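{- Let $n\ge 48$ and let $G$ be an $n$-vertex caterpillar with $r$ non-leaf vertices, where $r\ge (n-5)/2$, and whose non-leaf degrees $d_1\ge d_2\ge\cdots\ge d_r$ satisfy $d_1=d_3>d_4>2$. Then $G$ is reconstructible from its deck $\mathcal D(G)$: every graph $H$ with $\mathcal D(H)=\mathcal D(G)$ is isomorphic to $G$.
   Context: A caterpillar is a tree in which the subgraph induced by the non-leaf vertices is a path (the spine). For an $n$-vertex graph $G$, the deck $\mathcal D(G)$ is the multiset of all induced subgraphs of $G$ (each up to isomorphism) having at most $(n+2)/2$ vertices. -}

module Defs where

open import Data.Bool using (Bool; true; false; _∨_; T)
open import Data.Bool.Properties using (∨-comm)
open import Data.Nat using (ℕ; zero; suc; _≤_; _≤ᵇ_; _≡ᵇ_; _+_; _*_)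
open import Data.Nat.Properties using ()
open import Data.Fin using (Fin; toℕ)
open import Data.Fin.Subset using (Subset; _∈_; ∣_∣)
open import Data.Vec using (tabulate)
open import Data.List using (List; []; _∷_; _++_; [_]; length; map; filterᵇ)
open import Data.List.Relation.Unary.Unique.Propositional using (Unique)
open import Data.List.Relation.Unary.Linked using (Linked)
open import Data.Product using (Σ; _×_; proj₁; proj₂; _,_)
open import Data.Empty using (⊥)
open import Function.Bundles using (_⤖_; Bijection)
open import Relation.Binary.PropositionalEquality using (_≡_; refl)
open import Relation.Binary.Construct.Closure.ReflexiveTransitive using (Star)
open import Relation.Nullary using (¬_)

record Graph (V : Set) : Set where
  field
    adj    : V → V → Bool
    sym    : ∀ u v → adj u v ≡ adj v u
    irrefl : ∀ v → adj v v ≡ false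

open Graph public

Adj : {V : Set} → Graph V → V → V → Set
Adj G u v = adj G u v ≡ true

record _≅_ {V W : Set} (G : Graph V) (H : Graph W) : Set where
  field
    bij      : V ⤖ W
    preserve : ∀ u v → adj G u v ≡ adj H (Bijection.to bij u) (Bijection.to bij v)

Induced : {n : ℕ} → Graph (Fin n) → (S : Subset n) → Graph (Σ (Fin n) (λ v → v ∈ S))
Induced G S = record
  { adj = λ u v → adj G (proj₁ u) (proj₁ v)
  ; sym = λ u v → sym G (proj₁ u) (proj₁ v)
  ; irrefl = λ v → irrefl G (proj₁ v) }

DeckIndex : ℕ → Set
DeckIndex n = Σ (Subset n) (λ S → 2 * ∣ S ∣ ≤ n + 2)

-- D(G) = D(H) as multisets of isomorphism classes: a bijection between the
-- indexing families of the two decks matching isomorphic induced subgraphs.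
SameDeck : {n m : ℕ} → Graph (Fin n) → Graph (Fin m) → Set
SameDeck {n} {m} G H =
  Σ (DeckIndex n ⤖ DeckIndex m) λ σ →
    ∀ (i : DeckIndex n) →
      Induced G (proj₁ i) ≅ Induced H (proj₁ (Bijection.to σ i))

Connected : {V : Set} → Graph V → Set
Connected G = ∀ u v → Star (Adj G) u v

IsCycle : {V : Set} → Graph V → V → List V → Set
IsCycle G v vs = (2 ≤ length vs) × Unique (v ∷ vs) × Linked (Adj G) ((v ∷ vs) ++ [ v ])

IsTree : {V : Set} → Graph V → Set
IsTree G = Connected G × (∀ v vs → ¬ IsCycle G v vs)

allVerts : (n : ℕ) → List (Fin n)
allVerts n = Data.List.allFin n

deg : {n : ℕ} → Graph (Fin n) → Fin n → ℕ
deg {n} G v = length (filterᵇ (adj G v) (allVerts n))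

isNonLeaf : {n : ℕ} → Graph (Fin n) → Fin n → Bool
isNonLeaf G v = 2 ≤ᵇ deg G v

NonLeaves : {n : ℕ} → Graph (Fin n) → Subset n
NonLeaves G = tabulate (isNonLeaf G)

nonLeafDegrees : {n : ℕ} → Graph (Fin n) → List ℕ
nonLeafDegrees {n} G = map (deg G) (filterᵇ (isNonLeaf G) (allVerts n))

pathAdj : {k : ℕ} → Fin k → Fin k → Bool
pathAdj i j = (toℕ i ≡ᵇ suc (toℕ j)) ∨ (toℕ j ≡ᵇ suc (toℕ i))

private
  n≢ᵇsn : ∀ n → (n ≡ᵇ suc n) ≡ false
  n≢ᵇsn zero = refl
  n≢ᵇsn (suc n) = n≢ᵇsn n

PathGraph : (k : ℕ) → Graph (Fin k)
PathGraph k = record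
  { adj = pathAdj
  ; sym = λ i j → ∨-comm (toℕ i ≡ᵇ suc (toℕ j)) (toℕ j ≡ᵇ suc (toℕ i))
  ; irrefl = λ i → irr i }
  where
  irr : (i : Fin k) → pathAdj i i ≡ false
  irr i rewrite n≢ᵇsn (toℕ i) = refl

IsPathGraph : {V : Set} → Graph V → Set
IsPathGraph G = Σ ℕ λ k → G ≅ PathGraph k

IsCaterpillar : {n : ℕ} → Graph (Fin n) → Set
IsCaterpillar G = IsTree G × IsPathGraph (Induced G (NonLeaves G))

{-# OPTIONS --safe #-}
module Submission where

-- The deck determines every sum, over tuples of at most (n + 2)/2 vertices, of a quantity depending only on the
-- adjacencies and equalities inside the tuple.  Such sums give the number of nonbacktracking walks weighted by powers
-- of b = degree − 1 at chosen places.  Since b takes few values, the weight b at the starting vertex can be traded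
-- for the condition that this vertex is not a leaf (a moment argument).  On a caterpillar, the walks with program p minus
-- those with one more initial step then leave exactly the walks starting at the two ends of the spine.
--
-- In H this difference produces an end of a long path of nonleaf vertices; as H has no short cycle and the right
-- number of nonleaf vertices and of edges between them, its nonleaf vertices form a path of the same length r.
-- Reading the spine from both ends, with weights b₀, …, b_{r−1} and b*ᵢ = b_{r−1−i}, the deck gives bᵢ + b*ᵢ and
-- bᵢ bⱼ + b*ᵢ b*ⱼ away from the middle of the spine, hence the unordered pairs {bᵢ, b*ᵢ} and a common orientation of all of them.
-- For even r the middle pair is known from Σ b and Σ b², and is oriented by Σ bₖ bₖ₊δ for a suitable δ.

open import Defs hiding (sym)
open import Data.Bool using (Bool; true; false; _∧_; _∨_; not)
open import Data.Bool.Properties using (T-≡; T?; ∨-zeroʳ)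
open import Data.Empty using (⊥-elim)
open import Data.Fin using (Fin; zero; suc; toℕ; fromℕ<; inject≤; cast; _≟_)
open import Data.Fin.Properties using (toℕ-injective; toℕ<n; toℕ-fromℕ<; toℕ-cast; fromℕ<-toℕ; inject≤-injective; any?; injective⇒≤)
open import Data.Fin.Subset using (Subset; _∪_; ⁅_⁆; ∣_∣) renaming (_∈_ to _∈ˢ_; ⊥ to ∅)
open import Data.Fin.Subset.Properties using (∉⊥; ∣⊥∣≡0; x∈⁅x⁆; x∈⁅y⁆⇒x≡y; x∈p∪q⁺; x∈p∪q⁻; ⊆-antisym; ∪-identityˡ)
open import Data.List using (List; []; _∷_; _++_; [_]; length; map; filterᵇ; allFin; applyUpTo; cartesianProductWith; lookup)
open import Data.List.Properties using (map-++; map-∘; length-map; length-applyUpTo; applyUpTo-∷ʳ; length-++; length-tabulate; map-tabulate)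
open import Data.List.Membership.Propositional using (_∈_)
open import Data.List.Membership.Propositional.Properties using (∈-∃++; ∈-++⁺ˡ; ∈-++⁺ʳ; ∈-++⁻; ∈-allFin; ∈-cartesianProductWith⁺; ∈-filter⁺; ∈-filter⁻; ∈-lookup; ∈-map⁺; ∈-map⁻; ∈-tabulate⁻; ∈-applyUpTo⁻)
open import Data.List.Relation.Binary.Permutation.Propositional using (_↭_; ↭-sym)
open import Data.List.Relation.Binary.Permutation.Propositional.Properties using (↭-length; ∈-resp-↭)
open import Data.List.Relation.Unary.All using (All; []; _∷_)
import Data.List.Relation.Unary.All as All
open import Data.List.Relation.Unary.Any using (here; there; index)
open import Data.List.Relation.Unary.Any.Properties using (lookup-index)
open import Data.List.Relation.Unary.AllPairs using ([]; _∷_)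
open import Data.List.Relation.Unary.Linked using (Linked; []; _∷_)
import Data.List.Relation.Unary.Linked.Properties as Linkedₚ
open import Data.List.Relation.Unary.Unique.Propositional using (Unique)
import Data.List.Relation.Unary.Unique.Propositional.Properties as Uniqueₚ
open import Data.Nat using (ℕ; >-nonZero; zero; suc; pred; _+_; _*_; _∸_; _^_; _≤_; _<_; _<ᵇ_; _≡ᵇ_; z≤n; s≤s; s≤s⁻¹; _≤?_; _<?_)
open import Data.Nat.ListAction using () renaming (sum to sumᴸ)
open import Data.Nat.ListAction.Properties using (sum-++; sum-↭)
open import Data.Nat.Properties hiding (_≟_)
import Data.Nat.Properties as ℕ
open import Data.Nat.Induction using (<-rec)
open import Data.Nat.Tactic.RingSolver using (solve-∀)
import Algebra.Properties.Semiring.Sum +-*-semiring as Sum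
open import Data.Product using (Σ; ∃; ∃₂; _×_; _,_; proj₁; proj₂)
open import Data.Sum using (_⊎_; inj₁; inj₂; [_,_]′)
open import Data.Vec using (Vec; []; _∷_)
import Data.Vec as Vec
import Data.Vec.Properties as Vecₚ
open import Data.Vec.Properties.WithK using ([]=-irrelevant)
open import Function using (_∘_; id; case_of_)
open import Function.Bundles using (Bijection; mk⤖; Equivalence)
open import Relation.Binary.Construct.Closure.ReflexiveTransitive using (Star; ε; _◅_)
open import Relation.Binary.Definitions using (Tri; tri<; tri≈; tri>)
open import Relation.Binary.PropositionalEquality using (_≡_; _≢_; refl; sym; trans; cong; cong₂; subst; subst₂; module ≡-Reasoning)
open import Relation.Nullary using (¬_; Dec; yes; no; does)

-- The shape of the proof is dictated by a vertex budget. A walk program of length l is read off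
-- tuples of l + 3 vertices, and dropping the weight at its start costs K = M + 1 further vertices,
-- where M + 2 is the maximal degree. Comparing two spines up to position j therefore requires 2 (3
-- + K + 1 + j) ≤ n + 2. Counting leaves, three vertices of degree M + 2 and a fourth of degree at
-- least 3 force r + 3 M + 3 ≤ n. Together with M ≥ 2, which comes from d₃ > d₄ > 2, this pays for
-- every position with 2 j + 3 ≤ r. The one or two middle positions stay out of reach of such walks
-- and need the arguments by totals and correlations. The bound n ≤ 2 r + 5 keeps M below n / 6, so
-- that degrees, counts and a long path fit on a card. A second obstacle is that connectedness of
-- `H` is not visible on a card: a part of `H` away from the path could a priori contain a cycle too
-- long for any card. It is excluded by counting, since such a cycle and the path together would
-- need more than r nonleaf vertices.

⟦_⟧ : Bool → ℕ
⟦ true ⟧ = 1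
⟦ false ⟧ = 0

_==_ : ∀ {n} → Fin n → Fin n → Bool
x == y = does (x ≟ y)

==-refl : ∀ {n} (x : Fin n) → (x == x) ≡ true
==-refl x with x ≟ x
... | yes _ = refl
... | no x≢x = ⊥-elim (x≢x refl)

==-true : ∀ {n} {x y : Fin n} → x ≡ y → (x == y) ≡ true
==-true {x = x} refl = ==-refl x

==-≡ : ∀ {n} {x y : Fin n} → (x == y) ≡ true → x ≡ y
==-≡ {x = x} {y} e with x ≟ y
... | yes p = p
==-≡ () | no _

==-≢ : ∀ {n} {x y : Fin n} → x ≢ y → (x == y) ≡ false
==-≢ {x = x} {y} x≢y with x ≟ y
... | yes p = ⊥-elim (x≢y p)
... | no _ = refl

==-suc : ∀ {n} (x y : Fin n) → (Fin.suc x == suc y) ≡ (x == y)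
==-suc x y with x ≟ y
... | yes _ = refl
... | no _ = refl

⟦⟧-split : ∀ b c → ⟦ b ⟧ * c ≢ 0 → b ≡ true × c ≢ 0
⟦⟧-split true c h = refl , λ e → h (trans (+-identityʳ c) e)
⟦⟧-split false c h = ⊥-elim (h refl)

-- Finite sums

opaque

  sum : ∀ {n} → (Fin n → ℕ) → ℕ
  sum = Sum.sum

  sum-zero : ∀ {n} {f : Fin n → ℕ} → (∀ i → f i ≡ 0) → sum f ≡ 0
  sum-zero {zero} h = refl
  sum-zero {suc n} h = cong₂ _+_ (h zero) (sum-zero (h ∘ suc))

  sum-witness : ∀ {n} {f g : Fin n → ℕ} → sum g < sum f → ∃ λ i → g i < f i
  sum-witness {zero} ()
  sum-witness {suc n} {f} {g} lt with f zero ≤? g zero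
  ... | no f≰g = zero , ≰⇒> f≰g
  ... | yes f≤g with sum-witness {n} {f ∘ suc} {g ∘ suc}
          (≰⇒> λ le → <⇒≱ lt (+-mono-≤ f≤g le))
  ...   | i , lt′ = suc i , lt′

  sum-≢0 : ∀ {n} {f : Fin n → ℕ} → sum f ≢ 0 → ∃ λ i → f i ≢ 0
  sum-≢0 {n} {f} h with sum-witness {n} {f} {λ _ → 0}
    (subst (_< sum f) (sym (sum-zero {n} {λ _ → 0} λ _ → refl)) (n≢0⇒n>0 h))
  ... | i , lt = i , λ e → <⇒≢ lt (sym e)

  term≤sum : ∀ {n} (f : Fin n → ℕ) i → f i ≤ sum f
  term≤sum f zero = m≤m+n _ _
  term≤sum f (suc i) = ≤-trans (term≤sum (f ∘ suc) i) (m≤n+m _ _)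

  sum-const-1 : ∀ n → sum {n} (λ _ → 1) ≡ n
  sum-const-1 zero = refl
  sum-const-1 (suc n) = cong suc (sum-const-1 n)

  sum-cong-≗ : ∀ {n} {f g : Fin n → ℕ} → (∀ i → f i ≡ g i) → sum f ≡ sum g
  sum-cong-≗ = Sum.sum-cong-≗

  sum-δ : ∀ {n} (a : Fin n) (f : Fin n → ℕ) → sum (λ x → ⟦ x == a ⟧ * f x) ≡ f a
  sum-δ {suc n} zero f = trans (cong₂ _+_ (+-identityʳ _) (sum-zero {n} λ _ → refl)) (+-identityʳ _)
  sum-δ (suc a) f = trans (sum-cong-≗ λ x → cong (λ b → ⟦ b ⟧ * f (suc x)) (==-suc x a)) (sum-δ a (f ∘ suc))

  sum-swap : ∀ {m n} (f : Fin m → Fin n → ℕ) →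
    sum (λ i → sum (f i)) ≡ sum (λ j → sum (λ i → f i j))
  sum-swap f = Sum.∑-comm f

  sum-+ : ∀ {n} (f g : Fin n → ℕ) → sum (λ i → f i + g i) ≡ sum f + sum g
  sum-+ = Sum.∑-distrib-+

  sum-*ˡ : ∀ {n} c (f : Fin n → ℕ) → c * sum f ≡ sum (λ i → c * f i)
  sum-*ˡ = Sum.*-distribˡ-sum

  sum-*ʳ : ∀ {n} c (f : Fin n → ℕ) → sum f * c ≡ sum (λ i → f i * c)
  sum-*ʳ = Sum.*-distribʳ-sum

  sum-map-allFin : ∀ {n} (f : Fin n → ℕ) → sumᴸ (map f (allFin n)) ≡ sum f
  sum-map-allFin {n} f = trans (cong sumᴸ (map-tabulate id f)) (go f)
    where
    go : ∀ {n} (f : Fin n → ℕ) → sumᴸ (Data.List.tabulate f) ≡ sum f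
    go {zero} f = refl
    go {suc n} f = cong (f zero +_) (go (f ∘ suc))

module _ {A B : Set} (ι : A → B) (ι-inj : ∀ {x y} → ι x ≡ ι y → x ≡ y) (f : A → ℕ) (g : B → ℕ) where

  -- Induction on `xs`: the image of the head is cut out of `ys`, and uniqueness of `xs` together
  -- with injectivity of `ι` keeps the images of the tail inside what remains.
  sum-≤-injection : (xs : List A) (ys : List B) → Unique xs → (∀ {x} → x ∈ xs → ι x ∈ ys) →
    (∀ {x} → x ∈ xs → f x ≤ g (ι x)) → sumᴸ (map f xs) ≤ sumᴸ (map g ys)
  sum-≤-injection [] ys _ _ _ = z≤n
  sum-≤-injection (x ∷ xs) ys (x∉ ∷ u) mem le with ∈-∃++ (mem (here refl))
  ... | ys₁ , ys₂ , refl = begin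
    f x + sumᴸ (map f xs)  ≤⟨ +-mono-≤ (le (here refl)) (sum-≤-injection xs (ys₁ ++ ys₂) u mem′ (le ∘ there)) ⟩
    g (ι x) + sumᴸ (map g (ys₁ ++ ys₂))  ≡⟨ cong (λ l → g (ι x) + sumᴸ l) (map-++ g ys₁ ys₂) ⟩
    g (ι x) + sumᴸ (map g ys₁ ++ map g ys₂)       ≡⟨ cong (g (ι x) +_) (sum-++ (map g ys₁) _) ⟩
    g (ι x) + (sumᴸ (map g ys₁) + sumᴸ (map g ys₂)) ≡⟨ swap (g (ι x)) (sumᴸ (map g ys₁)) (sumᴸ (map g ys₂)) ⟩
    sumᴸ (map g ys₁) + (g (ι x) + sumᴸ (map g ys₂)) ≡⟨ sum-++ (map g ys₁) _ ⟨
    sumᴸ (map g ys₁ ++ g (ι x) ∷ map g ys₂)       ≡⟨ cong sumᴸ (map-++ g ys₁ (ι x ∷ ys₂)) ⟨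
    sumᴸ (map g (ys₁ ++ ι x ∷ ys₂))  ∎
    where
    open ≤-Reasoning
    swap : ∀ a b c → a + (b + c) ≡ b + (a + c)
    swap = solve-∀
    mem′ : ∀ {z} → z ∈ xs → ι z ∈ ys₁ ++ ys₂
    mem′ {z} z∈ with ∈-++⁻ ys₁ (mem (there z∈))
    ... | inj₁ p = ∈-++⁺ˡ p
    ... | inj₂ (here e) = ⊥-elim (All.lookup x∉ z∈ (sym (ι-inj e)))
    ... | inj₂ (there p) = ∈-++⁺ʳ ys₁ p

sum-unique-≤ : ∀ {n} (g : Fin n → ℕ) {xs : List (Fin n)} → Unique xs →
  sumᴸ (map g xs) ≤ sum g
sum-unique-≤ {n} g {xs} u = subst (sumᴸ (map g xs) ≤_) (sum-map-allFin g)
  (sum-≤-injection id id g g xs (allFin n) u (λ {x} _ → ∈-allFin x) (λ _ → ≤-refl))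

length-≤-sum : ∀ {n} (p : Fin n → Bool) {xs : List (Fin n)} → Unique xs →
  (∀ {x} → x ∈ xs → p x ≡ true) → length xs ≤ sum (⟦_⟧ ∘ p)
length-≤-sum p {xs} u h = ≤-trans (≤-reflexive (len xs h)) (sum-unique-≤ (⟦_⟧ ∘ p) u)
  where
  len : ∀ xs → (∀ {x} → x ∈ xs → p x ≡ true) → length xs ≡ sumᴸ (map (⟦_⟧ ∘ p) xs)
  len [] h = refl
  len (x ∷ xs) h = cong₂ _+_ (cong ⟦_⟧ (sym (h (here refl)))) (len xs (h ∘ there))

length-filterᵇ : ∀ {n} (p : Fin n → Bool) → length (filterᵇ p (allFin n)) ≡ sum (⟦_⟧ ∘ p)
length-filterᵇ {n} p = trans (go (allFin n)) (sum-map-allFin (⟦_⟧ ∘ p))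
  where
  go : ∀ xs → length (filterᵇ p xs) ≡ sumᴸ (map (⟦_⟧ ∘ p) xs)
  go [] = refl
  go (x ∷ xs) with p x
  ... | true = cong suc (go xs)
  ... | false = go xs

-- Carrying tuples of vertices from one deck to the other

≅-sym : {V W : Set} {G : Graph V} {H : Graph W} → G ≅ H → H ≅ G
≅-sym {V} {W} {G} {H} e = record
  { bij = mk⤖ {to = from} (from-injective , λ x → to x , λ { refl → injective (to-from (to x)) })
  ; preserve = λ u v → trans (sym (cong₂ (adj H) (to-from u) (to-from v))) (sym (_≅_.preserve e (from u) (from v)))
  }
  where
  open Bijection (_≅_.bij e) using (to; injective; surjective)
  from : W → V
  from y = proj₁ (surjective y)
  to-from : ∀ y → to (from y) ≡ y
  to-from y = proj₂ (surjective y) refl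
  from-injective : ∀ {x y} → from x ≡ from y → x ≡ y
  from-injective {x} {y} p = trans (sym (to-from x)) (trans (cong to p) (to-from y))

SameDeck-sym : ∀ {n m} {G : Graph (Fin n)} {H : Graph (Fin m)} → SameDeck G H → SameDeck H G
SameDeck-sym {n} {m} {G} {H} (σ , iso) =
  mk⤖ {to = from} (from-injective , λ x → to x , λ { refl → injective (to-from (to x)) }) ,
  λ i → ≅-sym (subst (λ j → Induced G (proj₁ (from i)) ≅ Induced H (proj₁ j)) (to-from i) (iso (from i)))
  where
  open Bijection σ using (to; injective; surjective)
  from : DeckIndex m → DeckIndex n
  from y = proj₁ (surjective y)
  to-from : ∀ y → to (from y) ≡ y
  to-from y = proj₂ (surjective y) refl
  from-injective : ∀ {x y} → from x ≡ from y → x ≡ y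
  from-injective {x} {y} p = trans (sym (to-from x)) (trans (cong to p) (to-from y))

Similar : ∀ {n m k} → Graph (Fin n) → Graph (Fin m) → Vec (Fin n) k → Vec (Fin m) k → Set
Similar {k = k} G H t t′ = ∀ (i j : Fin k) →
  adj G (Vec.lookup t i) (Vec.lookup t j) ≡ adj H (Vec.lookup t′ i) (Vec.lookup t′ j) ×
  (Vec.lookup t i == Vec.lookup t j) ≡ (Vec.lookup t′ i == Vec.lookup t′ j)

lookup-ext : ∀ {A : Set} {k} {t t′ : Vec A k} → (∀ i → Vec.lookup t i ≡ Vec.lookup t′ i) → t ≡ t′
lookup-ext {t = t} {t′} h = trans (sym (Vecₚ.tabulate∘lookup t)) (trans (Vecₚ.tabulate-cong h) (Vecₚ.tabulate∘lookup t′))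

image : ∀ {n k} → Vec (Fin n) k → Subset n
image [] = ∅
image (x ∷ xs) = ⁅ x ⁆ ∪ image xs

∈-image⁺ : ∀ {n k} (t : Vec (Fin n) k) i → Vec.lookup t i ∈ˢ image t
∈-image⁺ (x ∷ xs) zero = x∈p∪q⁺ (inj₁ (x∈⁅x⁆ x))
∈-image⁺ (x ∷ xs) (suc i) = x∈p∪q⁺ (inj₂ (∈-image⁺ xs i))

∈-image⁻ : ∀ {n k} (t : Vec (Fin n) k) {x} → x ∈ˢ image t → ∃ λ i → Vec.lookup t i ≡ x
∈-image⁻ [] x∈ = ⊥-elim (∉⊥ x∈)
∈-image⁻ (y ∷ ys) x∈ with x∈p∪q⁻ ⁅ y ⁆ (image ys) x∈
... | inj₁ p = zero , sym (x∈⁅y⁆⇒x≡y y p)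
... | inj₂ p with ∈-image⁻ ys p
...   | i , e = suc i , e

∣⁅x⁆∪p∣≤1+∣p∣ : ∀ {n} (x : Fin n) (p : Subset n) → ∣ ⁅ x ⁆ ∪ p ∣ ≤ suc ∣ p ∣
∣⁅x⁆∪p∣≤1+∣p∣ {suc n} zero (b ∷ p) = s≤s (≤-trans (≤-reflexive (cong ∣_∣ (∪-identityˡ p))) (tail≤ b))
  where
  tail≤ : ∀ b → ∣ p ∣ ≤ ∣ b ∷ p ∣
  tail≤ true = n≤1+n _
  tail≤ false = ≤-refl
∣⁅x⁆∪p∣≤1+∣p∣ (suc x) (true ∷ p) = s≤s (∣⁅x⁆∪p∣≤1+∣p∣ x p)
∣⁅x⁆∪p∣≤1+∣p∣ (suc x) (false ∷ p) = ∣⁅x⁆∪p∣≤1+∣p∣ x p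

∣image∣≤ : ∀ {n k} (t : Vec (Fin n) k) → ∣ image t ∣ ≤ k
∣image∣≤ {n} [] = ≤-reflexive (∣⊥∣≡0 n)
∣image∣≤ (x ∷ xs) = ≤-trans (∣⁅x⁆∪p∣≤1+∣p∣ x (image xs)) (s≤s (∣image∣≤ xs))

module _ {n m} {G : Graph (Fin n)} {H : Graph (Fin m)} (D : SameDeck G H) where

  private
    module σ = Bijection (proj₁ D)

  move : (i : DeckIndex n) {x : Fin n} → x ∈ˢ proj₁ i → Fin m
  move i {x} p = proj₁ (Bijection.to (_≅_.bij (proj₂ D i)) (x , p))

  move-∈ : ∀ i {x} (p : x ∈ˢ proj₁ i) → move i p ∈ˢ proj₁ (σ.to i)
  move-∈ i {x} p = proj₂ (Bijection.to (_≅_.bij (proj₂ D i)) (x , p))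

  move-injective : ∀ i {x y} (p : x ∈ˢ proj₁ i) (q : y ∈ˢ proj₁ i) → move i p ≡ move i q → x ≡ y
  move-injective i p q e = cong proj₁ (Bijection.injective (_≅_.bij (proj₂ D i)) (Σ-≡ e))
    where
    Σ-≡ : ∀ {S : Subset m} {a b : Σ (Fin m) (_∈ˢ S)} → proj₁ a ≡ proj₁ b → a ≡ b
    Σ-≡ {a = a , p} {b , q} refl = cong (a ,_) ([]=-irrelevant p q)

  move-onto : ∀ i {y} → y ∈ˢ proj₁ (σ.to i) → ∃ λ x → Σ (x ∈ˢ proj₁ i) λ p → move i p ≡ y
  move-onto i {y} y∈ with Bijection.surjective (_≅_.bij (proj₂ D i)) (y , y∈)
  ... | (x , p) , h = x , p , cong proj₁ (h refl)

  move-irrelevant : ∀ i {x y} (p : x ∈ˢ proj₁ i) (q : y ∈ˢ proj₁ i) → x ≡ y → move i p ≡ move i q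
  move-irrelevant i p q refl = cong (move i) ([]=-irrelevant p q)

  module _ {k} (small : 2 * k ≤ n + 2) where

    imageIndex : Vec (Fin n) k → DeckIndex n
    imageIndex t = image t , ≤-trans (*-monoʳ-≤ 2 (∣image∣≤ t)) small

    -- The entries are moved by the isomorphism between the card on the image of the tuple and its
    -- partner card. Repeated entries do no harm, because only the image has to be small.
    transport : Vec (Fin n) k → Vec (Fin m) k
    transport t = Vec.tabulate λ i → move (imageIndex t) (∈-image⁺ t i)

    lookup-transport : ∀ t i → Vec.lookup (transport t) i ≡ move (imageIndex t) (∈-image⁺ t i)
    lookup-transport t = Vecₚ.lookup∘tabulate _

    transport-similar : ∀ t → Similar G H t (transport t)
    transport-similar t i j
      rewrite lookup-transport t i | lookup-transport t j
      = _≅_.preserve (proj₂ D (imageIndex t)) _ _ , eq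
      where
      eq : (Vec.lookup t i == Vec.lookup t j) ≡ (move (imageIndex t) (∈-image⁺ t i) == move (imageIndex t) (∈-image⁺ t j))
      eq with Vec.lookup t i ≟ Vec.lookup t j
      ... | yes p = sym (==-true (move-irrelevant (imageIndex t) (∈-image⁺ t i) (∈-image⁺ t j) p))
      ... | no ¬p = sym (==-≢ λ e → ¬p (move-injective (imageIndex t) (∈-image⁺ t i) (∈-image⁺ t j) e))

    image-transport : ∀ t → image (transport t) ≡ proj₁ (σ.to (imageIndex t))
    image-transport t = ⊆-antisym to from
      where
      to : ∀ {y} → y ∈ˢ image (transport t) → y ∈ˢ proj₁ (σ.to (imageIndex t))
      to y∈ with ∈-image⁻ (transport t) y∈
      ... | i , refl = subst (_∈ˢ proj₁ (σ.to (imageIndex t))) (sym (lookup-transport t i)) (move-∈ _ (∈-image⁺ t i))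
      from : ∀ {y} → y ∈ˢ proj₁ (σ.to (imageIndex t)) → y ∈ˢ image (transport t)
      from y∈ with move-onto (imageIndex t) y∈
      ... | x , p , refl with ∈-image⁻ t p
      ...   | i , e = subst (_∈ˢ image (transport t))
                (trans (lookup-transport t i) (move-irrelevant _ (∈-image⁺ t i) p e))
                (∈-image⁺ (transport t) i)

    -- The image of the transported tuple is the whole partner card. It determines the original
    -- card, since the bijection of the decks is injective, and then the isomorphism on that card
    -- determines the entries.
    transport-injective : ∀ {t t′} → transport t ≡ transport t′ → t ≡ t′
    transport-injective {t} {t′} e = lookup-ext λ i →
      conclude (imageIndex t) (imageIndex t′) index≡ (∈-image⁺ t i) (∈-image⁺ t′ i)
        (trans (sym (lookup-transport t i)) (trans (cong (λ v → Vec.lookup v i) e) (lookup-transport t′ i)))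
      where
      DeckIndex-≡ : ∀ {k} {i j : DeckIndex k} → proj₁ i ≡ proj₁ j → i ≡ j
      DeckIndex-≡ {i = S , p} {.S , q} refl = cong (S ,_) (≤-irrelevant p q)
      index≡ : imageIndex t ≡ imageIndex t′
      index≡ = σ.injective (DeckIndex-≡ (trans (sym (image-transport t)) (trans (cong image e) (image-transport t′))))
      conclude : ∀ i j → i ≡ j → ∀ {x y} (p : x ∈ˢ proj₁ i) (q : y ∈ˢ proj₁ j) → move i p ≡ move j q → x ≡ y
      conclude i .i refl p q = move-injective i p q

-- A single vertex is always a card, so the transport of 1-tuples injects one vertex set into the
-- other.
SameDeck⇒≤ : ∀ {n m} {G : Graph (Fin n)} {H : Graph (Fin m)} → SameDeck G H → n ≤ m
SameDeck⇒≤ {n} {m} D = injective⇒≤ {f = λ x → Vec.head (transport D small (x ∷ []))}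
  λ {x} {y} e → cong Vec.head (transport-injective D small {x ∷ []} {y ∷ []} (head-≡ e))
  where
  small : 2 * 1 ≤ n + 2
  small = m≤n+m 2 n
  head-≡ : ∀ {A : Set} {v w : Vec A 1} → Vec.head v ≡ Vec.head w → v ≡ w
  head-≡ {v = a ∷ []} {b ∷ []} refl = refl

-- Sums over tuples are determined by the deck

tuples : ∀ n k → List (Vec (Fin n) k)
tuples n zero = [] ∷ []
tuples n (suc k) = cartesianProductWith _∷_ (allFin n) (tuples n k)

∈-tuples : ∀ {n k} (t : Vec (Fin n) k) → t ∈ tuples n k
∈-tuples [] = here refl
∈-tuples (x ∷ t) = ∈-cartesianProductWith⁺ _∷_ (∈-allFin x) (∈-tuples t)

tuples-unique : ∀ n k → Unique (tuples n k)
tuples-unique n zero = [] ∷ []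
tuples-unique n (suc k) = Uniqueₚ.cartesianProductWith⁺ _∷_ (λ { refl → refl , refl })
  (Uniqueₚ.allFin⁺ n) (tuples-unique n k)

sumᵀ : ∀ {n k} → (Vec (Fin n) k → ℕ) → ℕ
sumᵀ {k = zero} F = F []
sumᵀ {k = suc k} F = sum λ x → sumᵀ λ t → F (x ∷ t)

sum-map-tuples : ∀ {n k} (F : Vec (Fin n) k → ℕ) → sumᴸ (map F (tuples n k)) ≡ sumᵀ F
sum-map-tuples {k = zero} F = +-identityʳ _
sum-map-tuples {n} {suc k} F = trans (go (allFin n))
  (trans (sum-map-allFin λ x → sumᴸ (map (λ t → F (x ∷ t)) (tuples n k)))
    (sum-cong-≗ λ x → sum-map-tuples λ t → F (x ∷ t)))
  where
  go : ∀ xs → sumᴸ (map F (cartesianProductWith _∷_ xs (tuples n k))) ≡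
              sumᴸ (map (λ x → sumᴸ (map (λ t → F (x ∷ t)) (tuples n k))) xs)
  go [] = refl
  go (x ∷ xs) = trans (cong sumᴸ (map-++ F (map (x ∷_) (tuples n k)) _))
    (trans (sum-++ (map F (map (x ∷_) (tuples n k))) _)
      (cong₂ _+_ (cong sumᴸ (sym (map-∘ (tuples n k)))) (go xs)))

-- An injection of tuples gives only an inequality; `sumᵀ-≡` runs it in both directions instead of
-- inverting `transport`.
sumᵀ-≤ : ∀ {n m k} {G : Graph (Fin n)} {H : Graph (Fin m)} → SameDeck G H → 2 * k ≤ n + 2 →
  (F : Vec (Fin n) k → ℕ) (F′ : Vec (Fin m) k → ℕ) → (∀ t t′ → Similar G H t t′ → F t ≡ F′ t′) →
  sumᵀ F ≤ sumᵀ F′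
sumᵀ-≤ {n} {m} {k} D small F F′ inv = subst₂ _≤_ (sum-map-tuples F) (sum-map-tuples F′)
  (sum-≤-injection (transport D small) (transport-injective D small) F F′ (tuples n k) (tuples m k)
    (tuples-unique n k) (λ _ → ∈-tuples _) λ {t} _ → ≤-reflexive (inv t _ (transport-similar D small t)))

sumᵀ-≡ : ∀ {n k} {G H : Graph (Fin n)} → SameDeck G H → 2 * k ≤ n + 2 →
  (F F′ : Vec (Fin n) k → ℕ) → (∀ t t′ → Similar G H t t′ → F t ≡ F′ t′) → sumᵀ F ≡ sumᵀ F′
sumᵀ-≡ D small F F′ inv = ≤-antisym (sumᵀ-≤ D small F F′ inv)
  (sumᵀ-≤ (SameDeck-sym D) small F′ F λ t t′ s →
    sym (inv t′ t λ i j → sym (proj₁ (s i j)) , sym (proj₂ (s i j))))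

-- Weighted nonbacktracking walks

-- A walk is remembered by its current arc from u to v. `step` moves the arc onwards, while `fwd`
-- and `back` stay in place and multiply by the excess at the head v and at the tail u.
data Op : Set where
  step fwd back : Op

Program : Set
Program = List Op

-- The number of ways to leave a vertex entered along an edge without turning back, hence a count
-- over one more vertex. It is 0 exactly on leaves and isolated vertices.
excess : ∀ {n} → Graph (Fin n) → Fin n → ℕ
excess G v = pred (deg G v)

onward : ∀ {n} → Graph (Fin n) → Fin n → Fin n → Fin n → Bool
onward G u v x = adj G v x ∧ not (x == u)

-- The base value excess G v makes every walk ending in a leaf count zero.
walks : ∀ {n} → Graph (Fin n) → Program → Fin n → Fin n → ℕ
walks G [] u v = excess G v
walks G (step ∷ p) u v = sum λ x → ⟦ onward G u v x ⟧ * walks G p v x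
walks G (fwd ∷ p) u v = excess G v * walks G p u v
walks G (back ∷ p) u v = excess G u * walks G p u v

total : ∀ {n} → Graph (Fin n) → Program → ℕ
total G p = sum λ u → sum λ v → ⟦ adj G u v ⟧ * walks G p u v

deg-sum : ∀ {n} (G : Graph (Fin n)) v → deg G v ≡ sum λ x → ⟦ adj G v x ⟧
deg-sum G v = length-filterᵇ (adj G v)

deg≡1+onward : ∀ {n} (G : Graph (Fin n)) {u v} → adj G v u ≡ true →
  deg G v ≡ suc (sum λ x → ⟦ onward G u v x ⟧)
deg≡1+onward G {u} {v} a = begin
  deg G v  ≡⟨ deg-sum G v ⟩
  sum (λ x → ⟦ adj G v x ⟧)  ≡⟨ sum-cong-≗ split ⟩
  sum (λ x → ⟦ x == u ⟧ * ⟦ adj G v x ⟧ + ⟦ onward G u v x ⟧)    ≡⟨ sum-+ (λ x → ⟦ x == u ⟧ * ⟦ adj G v x ⟧) _ ⟩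
  sum (λ x → ⟦ x == u ⟧ * ⟦ adj G v x ⟧) + sum (λ x → ⟦ onward G u v x ⟧)
                ≡⟨ cong (_+ sum (λ x → ⟦ onward G u v x ⟧)) (trans (sum-δ u _) (cong ⟦_⟧ a)) ⟩
  suc (sum λ x → ⟦ onward G u v x ⟧)  ∎
  where
  open ≡-Reasoning
  split : ∀ x → ⟦ adj G v x ⟧ ≡ ⟦ x == u ⟧ * ⟦ adj G v x ⟧ + ⟦ onward G u v x ⟧
  split x with x == u | adj G v x
  ... | true | true = refl
  ... | true | false = refl
  ... | false | true = refl
  ... | false | false = refl

excess-onward : ∀ {n} (G : Graph (Fin n)) {u v} → adj G v u ≡ true →
  excess G v ≡ sum λ x → ⟦ onward G u v x ⟧
excess-onward G a = cong pred (deg≡1+onward G a)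

-- The vertices visited after u and v: one per operation, and one for the final factor excess.
trace : ∀ {n} → Graph (Fin n) → (p : Program) → Fin n → Fin n → Vec (Fin n) (suc (length p)) → ℕ
trace G [] u v (x ∷ []) = ⟦ onward G u v x ⟧
trace G (step ∷ p) u v (x ∷ t) = ⟦ onward G u v x ⟧ * trace G p v x t
trace G (fwd ∷ p) u v (x ∷ t) = ⟦ onward G u v x ⟧ * trace G p u v t
trace G (back ∷ p) u v (x ∷ t) = ⟦ onward G v u x ⟧ * trace G p u v t

sumᵀ-*ˡ : ∀ {n k} c (F : Vec (Fin n) k → ℕ) → c * sumᵀ F ≡ sumᵀ (λ t → c * F t)
sumᵀ-*ˡ {k = zero} c F = refl
sumᵀ-*ˡ {k = suc k} c F = trans (sum-*ˡ c _) (sum-cong-≗ λ x → sumᵀ-*ˡ c λ t → F (x ∷ t))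

sumᵀ-factor : ∀ {n k} (c : Fin n → ℕ) (F : Vec (Fin n) k → ℕ) →
  sum c * sumᵀ F ≡ sum λ x → sumᵀ λ t → c x * F t
sumᵀ-factor c F = trans (sum-*ʳ (sumᵀ F) c) (sum-cong-≗ λ x → sumᵀ-*ˡ (c x) F)

-- By `excess-onward` each factor `excess` is a sum over one more vertex, so the whole product
-- unfolds into a sum over tuples. The adjacency of u and v is what lets `excess` count onward
-- neighbours.
walks-trace : ∀ {n} (G : Graph (Fin n)) p u v → adj G u v ≡ true → walks G p u v ≡ sumᵀ (trace G p u v)
walks-trace G [] u v a = excess-onward G (trans (Graph.sym G v u) a)
walks-trace G (step ∷ p) u v a = sum-cong-≗ λ x → trans (next x) (sumᵀ-*ˡ ⟦ onward G u v x ⟧ (trace G p v x))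
  where
  next : ∀ x → ⟦ onward G u v x ⟧ * walks G p v x ≡ ⟦ onward G u v x ⟧ * sumᵀ (trace G p v x)
  next x with adj G v x in e
  ... | true = cong (⟦ not (x == u) ⟧ *_) (walks-trace G p v x e)
  ... | false = refl
walks-trace G (fwd ∷ p) u v a = trans
  (cong₂ _*_ (excess-onward G (trans (Graph.sym G v u) a)) (walks-trace G p u v a))
  (sumᵀ-factor (λ x → ⟦ onward G u v x ⟧) (trace G p u v))
walks-trace G (back ∷ p) u v a = trans
  (cong₂ _*_ (excess-onward G a) (walks-trace G p u v a))
  (sumᵀ-factor (λ x → ⟦ onward G v u x ⟧) (trace G p u v))

module _ {n m} (G : Graph (Fin n)) (H : Graph (Fin m)) where

  -- A vertex counted by `fwd` or `back` is not on the walk, so it is dropped before the rest of the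
  -- two traces is compared.
  delete-third : ∀ {k a b c a′ b′ c′} {t : Vec (Fin n) k} {t′ : Vec (Fin m) k} →
    Similar G H (a ∷ b ∷ c ∷ t) (a′ ∷ b′ ∷ c′ ∷ t′) → Similar G H (a ∷ b ∷ t) (a′ ∷ b′ ∷ t′)
  delete-third s zero zero = s zero zero
  delete-third s zero (suc zero) = s zero (suc zero)
  delete-third s zero (suc (suc j)) = s zero (suc (suc (suc j)))
  delete-third s (suc zero) zero = s (suc zero) zero
  delete-third s (suc zero) (suc zero) = s (suc zero) (suc zero)
  delete-third s (suc zero) (suc (suc j)) = s (suc zero) (suc (suc (suc j)))
  delete-third s (suc (suc i)) zero = s (suc (suc (suc i))) zero
  delete-third s (suc (suc i)) (suc zero) = s (suc (suc (suc i))) (suc zero)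
  delete-third s (suc (suc i)) (suc (suc j)) = s (suc (suc (suc i))) (suc (suc (suc j)))

  onward-similar : ∀ {u v x u′ v′ x′} → adj G v x ≡ adj H v′ x′ → (x == u) ≡ (x′ == u′) →
    ⟦ onward G u v x ⟧ ≡ ⟦ onward H u′ v′ x′ ⟧
  onward-similar e f = cong₂ (λ a b → ⟦ a ∧ not b ⟧) e f

  trace-similar : ∀ p {u v u′ v′ t t′} → Similar G H (u ∷ v ∷ t) (u′ ∷ v′ ∷ t′) →
    trace G p u v t ≡ trace H p u′ v′ t′
  trace-similar [] {t = x ∷ []} {x′ ∷ []} s =
    onward-similar (proj₁ (s (suc zero) (suc (suc zero)))) (proj₂ (s (suc (suc zero)) zero))
  trace-similar (step ∷ p) {t = x ∷ t} {x′ ∷ t′} s = cong₂ _*_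
    (onward-similar (proj₁ (s (suc zero) (suc (suc zero)))) (proj₂ (s (suc (suc zero)) zero)))
    (trace-similar p λ i j → s (suc i) (suc j))
  trace-similar (fwd ∷ p) {t = x ∷ t} {x′ ∷ t′} s = cong₂ _*_
    (onward-similar (proj₁ (s (suc zero) (suc (suc zero)))) (proj₂ (s (suc (suc zero)) zero)))
    (trace-similar p (delete-third s))
  trace-similar (back ∷ p) {t = x ∷ t} {x′ ∷ t′} s = cong₂ _*_
    (onward-similar (proj₁ (s zero (suc (suc zero)))) (proj₂ (s (suc (suc zero)) (suc zero))))
    (trace-similar p (delete-third s))

edgeTrace : ∀ {n} → Graph (Fin n) → (p : Program) → Vec (Fin n) (3 + length p) → ℕ
edgeTrace G p (u ∷ v ∷ t) = ⟦ adj G u v ⟧ * trace G p u v t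

total-trace : ∀ {n} (G : Graph (Fin n)) p → total G p ≡ sumᵀ (edgeTrace G p)
total-trace G p = sum-cong-≗ λ u → sum-cong-≗ λ v → trans (next u v) (sumᵀ-*ˡ ⟦ adj G u v ⟧ (trace G p u v))
  where
  next : ∀ u v → ⟦ adj G u v ⟧ * walks G p u v ≡ ⟦ adj G u v ⟧ * sumᵀ (trace G p u v)
  next u v with adj G u v in e
  ... | true = cong (_+ 0) (walks-trace G p u v e)
  ... | false = refl

-- The 3 accounts for both ends of the first arc and for the vertex that counts the final factor
-- `excess`.
total-≡ : ∀ {n} {G H : Graph (Fin n)} → SameDeck G H → ∀ p → 2 * (3 + length p) ≤ n + 2 → total G p ≡ total H p
total-≡ {G = G} {H} D p small = begin
  total G p  ≡⟨ total-trace G p ⟩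
  sumᵀ (edgeTrace G p)  ≡⟨ sumᵀ-≡ D small (edgeTrace G p) (edgeTrace H p) same ⟩
  sumᵀ (edgeTrace H p)  ≡⟨ total-trace H p ⟨
  total H p  ∎
  where
  open ≡-Reasoning
  same : ∀ t t′ → Similar G H t t′ → edgeTrace G p t ≡ edgeTrace H p t′
  same (u ∷ v ∷ t) (u′ ∷ v′ ∷ t′) s = cong₂ _*_ (cong ⟦_⟧ (proj₁ (s zero (suc zero)))) (trace-similar G H p s)

edges : ∀ {n} → Graph (Fin n) → ℕ
edges G = sum λ u → sum λ v → ⟦ adj G u v ⟧

edges-≡ : ∀ {n} {G H : Graph (Fin n)} → SameDeck G H → 2 ≤ n → edges G ≡ edges H
edges-≡ {n} {G} {H} D 2≤n = sumᵀ-≡ D (+-monoˡ-≤ 2 2≤n) (F G) (F H) same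
  where
  F : Graph (Fin n) → Vec (Fin n) 2 → ℕ
  F G (u ∷ v ∷ []) = ⟦ adj G u v ⟧
  same : ∀ t t′ → Similar G H t t′ → F G t ≡ F H t′
  same (u ∷ v ∷ []) (u′ ∷ v′ ∷ []) s = cong ⟦_⟧ (proj₁ (s zero (suc zero)))

-- The moment argument

≡ᵇ-refl : ∀ k → (k ≡ᵇ k) ≡ true
≡ᵇ-refl zero = refl
≡ᵇ-refl (suc k) = ≡ᵇ-refl k

≡ᵇ-≢ : ∀ {k l} → k ≢ l → (k ≡ᵇ l) ≡ false
≡ᵇ-≢ {zero} {zero} h = ⊥-elim (h refl)
≡ᵇ-≢ {zero} {suc l} h = refl
≡ᵇ-≢ {suc k} {zero} h = refl
≡ᵇ-≢ {suc k} {suc l} h = ≡ᵇ-≢ (h ∘ cong suc)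

*-factor≢0 : ∀ a b → a * b ≢ 0 → a ≢ 0 × b ≢ 0
*-factor≢0 a b h = (λ { refl → h refl }) , λ { refl → h (*-zeroʳ a) }

mass : ∀ {n} → (Fin n → ℕ) → (Fin n → ℕ) → ℕ → ℕ
mass b f j = sum λ u → ⟦ b u ≡ᵇ j ⟧ * f u

byValue : (ℕ → ℕ) → (ℕ → ℕ) → ℕ → ℕ
byValue h X zero = h 0 * X 0
byValue h X (suc K) = byValue h X K + h (suc K) * X (suc K)

byValue-point : ∀ h K {c} y → c ≤ K → byValue h (λ j → ⟦ c ≡ᵇ j ⟧ * y) K ≡ h c * y
byValue-point h zero y z≤n = cong (h 0 *_) (+-identityʳ y)
byValue-point h (suc K) {c} y c≤ with c ≤? K
... | yes le = trans (cong₂ _+_ (byValue-point h K y le)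
        (trans (cong (λ b → h (suc K) * (⟦ b ⟧ * y)) (≡ᵇ-≢ {c} {suc K} λ { refl → 1+n≰n le })) (*-zeroʳ (h (suc K)))))
        (+-identityʳ _)
... | no nle with ≤-antisym c≤ (≰⇒> nle)
...   | refl = cong₂ _+_ (vanish K (≤-refl {suc K}))
          (cong (h (suc K) *_) (trans (cong (λ b → ⟦ b ⟧ * y) (≡ᵇ-refl K)) (+-identityʳ y)))
  where
  vanish : ∀ K {c} → K < c → byValue h (λ j → ⟦ c ≡ᵇ j ⟧ * y) K ≡ 0
  vanish zero {suc c} lt = *-zeroʳ (h 0)
  vanish (suc K) {c} lt = cong₂ _+_ (vanish K (≤-trans (n≤1+n _) lt))
    (trans (cong (λ b → h (suc K) * (⟦ b ⟧ * y)) (≡ᵇ-≢ {c} {suc K} (<⇒≢ lt ∘ sym))) (*-zeroʳ (h (suc K))))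

sum-byValue : ∀ {n} h (X : Fin n → ℕ → ℕ) K → sum (λ u → byValue h (X u) K) ≡ byValue h (λ j → sum λ u → X u j) K
sum-byValue h X zero = sym (sum-*ˡ (h 0) _)
sum-byValue h X (suc K) = trans (sum-+ (λ u → byValue h (X u) K) _)
  (cong₂ _+_ (sum-byValue h X K) (sym (sum-*ˡ (h (suc K)) _)))

-- The bound on `b` is demanded only where `f` is nonzero, because the reweighting in `mass-≡`
-- lowers the bound by making `f` vanish at the top value.
sum-by-mass : ∀ {n} (b f : Fin n → ℕ) h K → (∀ u → f u ≢ 0 → b u ≤ K) →
  sum (λ u → h (b u) * f u) ≡ byValue h (mass b f) K
sum-by-mass b f h K supp = trans (sum-cong-≗ point) (sum-byValue h _ K)
  where
  zeros : ∀ u K → f u ≡ 0 → byValue h (λ j → ⟦ b u ≡ᵇ j ⟧ * f u) K ≡ 0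
  zeros u zero e rewrite e | *-zeroʳ ⟦ b u ≡ᵇ 0 ⟧ = *-zeroʳ (h 0)
  zeros u (suc K) e rewrite zeros u K e | e | *-zeroʳ ⟦ b u ≡ᵇ suc K ⟧ = *-zeroʳ (h (suc K))
  point : ∀ u → h (b u) * f u ≡ byValue h (λ j → ⟦ b u ≡ᵇ j ⟧ * f u) K
  point u with f u ℕ.≟ 0
  ... | yes e = trans (trans (cong (h (b u) *_) e) (*-zeroʳ (h (b u)))) (sym (zeros u K e))
  ... | no ne = sym (byValue-point h K (f u) (supp u ne))

byValue-cong : ∀ h (X Y : ℕ → ℕ) K → h 0 ≡ 0 → (∀ j → 1 ≤ j → j ≤ K → X j ≡ Y j) → byValue h X K ≡ byValue h Y K
byValue-cong h X Y zero h0 e rewrite h0 = refl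
byValue-cong h X Y (suc K) h0 e = cong₂ _+_
  (byValue-cong h X Y K h0 λ j l u → e j l (≤-trans u (n≤1+n K)))
  (cong (h (suc K) *_) (e (suc K) (s≤s z≤n) ≤-refl))

module _ {n m} (b : Fin n → ℕ) (b′ : Fin m → ℕ) where

  -- Weighting by (suc K ∸ b) removes the top value suc K from the support at the cost of one moment.
  mass-≡ : ∀ K (f : Fin n → ℕ) (f′ : Fin m → ℕ) →
    (∀ u → f u ≢ 0 → b u ≤ K) → (∀ u → f′ u ≢ 0 → b′ u ≤ K) →
    (∀ s → s < K → sum (λ u → b u ^ suc s * f u) ≡ sum (λ u → b′ u ^ suc s * f′ u)) →
    ∀ j → 1 ≤ j → j ≤ K → mass b f j ≡ mass b′ f′ j
  mass-≡ zero f f′ _ _ _ zero () _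
  mass-≡ zero f f′ _ _ _ (suc j) _ ()
  mass-≡ (suc K) f f′ supp supp′ mom = masses
    where
    weight : ∀ {l} → (Fin l → ℕ) → (Fin l → ℕ) → Fin l → ℕ
    weight b f u = (suc K ∸ b u) * f u

    weight-supp : ∀ {l} (b f : Fin l → ℕ) → (∀ u → f u ≢ 0 → b u ≤ suc K) → ∀ u → weight b f u ≢ 0 → b u ≤ K
    weight-supp b f supp u ne with b u ≤? K
    ... | yes le = le
    ... | no nle = ⊥-elim (proj₁ (*-factor≢0 _ _ ne) (m≤n⇒m∸n≡0 (≰⇒> nle)))

    -- This is b^(s+1) (K + 1 - b) = (K + 1) b^(s+1) - b^(s+2) without subtraction; the truncated
    -- difference is exact on the support of `f`.
    weight-moment : ∀ {l} (b f : Fin l → ℕ) → (∀ u → f u ≢ 0 → b u ≤ suc K) → ∀ s →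
      sum (λ u → b u ^ suc s * weight b f u) + sum (λ u → b u ^ suc (suc s) * f u) ≡
      suc K * sum (λ u → b u ^ suc s * f u)
    weight-moment b f supp s = trans (sym (sum-+ (λ u → b u ^ suc s * weight b f u) _))
      (trans (sum-cong-≗ point) (sym (sum-*ˡ (suc K) _)))
      where
      regroup : ∀ B p x d → (B * p) * (d * x) + (B * (B * p)) * x ≡ (d + B) * ((B * p) * x)
      regroup = solve-∀
      point : ∀ u → b u ^ suc s * weight b f u + b u ^ suc (suc s) * f u ≡ suc K * (b u ^ suc s * f u)
      point u with f u ℕ.≟ 0
      ... | yes e rewrite e | *-zeroʳ (suc K ∸ b u) | *-zeroʳ (b u * b u ^ s) | *-zeroʳ (b u * (b u * b u ^ s))
        | *-zeroʳ (suc K) = refl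
      ... | no ne = trans (regroup (b u) (b u ^ s) (f u) (suc K ∸ b u))
              (cong (_* (b u ^ suc s * f u)) (m∸n+n≡m (supp u ne)))

    weight-mass : ∀ {l} (b f : Fin l → ℕ) j → mass b (weight b f) j ≡ (suc K ∸ j) * mass b f j
    weight-mass b f j = trans (sum-cong-≗ point) (sym (sum-*ˡ (suc K ∸ j) _))
      where
      regroup : ∀ d x → 1 * (d * x) ≡ d * (1 * x)
      regroup = solve-∀
      point : ∀ u → ⟦ b u ≡ᵇ j ⟧ * weight b f u ≡ (suc K ∸ j) * (⟦ b u ≡ᵇ j ⟧ * f u)
      point u with b u ℕ.≟ j
      ... | yes e rewrite e | ≡ᵇ-refl j = regroup (suc K ∸ j) (f u)
      ... | no ne rewrite ≡ᵇ-≢ ne = sym (*-zeroʳ (suc K ∸ j))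

    low : ∀ j → 1 ≤ j → j ≤ K → mass b f j ≡ mass b′ f′ j
    low j 1≤j j≤K = *-cancelˡ-≡ _ _ (suc K ∸ j) ⦃ >-nonZero (m<n⇒0<n∸m (s≤s j≤K)) ⦄ (begin
      (suc K ∸ j) * mass b f j      ≡⟨ weight-mass b f j ⟨
      mass b (weight b f) j  ≡⟨ mass-≡ K (weight b f) (weight b′ f′) (weight-supp b f supp) (weight-supp b′ f′ supp′) moments j 1≤j j≤K ⟩
      mass b′ (weight b′ f′) j      ≡⟨ weight-mass b′ f′ j ⟩
      (suc K ∸ j) * mass b′ f′ j    ∎)
      where
      open ≡-Reasoning
      moments : ∀ s → s < K → sum (λ u → b u ^ suc s * weight b f u) ≡ sum (λ u → b′ u ^ suc s * weight b′ f′ u)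
      moments s lt = +-cancelʳ-≡ _ _ _ (trans (weight-moment b f supp s)
        (trans (cong (suc K *_) (mom s (≤-trans lt (n≤1+n K))))
          (trans (sym (weight-moment b′ f′ supp′ s)) (cong (sum (λ u → b′ u ^ suc s * weight b′ f′ u) +_) (sym (mom (suc s) (s≤s lt)))))))

    -- Once the lower masses are known, the first moment leaves only the top term, whose coefficient
    -- `suc K` can be cancelled.
    top : mass b f (suc K) ≡ mass b′ f′ (suc K)
    top = *-cancelˡ-≡ _ _ (suc K) (+-cancelˡ-≡ (byValue id (mass b f) K) _ _ (begin
      byValue id (mass b f) (suc K)     ≡⟨ sum-by-mass b f id (suc K) supp ⟨
      sum (λ u → b u * f u)  ≡⟨ sum-cong-≗ (λ u → cong (_* f u) (sym (*-identityʳ (b u)))) ⟩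
      sum (λ u → b u ^ 1 * f u)  ≡⟨ mom 0 (s≤s z≤n) ⟩
      sum (λ u → b′ u ^ 1 * f′ u)       ≡⟨ sum-cong-≗ (λ u → cong (_* f′ u) (*-identityʳ (b′ u))) ⟩
      sum (λ u → b′ u * f′ u)  ≡⟨ sum-by-mass b′ f′ id (suc K) supp′ ⟩
      byValue id (mass b′ f′) (suc K)   ≡⟨ cong (_+ suc K * mass b′ f′ (suc K)) (byValue-cong id (mass b f) (mass b′ f′) K refl low) ⟨
      byValue id (mass b f) K + suc K * mass b′ f′ (suc K) ∎))
      where open ≡-Reasoning

    masses : ∀ j → 1 ≤ j → j ≤ suc K → mass b f j ≡ mass b′ f′ j
    masses j 1≤j j≤ with j ≤? K
    ... | yes le = low j 1≤j le
    ... | no nle with ≤-antisym j≤ (≰⇒> nle)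
    ...   | refl = top

  -- Moments with positive exponent do not see where `b` is 0, so the mass there stays unknown and
  -- `h 0 ≡ 0` is required.
  moments-determine : ∀ K (f : Fin n → ℕ) (f′ : Fin m → ℕ) → (∀ u → b u ≤ K) → (∀ u → b′ u ≤ K) →
    (∀ s → s < K → sum (λ u → b u ^ suc s * f u) ≡ sum (λ u → b′ u ^ suc s * f′ u)) →
    ∀ h → h 0 ≡ 0 → sum (λ u → h (b u) * f u) ≡ sum (λ u → h (b′ u) * f′ u)
  moments-determine K f f′ le le′ mom h h0 = trans (sum-by-mass b f h K λ u _ → le u)
    (trans (byValue-cong h (mass b f) (mass b′ f′) K h0 (mass-≡ K f f′ (λ u _ → le u) (λ u _ → le′ u) mom))
      (sym (sum-by-mass b′ f′ h K λ u _ → le′ u)))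

-- Trading weights for the nonleaf condition

positive : ℕ → ℕ
positive zero = 0
positive (suc _) = 1

isNonLeaf-excess : ∀ {n} (G : Graph (Fin n)) v → ⟦ isNonLeaf G v ⟧ ≡ positive (excess G v)
isNonLeaf-excess G v with deg G v
... | zero = refl
... | suc zero = refl
... | suc (suc _) = refl

sumFrom : ∀ {n} → Graph (Fin n) → Program → Fin n → ℕ
sumFrom G p u = sum λ v → ⟦ adj G u v ⟧ * walks G p u v

nonLeafTotal : ∀ {n} → Graph (Fin n) → Program → ℕ
nonLeafTotal G p = sum λ u → ⟦ isNonLeaf G u ⟧ * sumFrom G p u

backs : ℕ → Program → Program
backs zero p = p
backs (suc s) p = back ∷ backs s p

fwds : ℕ → Program
fwds zero = []
fwds (suc s) = fwd ∷ fwds s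

length-backs : ∀ s p → length (backs s p) ≡ s + length p
length-backs zero p = refl
length-backs (suc s) p = cong suc (length-backs s p)

length-fwds : ∀ s → length (fwds s) ≡ s
length-fwds zero = refl
length-fwds (suc s) = cong suc (length-fwds s)

walks-backs : ∀ {n} (G : Graph (Fin n)) s p u v → walks G (backs s p) u v ≡ excess G u ^ s * walks G p u v
walks-backs G zero p u v = sym (+-identityʳ _)
walks-backs G (suc s) p u v = trans (cong (excess G u *_) (walks-backs G s p u v)) (sym (*-assoc (excess G u) _ _))

walks-fwds : ∀ {n} (G : Graph (Fin n)) s u v → walks G (fwds s) u v ≡ excess G v ^ suc s
walks-fwds G zero u v = sym (*-identityʳ _)
walks-fwds G (suc s) u v = cong (excess G v *_) (walks-fwds G s u v)

*-swapˡ : ∀ a b c → a * (b * c) ≡ b * (a * c)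
*-swapˡ = solve-∀

total-backs : ∀ {n} (G : Graph (Fin n)) s p → total G (backs s p) ≡ sum λ u → excess G u ^ s * sumFrom G p u
total-backs G s p = sum-cong-≗ λ u → trans
  (sum-cong-≗ λ v → trans (cong (⟦ adj G u v ⟧ *_) (walks-backs G s p u v)) (*-swapˡ ⟦ adj G u v ⟧ (excess G u ^ s) _))
  (sym (sum-*ˡ (excess G u ^ s) _))

-- The tail of the arc is free and contributes the factor `deg G v`, so the deck yields moments
-- weighted by the degree rather than by 1.
total-fwds : ∀ {n} (G : Graph (Fin n)) s → total G (fwds s) ≡ sum λ v → excess G v ^ suc s * deg G v
total-fwds G s = begin
  total G (fwds s)  ≡⟨ sum-cong-≗ (λ u → sum-cong-≗ λ v →
                cong₂ (λ a w → ⟦ a ⟧ * w) (Graph.sym G u v) (walks-fwds G s u v)) ⟩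
  sum (λ u → sum λ v → ⟦ adj G v u ⟧ * excess G v ^ suc s)  ≡⟨ sum-swap _ ⟩
  sum (λ v → sum λ u → ⟦ adj G v u ⟧ * excess G v ^ suc s)  ≡⟨ sum-cong-≗ (λ v → sym (trans
                (cong (excess G v ^ suc s *_) (deg-sum G v))
                (trans (sum-*ˡ (excess G v ^ suc s) _)
                (sum-cong-≗ λ u → *-comm (excess G v ^ suc s) _)))) ⟩
  sum (λ v → excess G v ^ suc s * deg G v)  ∎
  where open ≡-Reasoning

-- A linear inequality from hypotheses added up in x ≤ y, with slack e, as an identity for the ring solver.
≤-linear : ∀ {a b x y} d e → x ≤ y → suc d * a + y + e ≡ suc d * b + x → a ≤ b
≤-linear {a} {b} {x} {y} d e x≤y eq = *-cancelˡ-≤ (suc d) (+-cancelʳ-≤ y _ _ (begin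
  suc d * a + y       ≤⟨ m≤m+n _ e ⟩
  suc d * a + y + e   ≡⟨ eq ⟩
  suc d * b + x       ≤⟨ +-monoʳ-≤ (suc d * b) x≤y ⟩
  suc d * b + y       ∎))
  where open ≤-Reasoning

module _ {n} {G H : Graph (Fin n)} (D : SameDeck G H) {K} (≤K : ∀ v → excess G v ≤ K) (≤K′ : ∀ v → excess H v ≤ K) where

  total-≡′ : ∀ p k → length p ≤ k → 2 * (3 + k) ≤ n + 2 → total G p ≡ total H p
  total-≡′ p k le small = total-≡ D p (≤-trans (*-monoʳ-≤ 2 (+-monoʳ-≤ 3 le)) small)

  -- The moments are the totals of `backs s p` for s from 1 to K; the longest of these programs is
  -- where the K further vertices go.
  nonLeafTotal-≡ : ∀ p → 2 * (3 + (K + length p)) ≤ n + 2 → nonLeafTotal G p ≡ nonLeafTotal H p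
  nonLeafTotal-≡ p small = begin
    nonLeafTotal G p  ≡⟨ sum-cong-≗ (λ u → cong (_* sumFrom G p u) (isNonLeaf-excess G u)) ⟩
    sum (λ u → positive (excess G u) * sumFrom G p u)       ≡⟨ moments-determine (excess G) (excess H) K (sumFrom G p) (sumFrom H p) ≤K ≤K′ moments positive refl ⟩
    sum (λ u → positive (excess H u) * sumFrom H p u)       ≡⟨ sum-cong-≗ (λ u → cong (_* sumFrom H p u) (isNonLeaf-excess H u)) ⟨
    nonLeafTotal H p  ∎
    where
    open ≡-Reasoning
    moments : ∀ s → s < K → sum (λ u → excess G u ^ suc s * sumFrom G p u) ≡ sum (λ u → excess H u ^ suc s * sumFrom H p u)
    moments s lt = trans (sym (total-backs G (suc s) p)) (trans
      (total-≡′ (backs (suc s) p) (K + length p)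
        (≤-trans (≤-reflexive (length-backs (suc s) p)) (+-monoˡ-≤ (length p) lt)) small)
      (total-backs H (suc s) p))

  private
    degree-moments : 2 * (3 + K) ≤ n + 2 → ∀ s → s < K →
      sum (λ v → excess G v ^ suc s * deg G v) ≡ sum (λ v → excess H v ^ suc s * deg H v)
    degree-moments small s lt = trans (sym (total-fwds G s)) (trans
      (total-≡′ (fwds s) K (≤-trans (≤-reflexive (length-fwds s)) (<⇒≤ lt)) small)
      (total-fwds H s))

  nonLeafDegreeSum-≡ : 2 * (3 + K) ≤ n + 2 →
    sum (λ v → ⟦ isNonLeaf G v ⟧ * deg G v) ≡ sum (λ v → ⟦ isNonLeaf H v ⟧ * deg H v)
  nonLeafDegreeSum-≡ small = trans
    (sum-cong-≗ λ v → cong (_* deg G v) (isNonLeaf-excess G v)) (trans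
    (moments-determine (excess G) (excess H) K (deg G) (deg H) ≤K ≤K′ (degree-moments small) positive refl)
    (sum-cong-≗ λ v → cong (_* deg H v) (sym (isNonLeaf-excess H v))))

  -- The available moments carry the factor `deg`. On the vertices of a fixed positive excess it is
  -- constant, so it can be divided out mass by mass.
  nonLeafCount-≡ : 2 * (3 + K) ≤ n + 2 → sum (λ v → ⟦ isNonLeaf G v ⟧) ≡ sum (λ v → ⟦ isNonLeaf H v ⟧)
  nonLeafCount-≡ small = trans (byMass G ≤K) (trans
    (byValue-cong positive (mass (excess G) (λ _ → 1)) (mass (excess H) (λ _ → 1)) K refl masses)
    (sym (byMass H ≤K′)))
    where
    byMass : ∀ (G : Graph (Fin n)) → (∀ v → excess G v ≤ K) →
      sum (λ v → ⟦ isNonLeaf G v ⟧) ≡ byValue positive (mass (excess G) (λ _ → 1)) K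
    byMass G ≤K = trans (sum-cong-≗ λ v → trans (isNonLeaf-excess G v) (sym (*-identityʳ _)))
      (sum-by-mass (excess G) (λ _ → 1) positive K λ v _ → ≤K v)
    degreeMass : ∀ (G : Graph (Fin n)) j → mass (excess G) (deg G) (suc j) ≡ suc (suc j) * mass (excess G) (λ _ → 1) (suc j)
    degreeMass G j = trans (sum-cong-≗ point) (sym (sum-*ˡ (suc (suc j)) _))
      where
      point : ∀ v → ⟦ excess G v ≡ᵇ suc j ⟧ * deg G v ≡ suc (suc j) * (⟦ excess G v ≡ᵇ suc j ⟧ * 1)
      point v with deg G v
      ... | zero = sym (*-zeroʳ (suc (suc j)))
      ... | suc d with d ℕ.≟ suc j
      ...   | yes refl rewrite ≡ᵇ-refl j = trans (+-identityʳ _) (sym (*-identityʳ _))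
      ...   | no ne rewrite ≡ᵇ-≢ ne = sym (*-zeroʳ (suc (suc j)))
    masses : ∀ j → 1 ≤ j → j ≤ K → mass (excess G) (λ _ → 1) j ≡ mass (excess H) (λ _ → 1) j
    masses (suc j) l u = *-cancelˡ-≡ _ _ (suc (suc j)) (trans (sym (degreeMass G j)) (trans
      (mass-≡ (excess G) (excess H) K (deg G) (deg H) (λ v _ → ≤K v) (λ v _ → ≤K′ v) (degree-moments small) (suc j) l u)
      (degreeMass H j)))

nonLeafPairs : ∀ {n} → Graph (Fin n) → ℕ
nonLeafPairs G = sum λ v → ⟦ isNonLeaf G v ⟧ * sum λ u → ⟦ isNonLeaf G u ⟧ * ⟦ adj G u v ⟧

-- The moment argument is applied twice, to the tail of an arc and then to its head, hence K + K in
-- the budget.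
nonLeafPairs-≡ : ∀ {n} {G H : Graph (Fin n)} → SameDeck G H → ∀ {K} → (∀ v → excess G v ≤ K) → (∀ v → excess H v ≤ K) →
  2 * (3 + (K + K)) ≤ n + 2 → nonLeafPairs G ≡ nonLeafPairs H
nonLeafPairs-≡ {n} {G} {H} D {K} ≤K ≤K′ small = trans
  (sum-cong-≗ λ v → cong (_* nbrs G v) (isNonLeaf-excess G v)) (trans
  (moments-determine (excess G) (excess H) K (nbrs G) (nbrs H) ≤K ≤K′ moments positive refl)
  (sum-cong-≗ λ v → cong (_* nbrs H v) (sym (isNonLeaf-excess H v))))
  where
  nbrs : Graph (Fin n) → Fin n → ℕ
  nbrs G v = sum λ u → ⟦ isNonLeaf G u ⟧ * ⟦ adj G u v ⟧
  moment : ∀ (G : Graph (Fin n)) s → nonLeafTotal G (fwds s) ≡ sum λ v → excess G v ^ suc s * nbrs G v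
  moment G s = begin
    nonLeafTotal G (fwds s)  ≡⟨ sum-cong-≗ (λ u → sum-*ˡ ⟦ isNonLeaf G u ⟧ _) ⟩
    sum (λ u → sum λ v → ⟦ isNonLeaf G u ⟧ * (⟦ adj G u v ⟧ * walks G (fwds s) u v))       ≡⟨ sum-swap _ ⟩
    sum (λ v → sum λ u → ⟦ isNonLeaf G u ⟧ * (⟦ adj G u v ⟧ * walks G (fwds s) u v))       ≡⟨ sum-cong-≗ (λ v → trans
      (sum-cong-≗ λ u → trans (cong (λ w → ⟦ isNonLeaf G u ⟧ * (⟦ adj G u v ⟧ * w)) (walks-fwds G s u v))
        (regroup ⟦ isNonLeaf G u ⟧ ⟦ adj G u v ⟧ (excess G v ^ suc s)))
      (sym (sum-*ˡ (excess G v ^ suc s) _))) ⟩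
    sum (λ v → excess G v ^ suc s * nbrs G v)  ∎
    where
    open ≡-Reasoning
    regroup : ∀ a b c → a * (b * c) ≡ c * (a * b)
    regroup = solve-∀
  moments : ∀ s → s < K → sum (λ v → excess G v ^ suc s * nbrs G v) ≡ sum (λ v → excess H v ^ suc s * nbrs H v)
  moments s lt = trans (sym (moment G s)) (trans
    (nonLeafTotal-≡ D ≤K ≤K′ (fwds s) (≤-trans (*-monoʳ-≤ 2 (+-monoʳ-≤ 3 (+-monoʳ-≤ K
      (≤-trans (≤-reflexive (length-fwds s)) (<⇒≤ lt))))) small))
    (moment H s))

-- Dead ends among the nonleaf vertices

waysInto : ∀ {n} → Graph (Fin n) → Fin n → Fin n → ℕ
waysInto G v x = sum λ u → ⟦ isNonLeaf G u ⟧ * (⟦ adj G u v ⟧ * ⟦ onward G u v x ⟧)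

-- The right side is at most w, so strictness forces `waysInto G v x` to be 0, whereas a nonleaf
-- neighbour of v other than x would contribute 1 to it.
waysInto-< : ∀ {n} (G : Graph (Fin n)) v x w → waysInto G v x * w < ⟦ isNonLeaf G v ⟧ * (⟦ adj G v x ⟧ * w) →
  isNonLeaf G v ≡ true × adj G v x ≡ true × w ≢ 0 ×
    (∀ u → isNonLeaf G u ≡ true → adj G u v ≡ true → u ≡ x)
waysInto-< G v x w lt
  with ⟦⟧-split (isNonLeaf G v) (⟦ adj G v x ⟧ * w) (λ e → n≮0 (subst (waysInto G v x * w <_) e lt))
... | iv , ne with ⟦⟧-split (adj G v x) w ne
...   | ax , w≢0 = iv , ax , w≢0 , only
  where
  one-way : ∀ {b c} → b ≡ true → c ≡ true → ⟦ b ⟧ * (⟦ c ⟧ * w) ≡ 1 * w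
  one-way refl refl = +-identityʳ _
  none : waysInto G v x ≡ 0
  none = n<1⇒n≡0 (*-cancelʳ-< w (waysInto G v x) 1 (subst (waysInto G v x * w <_) (one-way iv ax) lt))
  only : ∀ u → isNonLeaf G u ≡ true → adj G u v ≡ true → u ≡ x
  only u iu au with x ≟ u
  ... | yes e = sym e
  ... | no x≢u = ⊥-elim (1+n≰n (subst₂ _≤_ one none (term≤sum _ u)))
    where
    one : ⟦ isNonLeaf G u ⟧ * (⟦ adj G u v ⟧ * ⟦ onward G u v x ⟧) ≡ 1
    one = trans (cong₂ (λ a b → ⟦ a ⟧ * (⟦ b ⟧ * ⟦ onward G u v x ⟧)) iu au)
      (cong₂ (λ a b → 1 * (1 * ⟦ a ∧ not b ⟧)) ax (==-≢ x≢u))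

-- If every walk of p starting at a nonleaf could be prolonged backwards to a nonleaf, then
-- nonLeafTotal (step ∷ p) would be at least nonLeafTotal p.
dead-end : ∀ {n} (G : Graph (Fin n)) p → nonLeafTotal G (step ∷ p) < nonLeafTotal G p →
  ∃₂ λ v x → isNonLeaf G v ≡ true × adj G v x ≡ true × walks G p v x ≢ 0 ×
    (∀ u → isNonLeaf G u ≡ true → adj G u v ≡ true → u ≡ x)
dead-end {n} G p lt with sum-witness lt₁
  where
  regroup : ∀ a b c d → a * (b * (c * d)) ≡ (a * (b * c)) * d
  regroup = solve-∀
  -- The walks of `step ∷ p` are grouped by their second arc (v, x), which is the first arc of the
  -- remaining walk of `p`.
  exchange : nonLeafTotal G (step ∷ p) ≡ sum λ v → sum λ x → waysInto G v x * walks G p v x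
  exchange = begin
    nonLeafTotal G (step ∷ p)
      ≡⟨ sum-cong-≗ (λ u → trans (sum-*ˡ ⟦ isNonLeaf G u ⟧ _) (sum-cong-≗ λ v →
           trans (cong (⟦ isNonLeaf G u ⟧ *_) (sum-*ˡ ⟦ adj G u v ⟧ _)) (trans (sum-*ˡ ⟦ isNonLeaf G u ⟧ _)
             (sum-cong-≗ λ x → regroup ⟦ isNonLeaf G u ⟧ ⟦ adj G u v ⟧ ⟦ onward G u v x ⟧ (walks G p v x))))) ⟩
    sum (λ u → sum λ v → sum λ x → ⟦ isNonLeaf G u ⟧ * (⟦ adj G u v ⟧ * ⟦ onward G u v x ⟧) * walks G p v x)
      ≡⟨ sum-swap _ ⟩
    sum (λ v → sum λ u → sum λ x → ⟦ isNonLeaf G u ⟧ * (⟦ adj G u v ⟧ * ⟦ onward G u v x ⟧) * walks G p v x)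
      ≡⟨ sum-cong-≗ (λ v → trans (sum-swap _) (sum-cong-≗ λ x → sym (sum-*ʳ (walks G p v x) _))) ⟩
    sum (λ v → sum λ x → waysInto G v x * walks G p v x) ∎
    where open ≡-Reasoning
  lt₁ : sum (λ v → sum λ x → waysInto G v x * walks G p v x) <
        sum (λ v → sum λ x → ⟦ isNonLeaf G v ⟧ * (⟦ adj G v x ⟧ * walks G p v x))
  lt₁ = subst₂ _<_ exchange (sum-cong-≗ λ v → sum-*ˡ ⟦ isNonLeaf G v ⟧ _) lt
... | v , lt₂ with sum-witness lt₂
...   | x , lt₃ = v , x , waysInto-< G v x (walks G p v x) lt₃

-- Sums over initial segments

Σ< : ℕ → (ℕ → ℕ) → ℕ
Σ< zero f = 0
Σ< (suc r) f = Σ< r f + f r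

Σ<-cong : ∀ r {f g : ℕ → ℕ} → (∀ i → i < r → f i ≡ g i) → Σ< r f ≡ Σ< r g
Σ<-cong zero h = refl
Σ<-cong (suc r) h = cong₂ _+_ (Σ<-cong r λ i lt → h i (m≤n⇒m≤1+n lt)) (h r ≤-refl)

Σ<-zero : ∀ r {f : ℕ → ℕ} → (∀ i → i < r → f i ≡ 0) → Σ< r f ≡ 0
Σ<-zero zero h = refl
Σ<-zero (suc r) h = cong₂ _+_ (Σ<-zero r λ i lt → h i (m≤n⇒m≤1+n lt)) (h r ≤-refl)

Σ<-single : ∀ r {f : ℕ → ℕ} k → k < r → (∀ i → i < r → i ≢ k → f i ≡ 0) → Σ< r f ≡ f k
Σ<-single (suc r) {f} k k<r h with k ℕ.≟ r
... | yes refl = cong (_+ f k) (Σ<-zero r λ i lt → h i (m≤n⇒m≤1+n lt) (<⇒≢ lt))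
... | no ne = trans (cong₂ _+_ (Σ<-single r k (≤∧≢⇒< (s≤s⁻¹ k<r) ne) λ i lt → h i (m≤n⇒m≤1+n lt)) (h r ≤-refl (ne ∘ sym))) (+-identityʳ _)

Σ<-mono : ∀ r {f g : ℕ → ℕ} → (∀ i → i < r → f i ≤ g i) → Σ< r f ≤ Σ< r g
Σ<-mono zero h = z≤n
Σ<-mono (suc r) h = +-mono-≤ (Σ<-mono r λ i lt → h i (m≤n⇒m≤1+n lt)) (h r ≤-refl)

Σ<-mono-< : ∀ r {f g : ℕ → ℕ} → (∀ i → i < r → f i ≤ g i) → ∀ k → k < r → f k < g k → Σ< r f < Σ< r g
Σ<-mono-< (suc r) h k k<r lt with k ℕ.≟ r
... | yes refl = +-mono-≤-< (Σ<-mono r λ i lt → h i (m≤n⇒m≤1+n lt)) lt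
... | no ne = +-mono-<-≤ (Σ<-mono-< r (λ i lt → h i (m≤n⇒m≤1+n lt)) k (≤∧≢⇒< (s≤s⁻¹ k<r) ne) lt) (h r ≤-refl)

Σ<-+ : ∀ r (f g : ℕ → ℕ) → Σ< r (λ i → f i + g i) ≡ Σ< r f + Σ< r g
Σ<-+ zero f g = refl
Σ<-+ (suc r) f g = trans (cong (_+ (f r + g r)) (Σ<-+ r f g)) (regroup (Σ< r f) (Σ< r g) (f r) (g r))
  where
  regroup : ∀ a b c d → a + b + (c + d) ≡ a + c + (b + d)
  regroup = solve-∀

Σ<-head : ∀ r (f : ℕ → ℕ) → Σ< (suc r) f ≡ f 0 + Σ< r (f ∘ suc)
Σ<-head zero f = sym (+-identityʳ _)
Σ<-head (suc r) f = trans (cong (_+ f (suc r)) (Σ<-head r f)) (+-assoc (f 0) _ _)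

Σ<-reverse : ∀ r (f : ℕ → ℕ) → Σ< r f ≡ Σ< r (λ i → f (r ∸ suc i))
Σ<-reverse zero f = refl
Σ<-reverse (suc r) f = begin
  Σ< r f + f r  ≡⟨ +-comm (Σ< r f) (f r) ⟩
  f r + Σ< r f  ≡⟨ cong (f r +_) (Σ<-reverse r f) ⟩
  f r + Σ< r (λ i → f (r ∸ suc i))  ≡⟨ Σ<-head r (λ i → f (suc r ∸ suc i)) ⟨
  Σ< (suc r) (λ i → f (suc r ∸ suc i))      ∎
  where open ≡-Reasoning

Σ<-sum-swap : ∀ {n} r (f : ℕ → Fin n → ℕ) → sum (λ u → Σ< r (λ i → f i u)) ≡ Σ< r (λ i → sum (f i))
Σ<-sum-swap zero f = sum-zero λ _ → refl
Σ<-sum-swap (suc r) f = trans (sum-+ (λ u → Σ< r (λ i → f i u)) (f r)) (cong (_+ sum (f r)) (Σ<-sum-swap r f))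

Σ<-*ʳ : ∀ r c (f : ℕ → ℕ) → Σ< r f * c ≡ Σ< r (λ i → f i * c)
Σ<-*ʳ zero c f = refl
Σ<-*ʳ (suc r) c f = trans (*-distribʳ-+ c (Σ< r f) (f r)) (cong (_+ f r * c) (Σ<-*ʳ r c f))

<ᵇ-true : ∀ {i r} → i < r → (i <ᵇ r) ≡ true
<ᵇ-true {i} {r} lt = Equivalence.to T-≡ (<⇒<ᵇ lt)

<ᵇ-false : ∀ {i r} → ¬ i < r → (i <ᵇ r) ≡ false
<ᵇ-false {i} {r} nlt with i <ᵇ r in e
... | true = ⊥-elim (nlt (<ᵇ⇒< i r (Equivalence.from T-≡ e)))
... | false = refl

-- Walks along a spine

leaf-excess : ∀ {n} (G : Graph (Fin n)) {v} → isNonLeaf G v ≡ false → excess G v ≡ 0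
leaf-excess G {v} e with deg G v
... | zero = refl
... | suc zero = refl

nonLeaf-deg : ∀ {n} (G : Graph (Fin n)) {v} → isNonLeaf G v ≡ true → 2 ≤ deg G v
nonLeaf-deg G {v} e with deg G v
... | suc (suc d) = s≤s (s≤s z≤n)

deg-nonLeaf : ∀ {n} (G : Graph (Fin n)) {v} → 2 ≤ deg G v → isNonLeaf G v ≡ true
deg-nonLeaf G {v} le with deg G v
deg-nonLeaf G {v} (s≤s ()) | suc zero
... | suc (suc d) = refl

-- A leaf that has just been entered has no onward neighbour, so a walk can neither stop there with
-- nonzero weight nor go on.
walks-leaf : ∀ {n} (G : Graph (Fin n)) p u v → adj G u v ≡ true → isNonLeaf G v ≡ false → walks G p u v ≡ 0
walks-leaf G [] u v a e = leaf-excess G e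
walks-leaf G (step ∷ p) u v a e = sum-zero λ x → cong (_* walks G p v x) (n≤0⇒n≡0 (≤-trans
  (term≤sum (λ x → ⟦ onward G u v x ⟧) x)
  (≤-reflexive (trans (sym (excess-onward G (trans (Graph.sym G v u) a))) (leaf-excess G e)))))
walks-leaf G (fwd ∷ p) u v a e = cong (_* walks G p u v) (leaf-excess G e)
walks-leaf G (back ∷ p) u v a e = trans (cong (excess G u *_) (walks-leaf G p u v a e)) (*-zeroʳ (excess G u))

-- The value of `walks` on the ray 0, 1, 2, ... with weights b, started on the arc from i to i + 1
-- and moving to the right.
along : Program → (ℕ → ℕ) → ℕ → ℕ
along [] b i = b (suc i)
along (step ∷ p) b i = along p b (suc i)
along (fwd ∷ p) b i = b (suc i) * along p b i
along (back ∷ p) b i = b i * along p b i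

along-beyond : ∀ p b r → (∀ i → r ≤ i → b i ≡ 0) → ∀ i → r ≤ suc i → along p b i ≡ 0
along-beyond [] b r h i le = h (suc i) le
along-beyond (step ∷ p) b r h i le = along-beyond p b r h (suc i) (m≤n⇒m≤1+n le)
along-beyond (fwd ∷ p) b r h i le = cong (_* along p b i) (h (suc i) le)
along-beyond (back ∷ p) b r h i le = trans (cong (b i *_) (along-beyond p b r h i le)) (*-zeroʳ (b i))

-- The indices are natural numbers and nothing is asked of `at` from r on, so walks may run past the
-- end. The last two fields make every vertex off the spine a leaf attached to it. Acyclicity is
-- left out, since for `H` it is not known beforehand.
record Spine {n} (G : Graph (Fin n)) (r : ℕ) : Set where
  field
    at : ℕ → Fin n
    at-injective : ∀ {i j} → i < r → j < r → at i ≡ at j → i ≡ j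
    at-nonLeaf : ∀ {i} → i < r → isNonLeaf G (at i) ≡ true
    at-onto : ∀ v → isNonLeaf G v ≡ true → ∃ λ i → i < r × at i ≡ v
    at-adj : ∀ {i} → suc i < r → adj G (at i) (at (suc i)) ≡ true
    at-adj⁻ : ∀ {i j} → i < r → j < r → adj G (at i) (at j) ≡ true → j ≡ suc i ⊎ i ≡ suc j
    deg≢0 : ∀ v → deg G v ≢ 0
    leaf-adj : ∀ {u v} → adj G u v ≡ true → isNonLeaf G u ≡ false → isNonLeaf G v ≡ true

  -- The cut-off at r makes walks that run past the end of the spine count 0, in agreement with
  -- `walks`.
  weights : ℕ → ℕ
  weights i = ⟦ i <ᵇ r ⟧ * excess G (at i)

  weights-at : ∀ {i} → i < r → weights i ≡ excess G (at i)
  weights-at {i} lt = trans (cong (λ b → ⟦ b ⟧ * excess G (at i)) (<ᵇ-true lt)) (+-identityʳ _)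

  weights-beyond : ∀ i → r ≤ i → weights i ≡ 0
  weights-beyond i le = cong (λ b → ⟦ b ⟧ * excess G (at i)) (<ᵇ-false (≤⇒≯ le))

  at-adjʳ : ∀ {i} → suc i < r → adj G (at (suc i)) (at i) ≡ true
  at-adjʳ {i} lt = trans (Graph.sym G (at (suc i)) (at i)) (at-adj lt)

  -- The only onward neighbours of `at (suc i)` are `at (suc (suc i))`, if it is on the spine, and
  -- leaves; the latter contribute 0 by `walks-leaf`.
  walks-along : ∀ p i → suc i < r → walks G p (at i) (at (suc i)) ≡ along p weights i
  walks-along [] i lt = sym (weights-at lt)
  walks-along (fwd ∷ p) i lt = cong₂ _*_ (sym (weights-at lt)) (walks-along p i lt)
  walks-along (back ∷ p) i lt = cong₂ _*_ (sym (weights-at (<-trans ≤-refl lt))) (walks-along p i lt)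
  walks-along (step ∷ p) i lt with suc (suc i) <? r
  ... | yes lt₂ = trans (sum-cong-≗ point) (trans (sum-δ (at (suc (suc i))) _) (walks-along p (suc i) lt₂))
    where
    point : ∀ x → ⟦ onward G (at i) (at (suc i)) x ⟧ * walks G p (at (suc i)) x ≡
                  ⟦ x == at (suc (suc i)) ⟧ * walks G p (at (suc i)) x
    point x with x ≟ at (suc (suc i))
    ... | yes refl = cong₂ (λ a b → ⟦ a ∧ not b ⟧ * walks G p (at (suc i)) x) (at-adj lt₂)
            (==-≢ λ e → <⇒≢ (m≤n⇒m≤1+n (≤-refl {suc i})) (sym (at-injective lt₂ (<-trans ≤-refl lt) e)))
    ... | no ne with adj G (at (suc i)) x in ax | isNonLeaf G x in ix
    ...   | false | _ = refl
    ...   | true | false = trans (cong (⟦ not (x == at i) ⟧ *_) (walks-leaf G p _ _ ax ix)) (*-zeroʳ ⟦ not (x == at i) ⟧)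
    ...   | true | true with at-onto x ix
    ...     | j , j<r , refl with at-adj⁻ lt j<r ax
    ...       | inj₁ refl = ⊥-elim (ne refl)
    ...       | inj₂ refl = cong (λ b → ⟦ not b ⟧ * walks G p (at (suc i)) (at i)) (==-refl (at i))
  ... | no nlt = trans (sum-zero point) (sym (along-beyond p weights r weights-beyond (suc i) (≮⇒≥ nlt)))
    where
    point : ∀ x → ⟦ onward G (at i) (at (suc i)) x ⟧ * walks G p (at (suc i)) x ≡ 0
    point x with adj G (at (suc i)) x in ax | isNonLeaf G x in ix
    ... | false | _ = refl
    ... | true | false = trans (cong (⟦ not (x == at i) ⟧ *_) (walks-leaf G p _ _ ax ix)) (*-zeroʳ ⟦ not (x == at i) ⟧)
    ... | true | true with at-onto x ix
    ...   | j , j<r , refl with at-adj⁻ lt j<r ax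
    ...     | inj₁ refl = ⊥-elim (nlt j<r)
    ...     | inj₂ refl = cong (λ b → ⟦ not b ⟧ * walks G p (at (suc i)) (at i)) (==-refl (at i))

  sum-nonLeaf : ∀ (g : Fin n → ℕ) → sum (λ u → ⟦ isNonLeaf G u ⟧ * g u) ≡ Σ< r (g ∘ at)
  sum-nonLeaf g = begin
    sum (λ u → ⟦ isNonLeaf G u ⟧ * g u)  ≡⟨ sum-cong-≗ (λ u → trans (cong (_* g u) (indicator u)) (Σ<-*ʳ r (g u) _)) ⟩
    sum (λ u → Σ< r (λ i → ⟦ u == at i ⟧ * g u))  ≡⟨ Σ<-sum-swap r (λ i u → ⟦ u == at i ⟧ * g u) ⟩
    Σ< r (λ i → sum (λ u → ⟦ u == at i ⟧ * g u))  ≡⟨ Σ<-cong r (λ i _ → sum-δ (at i) g) ⟩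
    Σ< r (g ∘ at)  ∎
    where
    open ≡-Reasoning
    indicator : ∀ u → ⟦ isNonLeaf G u ⟧ ≡ Σ< r (λ i → ⟦ u == at i ⟧)
    indicator u with isNonLeaf G u in iu
    ... | false = sym (Σ<-zero r λ i lt → cong ⟦_⟧ (==-≢ {x = u} {at i} λ { refl → case trans (sym iu) (at-nonLeaf lt) of λ () }))
    ... | true with at-onto u iu
    ...   | k , k<r , refl = sym (trans
              (Σ<-single r k k<r λ i i<r ne → cong ⟦_⟧ (==-≢ {x = at k} {at i} λ e → ne (at-injective i<r k<r (sym e))))
              (cong ⟦_⟧ (==-refl (at k))))

reverse : ∀ {n r} {G : Graph (Fin n)} → Spine G r → Spine G r
reverse {n} {r} {G} S = record
  { at = λ i → at (r ∸ suc i)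
  ; at-injective = λ {i} {j} i<r j<r e → suc-injective (∸-cancelˡ-≡ i<r j<r (at-injective (rev< i<r) (rev< j<r) e))
  ; at-nonLeaf = λ i<r → at-nonLeaf (rev< i<r)
  ; at-onto = λ v iv → case at-onto v iv of λ { (i , i<r , e) → r ∸ suc i , rev< i<r , trans (cong at (rev-rev i<r)) e }
  ; at-adj = λ {i} lt → trans (Graph.sym G (at (r ∸ suc i)) (at (r ∸ suc (suc i))))
      (subst (λ k → adj G (at (r ∸ suc (suc i))) (at k) ≡ true) (shift lt) (at-adj (subst (_< r) (sym (shift lt)) (rev< (<-trans ≤-refl lt)))))
  ; at-adj⁻ = λ {i} {j} i<r j<r a → case at-adj⁻ (rev< i<r) (rev< j<r) a of λ
      { (inj₁ e) → inj₂ (back-shift i<r j<r e)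
      ; (inj₂ e) → inj₁ (back-shift j<r i<r e) }
  ; deg≢0 = deg≢0
  ; leaf-adj = leaf-adj
  }
  where
  open Spine S
  rev< : ∀ {i} → i < r → r ∸ suc i < r
  rev< {i} lt = ∸-monoʳ-< {o = 0} (s≤s z≤n) lt
  rev-rev : ∀ {i} → i < r → r ∸ suc (r ∸ suc i) ≡ i
  rev-rev {i} lt = trans (sym (pred[m∸n]≡m∸[1+n] r (r ∸ suc i))) (cong pred (m∸[m∸n]≡n lt))
  shift : ∀ {i} → suc i < r → suc (r ∸ suc (suc i)) ≡ r ∸ suc i
  shift {i} lt = sym (+-∸-assoc 1 lt)
  back-shift : ∀ {i j} → i < r → j < r → r ∸ suc j ≡ suc (r ∸ suc i) → i ≡ suc j
  back-shift {i} {j} i<r j<r e = suc-injective (∸-cancelˡ-≡ i<r (m<n∸m⇒ j<r e) (suc-injective (trans (sym e) (sym (shift (m<n∸m⇒ j<r e))))))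
    where
    m<n∸m⇒ : ∀ {j k} → j < r → r ∸ suc j ≡ suc k → suc (suc j) ≤ r
    m<n∸m⇒ {j} j<r e with suc (suc j) ≤? r
    ... | yes le = le
    ... | no nle = case trans (sym e) (m≤n⇒m∸n≡0 (≮⇒≥ nle)) of λ ()

module _ {n r} {G : Graph (Fin n)} (S : Spine G r) where

  open Spine S
  private
    module R = Spine (reverse S)

  adj-at-count : ∀ {i j} → i < r → j < r → ⟦ adj G (at i) (at j) ⟧ ≡ ⟦ j ≡ᵇ suc i ⟧ + ⟦ i ≡ᵇ suc j ⟧
  adj-at-count {i} {j} i<r j<r with j ℕ.≟ suc i
  ... | yes refl rewrite at-adj j<r | ≡ᵇ-refl i | ≡ᵇ-≢ (<⇒≢ (m≤n⇒m≤1+n (≤-refl {suc i}))) = refl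
  ... | no j≢ with i ℕ.≟ suc j
  ...   | yes refl rewrite at-adjʳ i<r | ≡ᵇ-refl j | ≡ᵇ-≢ j≢ = refl
  ...   | no i≢ with adj G (at i) (at j) in a
  ...     | false rewrite ≡ᵇ-≢ j≢ | ≡ᵇ-≢ i≢ = refl
  ...     | true = ⊥-elim ([ j≢ , i≢ ]′ (at-adj⁻ i<r j<r a))

  -- The arcs between nonleaf vertices run along the path in one of two directions, and the backward
  -- ones are the forward arcs of the reversed spine.
  sum-pairs : (f : Fin n → Fin n → ℕ) → (∀ u v → adj G u v ≡ true → isNonLeaf G v ≡ false → f u v ≡ 0) →
    sum (λ u → ⟦ isNonLeaf G u ⟧ * sum λ v → ⟦ adj G u v ⟧ * f u v) ≡
    Σ< r (λ i → ⟦ suc i <ᵇ r ⟧ * f (at i) (at (suc i))) + Σ< r (λ i → ⟦ suc i <ᵇ r ⟧ * f (R.at i) (R.at (suc i)))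
  sum-pairs f leaf = begin
    sum (λ u → ⟦ isNonLeaf G u ⟧ * sum λ v → ⟦ adj G u v ⟧ * f u v)  ≡⟨ sum-nonLeaf _ ⟩
    Σ< r (λ i → sum λ v → ⟦ adj G (at i) v ⟧ * f (at i) v)  ≡⟨ Σ<-cong r (λ i i<r → row i i<r) ⟩
    Σ< r (λ i → forward i + backward i)  ≡⟨ Σ<-+ r forward backward ⟩
    Σ< r forward + Σ< r backward  ≡⟨ cong (Σ< r forward +_) (trans (Σ<-reverse r backward) (Σ<-cong r reversed)) ⟩
    Σ< r forward + Σ< r (λ i → ⟦ suc i <ᵇ r ⟧ * f (R.at i) (R.at (suc i))) ∎
    where
    open ≡-Reasoning
    forward backward : ℕ → ℕ
    forward i = ⟦ suc i <ᵇ r ⟧ * f (at i) (at (suc i))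
    backward i = ⟦ 0 <ᵇ i ⟧ * f (at i) (at (pred i))
    hidden : ∀ u v → ⟦ adj G u v ⟧ * f u v ≡ ⟦ isNonLeaf G v ⟧ * (⟦ adj G u v ⟧ * f u v)
    hidden u v with isNonLeaf G v in iv | adj G u v in a
    ... | true | _ = sym (+-identityʳ _)
    ... | false | false = refl
    ... | false | true = trans (+-identityʳ _) (leaf u v a iv)
    next : ∀ i → i < r → Σ< r (λ j → ⟦ j ≡ᵇ suc i ⟧ * f (at i) (at j)) ≡ forward i
    next i i<r with suc i <? r
    ... | yes lt = trans (Σ<-single r (suc i) lt λ j _ ne → cong (λ b → ⟦ b ⟧ * f (at i) (at j)) (≡ᵇ-≢ ne))
            (cong (λ b → ⟦ b ⟧ * f (at i) (at (suc i))) (trans (≡ᵇ-refl i) (sym (<ᵇ-true lt))))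
    ... | no nlt = trans (Σ<-zero r λ j j<r → cong (λ b → ⟦ b ⟧ * f (at i) (at j)) (≡ᵇ-≢ {j} {suc i} λ { refl → nlt j<r }))
            (cong (λ b → ⟦ b ⟧ * f (at i) (at (suc i))) (sym (<ᵇ-false nlt)))
    previous : ∀ i → i < r → Σ< r (λ j → ⟦ i ≡ᵇ suc j ⟧ * f (at i) (at j)) ≡ backward i
    previous zero i<r = Σ<-zero r λ _ _ → refl
    previous (suc i) i<r = trans
      (Σ<-single r i (<-trans ≤-refl i<r) λ j _ ne → cong (λ b → ⟦ b ⟧ * f (at (suc i)) (at j)) (≡ᵇ-≢ (ne ∘ sym)))
      (cong (λ b → ⟦ b ⟧ * f (at (suc i)) (at i)) (≡ᵇ-refl i))
    row : ∀ i → i < r → sum (λ v → ⟦ adj G (at i) v ⟧ * f (at i) v) ≡ forward i + backward i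
    row i i<r = begin
      sum (λ v → ⟦ adj G (at i) v ⟧ * f (at i) v)  ≡⟨ sum-cong-≗ (hidden (at i)) ⟩
      sum (λ v → ⟦ isNonLeaf G v ⟧ * (⟦ adj G (at i) v ⟧ * f (at i) v))   ≡⟨ sum-nonLeaf _ ⟩
      Σ< r (λ j → ⟦ adj G (at i) (at j) ⟧ * f (at i) (at j))  ≡⟨ Σ<-cong r (λ j j<r → trans
                (cong (_* f (at i) (at j)) (adj-at-count i<r j<r))
                (*-distribʳ-+ (f (at i) (at j)) ⟦ j ≡ᵇ suc i ⟧ _)) ⟩
      Σ< r (λ j → ⟦ j ≡ᵇ suc i ⟧ * f (at i) (at j) + ⟦ i ≡ᵇ suc j ⟧ * f (at i) (at j))
                ≡⟨ Σ<-+ r (λ j → ⟦ j ≡ᵇ suc i ⟧ * f (at i) (at j)) _ ⟩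
      Σ< r (λ j → ⟦ j ≡ᵇ suc i ⟧ * f (at i) (at j)) + Σ< r (λ j → ⟦ i ≡ᵇ suc j ⟧ * f (at i) (at j))
                ≡⟨ cong₂ _+_ (next i i<r) (previous i i<r) ⟩
      forward i + backward i  ∎
    reversed : ∀ i → i < r → backward (r ∸ suc i) ≡ ⟦ suc i <ᵇ r ⟧ * f (R.at i) (R.at (suc i))
    reversed i i<r = cong₂ (λ b k → ⟦ b ⟧ * f (R.at i) (at k)) same (pred[m∸n]≡m∸[1+n] r (suc i))
      where
      same : (0 <ᵇ r ∸ suc i) ≡ (suc i <ᵇ r)
      same with suc i <? r
      ... | yes lt = trans (<ᵇ-true (m<n⇒0<n∸m lt)) (sym (<ᵇ-true lt))
      ... | no nlt = trans (cong (0 <ᵇ_) (m≤n⇒m∸n≡0 (≮⇒≥ nlt))) (sym (<ᵇ-false nlt))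

  private
    walks-along′ : ∀ (S : Spine G r) p i → ⟦ suc i <ᵇ r ⟧ * walks G p (Spine.at S i) (Spine.at S (suc i)) ≡ along p (Spine.weights S) i
    walks-along′ S p i with suc i <? r
    ... | yes lt = trans (cong (λ b → ⟦ b ⟧ * walks G p (Spine.at S i) (Spine.at S (suc i))) (<ᵇ-true lt))
            (trans (+-identityʳ _) (Spine.walks-along S p i lt))
    ... | no nlt = trans (cong (λ b → ⟦ b ⟧ * walks G p (Spine.at S i) (Spine.at S (suc i))) (<ᵇ-false nlt))
            (sym (along-beyond p (Spine.weights S) r (Spine.weights-beyond S) i (≮⇒≥ nlt)))

  nonLeafTotal-spine : ∀ p → nonLeafTotal G p ≡ Σ< r (along p weights) + Σ< r (along p R.weights)
  nonLeafTotal-spine p = trans (sum-pairs (walks G p) λ u v → walks-leaf G p u v)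
    (cong₂ _+_ (Σ<-cong r λ i _ → walks-along′ S p i) (Σ<-cong r λ i _ → walks-along′ (reverse S) p i))

  private
    -- Prepending `step` shifts the starting position by one. The term entering at r is 0, so the
    -- shift loses just the term at position 0.
    telescope : ∀ p b → (∀ i → r ≤ i → b i ≡ 0) → Σ< r (along p b) ≡ along p b 0 + Σ< r (along (step ∷ p) b)
    telescope p b h = begin
      Σ< r (along p b)  ≡⟨ +-identityʳ _ ⟨
      Σ< r (along p b) + 0  ≡⟨ cong (Σ< r (along p b) +_) (along-beyond p b r h r (n≤1+n r)) ⟨
      Σ< (suc r) (along p b)  ≡⟨ Σ<-head r (along p b) ⟩
      along p b 0 + Σ< r (along (step ∷ p) b)      ∎
      where open ≡-Reasoning

  nonLeafTotal-step : ∀ p → nonLeafTotal G p ≡ (along p weights 0 + along p R.weights 0) + nonLeafTotal G (step ∷ p)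
  nonLeafTotal-step p = begin
    nonLeafTotal G p  ≡⟨ nonLeafTotal-spine p ⟩
    Σ< r (along p weights) + Σ< r (along p R.weights)  ≡⟨ cong₂ _+_ (telescope p weights weights-beyond) (telescope p R.weights R.weights-beyond) ⟩
    (along p weights 0 + Σ< r (along (step ∷ p) weights)) + (along p R.weights 0 + Σ< r (along (step ∷ p) R.weights))
                ≡⟨ regroup (along p weights 0) _ (along p R.weights 0) _ ⟩
    (along p weights 0 + along p R.weights 0) + (Σ< r (along (step ∷ p) weights) + Σ< r (along (step ∷ p) R.weights))
                ≡⟨ cong (along p weights 0 + along p R.weights 0 +_) (nonLeafTotal-spine (step ∷ p)) ⟨
    (along p weights 0 + along p R.weights 0) + nonLeafTotal G (step ∷ p) ∎
    where
    open ≡-Reasoning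
    regroup : ∀ a b c d → (a + b) + (c + d) ≡ (a + c) + (b + d)
    regroup = solve-∀

  nonLeafPairs-spine : nonLeafPairs G ≡ 2 * pred r
  nonLeafPairs-spine = begin
    nonLeafPairs G
      ≡⟨ sum-cong-≗ (λ v → cong (⟦ isNonLeaf G v ⟧ *_) (sum-cong-≗ λ u →
           trans (*-comm ⟦ isNonLeaf G u ⟧ _) (cong (λ b → ⟦ b ⟧ * ⟦ isNonLeaf G u ⟧) (Graph.sym G u v)))) ⟩
    sum (λ v → ⟦ isNonLeaf G v ⟧ * sum λ u → ⟦ adj G v u ⟧ * ⟦ isNonLeaf G u ⟧)
      ≡⟨ sum-pairs (λ _ u → ⟦ isNonLeaf G u ⟧) (λ _ v _ e → cong ⟦_⟧ e) ⟩
    Σ< r (λ i → ⟦ suc i <ᵇ r ⟧ * ⟦ isNonLeaf G (at (suc i)) ⟧) + Σ< r (λ i → ⟦ suc i <ᵇ r ⟧ * ⟦ isNonLeaf G (R.at (suc i)) ⟧)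
      ≡⟨ cong₂ _+_ (count S) (count (reverse S)) ⟩
    pred r + pred r
      ≡⟨ cong (_+_ (pred r)) (+-identityʳ (pred r)) ⟨
    2 * pred r ∎
    where
    open ≡-Reasoning
    shorter : ∀ r → Σ< r (λ i → ⟦ suc i <ᵇ r ⟧) ≡ pred r
    shorter zero = refl
    shorter (suc r) = trans (cong₂ _+_ (ones r (λ i i<r → cong ⟦_⟧ (<ᵇ-true (s≤s i<r)))) (cong ⟦_⟧ (<ᵇ-false (n≮n (suc r))))) (+-identityʳ r)
      where
      ones : ∀ k {f : ℕ → ℕ} → (∀ i → i < k → f i ≡ 1) → Σ< k f ≡ k
      ones zero h = refl
      ones (suc k) h = trans (cong₂ _+_ (ones k λ i lt → h i (m≤n⇒m≤1+n lt)) (h k ≤-refl)) (+-comm k 1)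
    count : (S : Spine G r) → Σ< r (λ i → ⟦ suc i <ᵇ r ⟧ * ⟦ isNonLeaf G (Spine.at S (suc i)) ⟧) ≡ pred r
    count S = trans (Σ<-cong r λ i _ → point i) (shorter r)
      where
      point : ∀ i → ⟦ suc i <ᵇ r ⟧ * ⟦ isNonLeaf G (Spine.at S (suc i)) ⟧ ≡ ⟦ suc i <ᵇ r ⟧
      point i with suc i <? r
      ... | yes lt rewrite <ᵇ-true lt | Spine.at-nonLeaf S lt = refl
      ... | no nlt rewrite <ᵇ-false nlt = refl

  nonLeafCount-spine : sum (λ v → ⟦ isNonLeaf G v ⟧) ≡ r
  nonLeafCount-spine = trans (sum-cong-≗ λ v → sym (*-identityʳ _)) (trans (sum-nonLeaf λ _ → 1) (Σ<-one r))
    where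
    Σ<-one : ∀ r → Σ< r (λ _ → 1) ≡ r
    Σ<-one zero = refl
    Σ<-one (suc r) = trans (cong (_+ 1) (Σ<-one r)) (+-comm r 1)

  sum-excess-spine : ∀ k → sum (λ v → excess G v ^ suc k) ≡ Σ< r (λ i → weights i ^ suc k)
  sum-excess-spine k = trans (sum-cong-≗ point) (trans (sum-nonLeaf _) (Σ<-cong r λ i lt → cong (_^ suc k) (sym (weights-at lt))))
    where
    point : ∀ v → excess G v ^ suc k ≡ ⟦ isNonLeaf G v ⟧ * excess G v ^ suc k
    point v with isNonLeaf G v in e
    ... | true = sym (+-identityʳ _)
    ... | false rewrite leaf-excess G e = refl

-- Counting edges and vertices by leaves

leafPairs : ∀ {n} → Graph (Fin n) → ℕ
leafPairs G = sum λ u → sum λ v → ⟦ adj G u v ⟧ * (⟦ not (isNonLeaf G u) ⟧ * ⟦ not (isNonLeaf G v) ⟧)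

nonLeafDegreeSum : ∀ {n} → Graph (Fin n) → ℕ
nonLeafDegreeSum G = sum λ v → ⟦ isNonLeaf G v ⟧ * deg G v

edges-deg : ∀ {n} (G : Graph (Fin n)) → edges G ≡ sum (deg G)
edges-deg G = sum-cong-≗ λ u → sym (deg-sum G u)

-- Inclusion and exclusion over ordered adjacent pairs, according to whether the first and the
-- second entry is a nonleaf. It serves to exclude adjacent leaves in `H`.
edges-by-leaves : ∀ {n} (G : Graph (Fin n)) →
  edges G + nonLeafPairs G ≡ (nonLeafDegreeSum G + nonLeafDegreeSum G) + leafPairs G
edges-by-leaves {n} G = begin
  edges G + nonLeafPairs G
    ≡⟨ cong (edges G +_) (sum-cong-≗ λ u → trans (sum-*ˡ ⟦ isNonLeaf G u ⟧ _)
         (sum-cong-≗ λ v → cong (λ b → ⟦ isNonLeaf G u ⟧ * (⟦ isNonLeaf G v ⟧ * ⟦ b ⟧)) (Graph.sym G v u))) ⟩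
  edges G + sum (λ u → sum λ v → inner u * (inner v * ⟦ adj G u v ⟧))
    ≡⟨ sum²-+ (λ u v → ⟦ adj G u v ⟧) _ ⟨
  sum (λ u → sum λ v → ⟦ adj G u v ⟧ + inner u * (inner v * ⟦ adj G u v ⟧))
    ≡⟨ sum-cong-≗ (λ u → sum-cong-≗ λ v → point u v) ⟩
  sum (λ u → sum λ v → (inner u * ⟦ adj G u v ⟧ + inner v * ⟦ adj G v u ⟧) + ⟦ adj G u v ⟧ * (⟦ not (isNonLeaf G u) ⟧ * ⟦ not (isNonLeaf G v) ⟧))
    ≡⟨ sum²-+ (λ u v → inner u * ⟦ adj G u v ⟧ + inner v * ⟦ adj G v u ⟧) _ ⟩
  sum (λ u → sum λ v → inner u * ⟦ adj G u v ⟧ + inner v * ⟦ adj G v u ⟧) + leafPairs G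
    ≡⟨ cong (_+ leafPairs G) (sum²-+ (λ u v → inner u * ⟦ adj G u v ⟧) _) ⟩
  sum (λ u → sum λ v → inner u * ⟦ adj G u v ⟧) + sum (λ u → sum λ v → inner v * ⟦ adj G v u ⟧) + leafPairs G
    ≡⟨ cong₂ (λ a b → a + b + leafPairs G) degrees (trans (sum-swap _) degrees) ⟩
  (nonLeafDegreeSum G + nonLeafDegreeSum G) + leafPairs G ∎
  where
  open ≡-Reasoning
  inner : Fin n → ℕ
  inner u = ⟦ isNonLeaf G u ⟧
  sum²-+ : (f g : Fin n → Fin n → ℕ) → sum (λ u → sum λ v → f u v + g u v) ≡ sum (λ u → sum (f u)) + sum (λ u → sum (g u))
  sum²-+ f g = trans (sum-cong-≗ λ u → sum-+ (f u) (g u)) (sum-+ (λ u → sum (f u)) _)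
  degrees : sum (λ u → sum λ v → inner u * ⟦ adj G u v ⟧) ≡ nonLeafDegreeSum G
  degrees = sum-cong-≗ λ u → trans (sym (sum-*ˡ (inner u) _)) (cong (inner u *_) (sym (deg-sum G u)))
  point : ∀ u v → ⟦ adj G u v ⟧ + inner u * (inner v * ⟦ adj G u v ⟧) ≡
    (inner u * ⟦ adj G u v ⟧ + inner v * ⟦ adj G v u ⟧) + ⟦ adj G u v ⟧ * (⟦ not (isNonLeaf G u) ⟧ * ⟦ not (isNonLeaf G v) ⟧)
  point u v rewrite Graph.sym G v u with adj G u v | isNonLeaf G u | isNonLeaf G v
  ... | false | false | false = refl
  ... | false | false | true = refl
  ... | false | true | false = refl
  ... | false | true | true = refl
  ... | true | false | false = refl
  ... | true | false | true = refl
  ... | true | true | false = refl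
  ... | true | true | true = refl

isolated : ∀ {n} → Graph (Fin n) → ℕ
isolated G = sum λ v → ⟦ deg G v ≡ᵇ 0 ⟧

-- The identity holds vertex by vertex, by the cases degree 0, 1 and at least 2. It serves to
-- exclude isolated vertices in `H`.
vertices-by-degree : ∀ {n} (G : Graph (Fin n)) →
  n + nonLeafDegreeSum G ≡ sum (λ v → ⟦ isNonLeaf G v ⟧) + isolated G + edges G
vertices-by-degree {n} G = begin
  n + nonLeafDegreeSum G  ≡⟨ cong (_+ nonLeafDegreeSum G) (sum-const-1 n) ⟨
  sum {n} (λ _ → 1) + nonLeafDegreeSum G  ≡⟨ sum-+ (λ _ → 1) _ ⟨
  sum (λ v → 1 + ⟦ isNonLeaf G v ⟧ * deg G v)  ≡⟨ sum-cong-≗ point ⟩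
  sum (λ v → ⟦ isNonLeaf G v ⟧ + ⟦ deg G v ≡ᵇ 0 ⟧ + deg G v)   ≡⟨ sum-+ (λ v → ⟦ isNonLeaf G v ⟧ + ⟦ deg G v ≡ᵇ 0 ⟧) _ ⟩
  sum (λ v → ⟦ isNonLeaf G v ⟧ + ⟦ deg G v ≡ᵇ 0 ⟧) + sum (deg G) ≡⟨ cong₂ _+_ (sum-+ (λ v → ⟦ isNonLeaf G v ⟧) _) (sym (edges-deg G)) ⟩
  sum (λ v → ⟦ isNonLeaf G v ⟧) + isolated G + edges G  ∎
  where
  open ≡-Reasoning
  point : ∀ v → 1 + ⟦ isNonLeaf G v ⟧ * deg G v ≡ ⟦ isNonLeaf G v ⟧ + ⟦ deg G v ≡ᵇ 0 ⟧ + deg G v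
  point v with deg G v
  ... | zero = refl
  ... | suc zero = refl
  ... | suc (suc d) = cong suc (+-identityʳ _)

-- The spine of a caterpillar

two-neighbours : ∀ {n} (G : Graph (Fin n)) {v x y} → adj G v x ≡ true → adj G v y ≡ true → x ≢ y → isNonLeaf G v ≡ true
two-neighbours G {v} {x} {y} ax ay x≢y = deg-nonLeaf G (subst (2 ≤_) (sym (deg-sum G v))
  (length-≤-sum (adj G v) {x ∷ y ∷ []} ((x≢y ∷ []) ∷ [] ∷ []) λ { (here refl) → ax ; (there (here refl)) → ay }))

adj⇒deg≢0 : ∀ {n} (G : Graph (Fin n)) {v x} → adj G v x ≡ true → deg G v ≢ 0
adj⇒deg≢0 G {v} {x} a e = 1+n≰n (subst (1 ≤_) (trans (sym (deg-sum G v)) e)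
  (length-≤-sum (adj G v) {x ∷ []} ([] ∷ []) λ { (here refl) → a }))

adj-irrefl : ∀ {V} (G : Graph V) {u v} → adj G u v ≡ true → u ≢ v
adj-irrefl G a refl = case trans (sym a) (Graph.irrefl G _) of λ ()

connected⇒deg≢0 : ∀ {n} (G : Graph (Fin n)) → 2 ≤ n → Connected G → ∀ v → deg G v ≢ 0
connected⇒deg≢0 G (s≤s (s≤s _)) conn zero with conn zero (suc zero)
... | a ◅ _ = adj⇒deg≢0 G a
connected⇒deg≢0 G (s≤s (s≤s _)) conn (suc v) with conn (suc v) zero
... | a ◅ _ = adj⇒deg≢0 G a

-- Two adjacent leaves are a component of their own, which cannot contain the nonleaf w.
connected⇒leaf-adj : ∀ {n} (G : Graph (Fin n)) → Connected G → ∀ {w} → isNonLeaf G w ≡ true →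
  ∀ {u v} → adj G u v ≡ true → isNonLeaf G u ≡ false → isNonLeaf G v ≡ true
connected⇒leaf-adj G conn {w} iw {u} {v} a iu with isNonLeaf G v in iv
... | true = refl
... | false = ⊥-elim ([ (λ { refl → case trans (sym iw) iu of λ () }) , (λ { refl → case trans (sym iw) iv of λ () }) ]′ (stay (inj₁ refl) (conn u w)))
  where
  unique : ∀ {x y z} → isNonLeaf G x ≡ false → adj G x y ≡ true → adj G x z ≡ true → y ≡ z
  unique {x} {y} {z} ix ay az with y ≟ z
  ... | yes e = e
  ... | no ne = case trans (sym ix) (two-neighbours G ay az ne) of λ ()
  stay : ∀ {x y} → x ≡ u ⊎ x ≡ v → Star (Adj G) x y → y ≡ u ⊎ y ≡ v
  stay h ε = h
  stay (inj₁ refl) (b ◅ p) = stay (inj₂ (unique iu b a)) p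
  stay (inj₂ refl) (b ◅ p) = stay (inj₁ (unique iv b (trans (Graph.sym G _ _) a))) p

caterpillar-spine : ∀ {n} (G : Graph (Fin n)) → 2 ≤ n → ∀ {w} → isNonLeaf G w ≡ true → IsCaterpillar G →
  Spine G (length (nonLeafDegrees G))
caterpillar-spine {n} G 2≤n {w} iw ((conn , _) , k , iso) = subst (Spine G) k≡ spine
  where
  open _≅_ (≅-sym iso)
  open Bijection bij using (to; injective; surjective)
  at′ : ∀ {i} → Dec (i < k) → Fin n
  at′ (yes lt) = proj₁ (to (fromℕ< lt))
  -- A default value for the indices from k on, about which `Spine` says nothing.
  at′ (no _) = w
  at : ℕ → Fin n
  at i = at′ (i <? k)
  at-< : ∀ {i} (lt : i < k) → at i ≡ proj₁ (to (fromℕ< lt))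
  at-< {i} lt with i <? k
  ... | yes lt′ = cong (λ l → proj₁ (to (fromℕ< l))) (<-irrelevant lt′ lt)
  ... | no nlt = ⊥-elim (nlt lt)
  Σ-≡ : ∀ {a b : Σ (Fin n) (_∈ˢ NonLeaves G)} → proj₁ a ≡ proj₁ b → a ≡ b
  Σ-≡ {a , p} {b , q} refl = cong (a ,_) ([]=-irrelevant p q)
  adj-at : ∀ {i j} (i<k : i < k) (j<k : j < k) → adj G (at i) (at j) ≡ ((i ≡ᵇ suc j) ∨ (j ≡ᵇ suc i))
  adj-at {i} {j} i<k j<k = begin
    adj G (at i) (at j)  ≡⟨ cong₂ (adj G) (at-< i<k) (at-< j<k) ⟩
    adj G (proj₁ (to (fromℕ< i<k))) (proj₁ (to (fromℕ< j<k)))  ≡⟨ preserve (fromℕ< i<k) (fromℕ< j<k) ⟨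
    pathAdj (fromℕ< i<k) (fromℕ< j<k)  ≡⟨ cong₂ (λ a b → (a ≡ᵇ suc b) ∨ (b ≡ᵇ suc a)) (toℕ-fromℕ< i<k) (toℕ-fromℕ< j<k) ⟩
    (i ≡ᵇ suc j) ∨ (j ≡ᵇ suc i)  ∎
    where open ≡-Reasoning
  inv : ∀ a b → (a ≡ᵇ suc b) ∨ (b ≡ᵇ suc a) ≡ true → b ≡ suc a ⊎ a ≡ suc b
  inv a b e with a ℕ.≟ suc b
  ... | yes p = inj₂ p
  ... | no np with b ℕ.≟ suc a
  ...   | yes q = inj₁ q
  ...   | no nq rewrite ≡ᵇ-≢ np | ≡ᵇ-≢ nq = case e of λ ()
  nonLeaf-∈ : ∀ {v} → isNonLeaf G v ≡ true → v ∈ˢ NonLeaves G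
  nonLeaf-∈ {v} iv = Vecₚ.lookup⇒[]= v (NonLeaves G) (trans (Vecₚ.lookup∘tabulate (isNonLeaf G) v) iv)
  spine : Spine G k
  spine = record
    { at = at
    ; at-injective = λ {i} {j} i<k j<k e → trans (sym (toℕ-fromℕ< i<k)) (trans
        (cong toℕ (injective (Σ-≡ (trans (sym (at-< i<k)) (trans e (at-< j<k))))))
        (toℕ-fromℕ< j<k))
    ; at-nonLeaf = λ {i} i<k → trans (cong (isNonLeaf G) (at-< i<k)) (trans
        (sym (Vecₚ.lookup∘tabulate (isNonLeaf G) _)) (Vecₚ.[]=⇒lookup (proj₂ (to (fromℕ< i<k)))))
    ; at-onto = λ v iv → case surjective (v , nonLeaf-∈ iv) of λ { (x , h) →
        toℕ x , toℕ<n x , trans (at-< (toℕ<n x)) (cong proj₁ (h (fromℕ<-toℕ x (toℕ<n x)))) }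
    ; at-adj = λ {i} lt → trans (adj-at (<-trans ≤-refl lt) lt)
        (trans (cong ((i ≡ᵇ suc (suc i)) ∨_) (≡ᵇ-refl i)) (∨-zeroʳ _))
    ; at-adj⁻ = λ {i} {j} i<k j<k a → inv i j (trans (sym (adj-at i<k j<k)) a)
    ; deg≢0 = connected⇒deg≢0 G 2≤n conn
    ; leaf-adj = connected⇒leaf-adj G conn iw
    }
  k≡ : k ≡ length (nonLeafDegrees G)
  k≡ = trans (sym (nonLeafCount-spine spine)) (trans (sym (length-filterᵇ (isNonLeaf G)))
    (sym (length-map (deg G) (filterᵇ (isNonLeaf G) (allFin n)))))

-- Following a path of nonleaf vertices

-- No vertex has three nonleaf neighbours. Stated without counting, so that a violation is a
-- configuration on seven vertices, small enough for a card.
Thin : ∀ {n} → Graph (Fin n) → Set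
Thin G = ∀ {v x y z} → adj G v x ≡ true → adj G v y ≡ true → adj G v z ≡ true →
  isNonLeaf G x ≡ true → isNonLeaf G y ≡ true → isNonLeaf G z ≡ true → x ≡ y ⊎ x ≡ z ⊎ y ≡ z

steps : ℕ → Program
steps zero = []
steps (suc ℓ) = step ∷ steps ℓ

length-steps : ∀ ℓ → length (steps ℓ) ≡ ℓ
length-steps zero = refl
length-steps (suc ℓ) = cong suc (length-steps ℓ)

members : ∀ {n} → (Fin n → Bool) → List (Fin n)
members {n} p = filterᵇ p (allFin n)

members-unique : ∀ {n} (p : Fin n → Bool) → Unique (members p)
members-unique {n} p = Uniqueₚ.filter⁺ (T? ∘ p) (Uniqueₚ.allFin⁺ n)

∈-members⁻ : ∀ {n} (p : Fin n → Bool) {x} → x ∈ members p → p x ≡ true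
∈-members⁻ {n} p x∈ = Equivalence.to T-≡ (proj₂ (∈-filter⁻ (T? ∘ p) {xs = allFin n} x∈))

∈-members⁺ : ∀ {n} (p : Fin n → Bool) {x} → p x ≡ true → x ∈ members p
∈-members⁺ p {x} e = ∈-filter⁺ (T? ∘ p) (∈-allFin x) (Equivalence.from T-≡ e)

∧-true : ∀ {b c} → b ∧ c ≡ true → b ≡ true × c ≡ true
∧-true {true} {true} refl = refl , refl

∧-intro : ∀ {b c} → b ≡ true → c ≡ true → b ∧ c ≡ true
∧-intro refl refl = refl

two-members : ∀ {n} (p : Fin n → Bool) → 2 ≤ sum (⟦_⟧ ∘ p) → ∃₂ λ x y → x ≢ y × p x ≡ true × p y ≡ true
two-members {n} p le = go (members p) (members-unique p) (∈-members⁻ p) (subst (2 ≤_) (sym (length-filterᵇ p)) le)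
  where
  go : ∀ xs → Unique xs → (∀ {x} → x ∈ xs → p x ≡ true) → 2 ≤ length xs → ∃₂ λ x y → x ≢ y × p x ≡ true × p y ≡ true
  go (x ∷ []) _ _ (s≤s ())
  go (x ∷ y ∷ _) ((x≢y ∷ _) ∷ _) h _ = x , y , x≢y , h (here refl) , h (there (here refl))

three-members : ∀ {n} (p : Fin n → Bool) → 3 ≤ sum (⟦_⟧ ∘ p) →
  ∃ λ x → ∃₂ λ y z → (x ≢ y × x ≢ z × y ≢ z) × p x ≡ true × p y ≡ true × p z ≡ true
three-members {n} p le = go (members p) (members-unique p) (∈-members⁻ p) (subst (3 ≤_) (sym (length-filterᵇ p)) le)
  where
  go : ∀ xs → Unique xs → (∀ {x} → x ∈ xs → p x ≡ true) → 3 ≤ length xs →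
    ∃ λ x → ∃₂ λ y z → (x ≢ y × x ≢ z × y ≢ z) × p x ≡ true × p y ≡ true × p z ≡ true
  go (x ∷ []) _ _ (s≤s ())
  go (x ∷ y ∷ []) _ _ (s≤s (s≤s ()))
  go (x ∷ y ∷ z ∷ _) ((x≢y ∷ x≢z ∷ _) ∷ (y≢z ∷ _) ∷ _) h _ =
    x , y , z , (x≢y , x≢z , y≢z) , h (here refl) , h (there (here refl)) , h (there (there (here refl)))

module Walk {n} (H : Graph (Fin n)) where

  Continues : Fin n → Fin n → Set
  Continues u v = ∃ λ x → onward H u v x ∧ isNonLeaf H x ≡ true

  continues? : ∀ u v → Dec (Continues u v)
  continues? u v = any? λ x → (onward H u v x ∧ isNonLeaf H x) Data.Bool.≟ true

  nextOf : ∀ {u v} → Dec (Continues u v) → Fin n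
  nextOf (yes (x , _)) = x
  -- The value at a dead end is arbitrary; `Good` keeps walks away from it.
  nextOf {v = v} (no _) = v

  next : Fin n → Fin n → Fin n
  next u v = nextOf (continues? u v)

  next-onward : ∀ {u v} → Continues u v → onward H u v (next u v) ∧ isNonLeaf H (next u v) ≡ true
  next-onward {u} {v} c with continues? u v
  ... | yes (x , e) = e
  ... | no nc = ⊥-elim (nc c)

  continue : ∀ {u v x} → adj H v x ≡ true → x ≢ u → isNonLeaf H x ≡ true → Continues u v
  continue {x = x} a ne i = x , ∧-intro (∧-intro a (cong not (==-≢ ne))) i

  module From (v₀ v₁ : Fin n) (a₀ : adj H v₀ v₁ ≡ true) (i₀ : isNonLeaf H v₀ ≡ true) (i₁ : isNonLeaf H v₁ ≡ true) where

    arc : ℕ → Fin n × Fin n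
    arc zero = v₀ , v₁
    arc (suc i) = proj₂ (arc i) , next (proj₁ (arc i)) (proj₂ (arc i))

    p : ℕ → Fin n
    p i = proj₁ (arc i)

    Good : ℕ → Set
    Good k = ∀ i → i < k → Continues (p i) (p (suc i))

    module _ {k} (good : Good k) where

      private
        fresh : ∀ i → i < k → onward H (p i) (p (suc i)) (p (suc (suc i))) ∧ isNonLeaf H (p (suc (suc i))) ≡ true
        fresh i lt = next-onward (good i lt)

      p-nonLeaf : ∀ i → i ≤ suc k → isNonLeaf H (p i) ≡ true
      p-nonLeaf zero _ = i₀
      p-nonLeaf (suc zero) _ = i₁
      p-nonLeaf (suc (suc i)) (s≤s lt) = proj₂ (∧-true (fresh i lt))

      p-adj : ∀ i → i ≤ k → adj H (p i) (p (suc i)) ≡ true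
      p-adj zero _ = a₀
      p-adj (suc i) lt = proj₁ (∧-true (proj₁ (∧-true {onward H (p i) (p (suc i)) (p (suc (suc i)))} (fresh i lt))))

      p-adjʳ : ∀ i → i ≤ k → adj H (p (suc i)) (p i) ≡ true
      p-adjʳ i le = trans (Graph.sym H _ _) (p-adj i le)

      p-turn : ∀ i → i < k → p (suc (suc i)) ≢ p i
      p-turn i lt e = case trans (sym (proj₂ (∧-true {adj H (p (suc i)) (p (suc (suc i)))}
        (proj₁ (∧-true {onward H (p i) (p (suc i)) (p (suc (suc i)))} (fresh i lt)))))) (cong not (==-true e)) of λ ()

    first-failure : ∀ K → Good K ⊎ ∃ λ k → k < K × Good k × ¬ Continues (p k) (p (suc k))
    first-failure zero = inj₁ λ i ()
    first-failure (suc K) with first-failure K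
    ... | inj₂ (k , lt , rest) = inj₂ (k , m≤n⇒m≤1+n lt , rest)
    ... | inj₁ good with continues? (p K) (p (suc K))
    ...   | no nc = inj₂ (K , ≤-refl , good , nc)
    ...   | yes c = inj₁ λ i lt → case m≤n⇒m<n∨m≡n (s≤s⁻¹ lt) of λ { (inj₁ l) → good i l ; (inj₂ refl) → c }

    module _ (thin : Thin H) where

      private
        thin′ : ∀ {v x y z} → adj H v x ≡ true → adj H v y ≡ true → adj H v z ≡ true →
          isNonLeaf H x ≡ true → isNonLeaf H y ≡ true → isNonLeaf H z ≡ true → x ≢ y → z ≡ x ⊎ z ≡ y
        thin′ ax ay az ix iy iz x≢y with thin ax ay az ix iy iz
        ... | inj₁ e = ⊥-elim (x≢y e)
        ... | inj₂ (inj₁ e) = inj₁ (sym e)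
        ... | inj₂ (inj₂ e) = inj₂ (sym e)

      -- A walk that contributes to `walks` need not be the one selected by `next`, but in a thin
      -- graph at most one nonleaf neighbour differs from the vertex just left, so the two walks
      -- agree.
      walks⇒good : ∀ ℓ i → (∀ j → j < i → Continues (p j) (p (suc j))) → walks H (steps ℓ) (p i) (p (suc i)) ≢ 0 → Good (i + ℓ)
      walks⇒good zero i good _ j lt = good j (subst (j <_) (+-identityʳ i) lt)
      walks⇒good (suc ℓ) i good ne = subst Good (sym (+-suc i ℓ))
          (walks⇒good ℓ (suc i) good′ (subst (λ y → walks H (steps ℓ) (p (suc i)) y ≢ 0) x≡ w≢0))
        where
        found = sum-≢0 ne
        x = proj₁ found
        split = ⟦⟧-split (onward H (p i) (p (suc i)) x) (walks H (steps ℓ) (p (suc i)) x) (proj₂ found)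
        w≢0 = proj₂ split
        ax : adj H (p (suc i)) x ≡ true
        ax = proj₁ (∧-true (proj₁ split))
        x≢ : x ≢ p i
        x≢ e = case trans (sym (proj₂ (∧-true {adj H (p (suc i)) x} (proj₁ split)))) (cong not (==-true e)) of λ ()
        ix : isNonLeaf H x ≡ true
        ix with isNonLeaf H x in e
        ... | true = refl
        ... | false = ⊥-elim (w≢0 (walks-leaf H (steps ℓ) (p (suc i)) x ax e))
        good′ : Good (suc i)
        good′ j lt = case m≤n⇒m<n∨m≡n (s≤s⁻¹ lt) of λ { (inj₁ l) → good j l ; (inj₂ refl) → continue ax x≢ ix }
        x≡ : x ≡ p (suc (suc i))
        x≡ with thin′ (p-adjʳ good′ i (n≤1+n i)) (p-adj good′ (suc i) ≤-refl) ax
                  (p-nonLeaf good′ i (m≤n⇒m≤1+n (n≤1+n i))) (p-nonLeaf good′ (suc (suc i)) ≤-refl) ix (p-turn good′ i ≤-refl ∘ sym)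
        ... | inj₁ e = ⊥-elim (x≢ e)
        ... | inj₂ e = e

      module _ (end : ∀ u → isNonLeaf H u ≡ true → adj H u v₀ ≡ true → u ≡ v₁) {k} (good : Good k) where

        -- At a first repetition p a = p b the vertex before p b is a nonleaf neighbour of p a,
        -- hence by thinness one of its neighbours on the path, and this is an earlier repetition.
        -- At a = 0 the hypothesis `end` replaces thinness. The remaining small gaps are a loop or a
        -- turn back.
        p-injective : ∀ b → b ≤ suc k → ∀ a → a < b → p a ≢ p b
        p-injective b = <-rec (λ b → b ≤ suc k → ∀ a → a < b → p a ≢ p b) distinct b
          where
          distinct : ∀ b → (∀ {b′} → b′ < b → b′ ≤ suc k → ∀ a → a < b′ → p a ≢ p b′) →
            b ≤ suc k → ∀ a → a < b → p a ≢ p b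
          distinct (suc b₀) ih (s≤s le) a lt e with a ℕ.≟ b₀
          ... | yes refl = adj-irrefl H (p-adj good a le) e
          distinct (suc b₀) ih (s≤s le) zero lt e | no ne
            with end (p b₀) (p-nonLeaf good b₀ (m≤n⇒m≤1+n le)) (trans (cong (adj H (p b₀)) e) (p-adj good b₀ le))
          ... | p≡ with b₀
          ...   | zero = ne refl
          ...   | suc zero = p-turn good 0 le (sym e)
          ...   | suc (suc b₁) = ih ≤-refl (m≤n⇒m≤1+n le) 1 (s≤s (s≤s z≤n)) (sym p≡)
          distinct (suc b₀) ih (s≤s le) (suc a) lt e | no ne
            with thin′ (p-adjʳ good a a≤k) (p-adj good (suc a) a<k)
                   (subst (λ y → adj H y (p b₀) ≡ true) (sym e) (p-adjʳ good b₀ le))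
                   (p-nonLeaf good a (m≤n⇒m≤1+n a≤k)) (p-nonLeaf good (suc (suc a)) (s≤s a<k))
                   (p-nonLeaf good b₀ (m≤n⇒m≤1+n le)) (p-turn good a a<k ∘ sym)
            where
            a<b₀ : suc a < b₀
            a<b₀ = ≤∧≢⇒< (s≤s⁻¹ lt) ne
            a<k : a < k
            a<k = ≤-trans (<⇒≤ a<b₀) le
            a≤k : a ≤ k
            a≤k = <⇒≤ a<k
          ... | inj₁ q = ih ≤-refl (m≤n⇒m≤1+n le) a (s≤s⁻¹ lt) (sym q)
          ... | inj₂ q with suc (suc a) ℕ.≟ b₀
          ...   | yes refl = p-turn good (suc a) le (sym e)
          ...   | no ne₂ = ih ≤-refl (m≤n⇒m≤1+n le) (suc (suc a)) (≤∧≢⇒< (≤∧≢⇒< (s≤s⁻¹ lt) ne) ne₂) (sym q)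

        -- Inside the path thinness leaves no third nonleaf neighbour; at its first vertex this is
        -- `end`, at its last one the failure of `Continues`.
        p-closed : ¬ Continues (p k) (p (suc k)) → ∀ i → i ≤ suc k → ∀ {x} → isNonLeaf H x ≡ true → adj H (p i) x ≡ true →
          ∃ λ j → j ≤ suc k × p j ≡ x × (j ≡ suc i ⊎ i ≡ suc j)
        p-closed nc zero le ix a = 1 , s≤s z≤n , sym (end _ ix (trans (Graph.sym H _ _) a)) , inj₁ refl
        p-closed nc (suc i) (s≤s le) {x} ix a with m≤n⇒m<n∨m≡n le
        ... | inj₁ lt with thin′ (p-adjʳ good i le) (p-adj good (suc i) lt) a
                 (p-nonLeaf good i (m≤n⇒m≤1+n le)) (p-nonLeaf good (suc (suc i)) (s≤s lt)) ix (p-turn good i lt ∘ sym)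
        ...   | inj₁ e = i , m≤n⇒m≤1+n le , sym e , inj₂ refl
        ...   | inj₂ e = suc (suc i) , s≤s lt , sym e , inj₁ refl
        p-closed nc (suc i) (s≤s le) {x} ix a | inj₂ refl with x ≟ p i
        ... | yes e = i , n≤1+n i , sym e , inj₂ refl
        ... | no ne = ⊥-elim (nc (continue a ne ix))

-- The nonleaf vertices form a single path

⟦⟧-∧ : ∀ b c → ⟦ b ∧ c ⟧ ≡ ⟦ b ⟧ * ⟦ c ⟧
⟦⟧-∧ true c = sym (+-identityʳ _)
⟦⟧-∧ false c = refl

spineDegree : ∀ {n} → Graph (Fin n) → Fin n → ℕ
spineDegree H v = sum λ u → ⟦ isNonLeaf H u ⟧ * ⟦ adj H u v ⟧

spineDegree-count : ∀ {n} (H : Graph (Fin n)) v → spineDegree H v ≡ sum (λ u → ⟦ isNonLeaf H u ∧ adj H u v ⟧)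
spineDegree-count H v = sum-cong-≗ λ u → sym (⟦⟧-∧ (isNonLeaf H u) (adj H u v))

-- Here a cycle is a closed sequence g 0, ..., g m with only its ends equal, the shape in which a
-- repetition on a walk produces it.
NoCycle : ∀ {n} → Graph (Fin n) → ℕ → Set
NoCycle {n} G m = 3 ≤ m → ∀ (g : ℕ → Fin n) → (∀ {i j} → i < j → j < m → g i ≢ g j) →
  (∀ i → i < m → adj G (g i) (g (suc i)) ≡ true) → g 0 ≢ g m

-- The nonleaf vertices have degree at most 2 among themselves, and the number of adjacent pairs leaves room
-- for only two of degree less than 2, which are the ends of one path.  A nonleaf outside this path would lie
-- on a cycle, and such a cycle together with the path would have more than r vertices.
module PathFromEnd {n} (H : Graph (Fin n)) (thin : Thin H) (r : ℕ)
  (count : sum (λ v → ⟦ isNonLeaf H v ⟧) ≡ r) (pairs : nonLeafPairs H ≡ 2 * pred r)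
  (N : ℕ) (noCycle : ∀ m → m ≤ N → NoCycle H m)
  (v₀ v₁ : Fin n) (a₀ : adj H v₀ v₁ ≡ true) (i₀ : isNonLeaf H v₀ ≡ true)
  (end : ∀ u → isNonLeaf H u ≡ true → adj H u v₀ ≡ true → u ≡ v₁)
  (L : ℕ) (long : walks H (steps L) v₀ v₁ ≢ 0) (room : r ≤ L + 2 + N)
  (deg≢0 : ∀ v → deg H v ≢ 0)
  (leaf-adj : ∀ {u v} → adj H u v ≡ true → isNonLeaf H u ≡ false → isNonLeaf H v ≡ true) where

  open Walk H

  i₁ : isNonLeaf H v₁ ≡ true
  i₁ with isNonLeaf H v₁ in e
  ... | true = refl
  ... | false = ⊥-elim (long (walks-leaf H (steps L) v₀ v₁ a₀ e))

  open From v₀ v₁ a₀ i₀ i₁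

  unique-≤r : ∀ {xs} → Unique xs → (∀ {x} → x ∈ xs → isNonLeaf H x ≡ true) → length xs ≤ r
  unique-≤r {xs} u h = subst (length xs ≤_) count (length-≤-sum (isNonLeaf H) u h)

  private
    applyUpTo-nonLeaf : ∀ (f : ℕ → Fin n) m → (∀ i → i < m → isNonLeaf H (f i) ≡ true) → ∀ {x} → x ∈ applyUpTo f m → isNonLeaf H x ≡ true
    applyUpTo-nonLeaf f m h x∈ with ∈-applyUpTo⁻ f x∈
    ... | i , lt , refl = h i lt

  -- A walk that does not stop within r moves would visit more than r distinct nonleaf vertices.
  failure : ∃ λ k → k < r × Good k × ¬ Continues (p k) (p (suc k))
  failure with first-failure r
  ... | inj₂ f = f
  ... | inj₁ good = ⊥-elim (1+n≰n (subst (_≤ r) (length-applyUpTo p (suc r)) (unique-≤r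
      (Uniqueₚ.applyUpTo⁺₁ p (suc r) λ {i} {j} i<j j< → p-injective thin end good j (<⇒≤ j<) i i<j)
      (applyUpTo-nonLeaf p (suc r) λ i lt → p-nonLeaf good i (<⇒≤ lt)))))

  k : ℕ
  k = proj₁ failure

  good : Good k
  good = proj₁ (proj₂ (proj₂ failure))

  stuck : ¬ Continues (p k) (p (suc k))
  stuck = proj₂ (proj₂ (proj₂ failure))

  L≤k : L ≤ k
  L≤k with L ≤? k
  ... | yes le = le
  ... | no nle = ⊥-elim (stuck (walks⇒good thin L 0 (λ _ ()) long k (≰⇒> nle)))

  closed : ∀ i → i ≤ suc k → ∀ {x} → isNonLeaf H x ≡ true → adj H (p i) x ≡ true →
    ∃ λ j → j ≤ suc k × p j ≡ x × (j ≡ suc i ⊎ i ≡ suc j)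
  closed = p-closed thin end good stuck

  distinct : ∀ {i j} → i < j → j ≤ suc k → p i ≢ p j
  distinct {i} {j} i<j le = p-injective thin end good j le i i<j

  OnPath : Fin n → Set
  OnPath w = ∃ λ j → j < suc (suc k) × p j ≡ w

  onPath? : ∀ w → Dec (OnPath w)
  onPath? w = anyUpTo? (λ j → p j ≟ w) (suc (suc k))

  spineDegree≤2 : ∀ v → spineDegree H v ≤ 2
  spineDegree≤2 v with spineDegree H v ≤? 2
  ... | yes le = le
  ... | no nle with three-members _ (subst (3 ≤_) (spineDegree-count H v) (≰⇒> nle))
  ...   | x , y , z , (x≢y , x≢z , y≢z) , hx , hy , hz with thin (adj′ hx) (adj′ hy) (adj′ hz)
            (proj₁ (∧-true hx)) (proj₁ (∧-true hy)) (proj₁ (∧-true hz))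
    where
    adj′ : ∀ {u} → isNonLeaf H u ∧ adj H u v ≡ true → adj H v u ≡ true
    adj′ {u} h = trans (Graph.sym H v u) (proj₂ (∧-true {isNonLeaf H u} h))
  ...     | inj₁ e = ⊥-elim (x≢y e)
  ...     | inj₂ (inj₁ e) = ⊥-elim (x≢z e)
  ...     | inj₂ (inj₂ e) = ⊥-elim (y≢z e)

  deficit : Fin n → ℕ
  deficit v = ⟦ isNonLeaf H v ⟧ * (2 ∸ spineDegree H v)

  -- This is 2 r - 2 (r - 1), the number of neighbours that the r nonleaf vertices lack to having
  -- two each.
  deficit-total : sum deficit ≡ 2
  deficit-total = +-cancelʳ-≡ (2 * pred r) _ _ (begin
    sum deficit + 2 * pred r  ≡⟨ cong (sum deficit +_) pairs ⟨
    sum deficit + nonLeafPairs H  ≡⟨ sum-+ deficit _ ⟨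
    sum (λ v → deficit v + ⟦ isNonLeaf H v ⟧ * spineDegree H v) ≡⟨ sum-cong-≗ (λ v → trans
                (sym (*-distribˡ-+ ⟦ isNonLeaf H v ⟧ (2 ∸ spineDegree H v) _))
                (cong (⟦ isNonLeaf H v ⟧ *_) (m∸n+n≡m (spineDegree≤2 v)))) ⟩
    sum (λ v → ⟦ isNonLeaf H v ⟧ * 2)  ≡⟨ sum-*ʳ 2 _ ⟨
    sum (λ v → ⟦ isNonLeaf H v ⟧) * 2  ≡⟨ cong (_* 2) count ⟩
    r * 2  ≡⟨ double (≤-trans (s≤s z≤n) (proj₁ (proj₂ failure))) ⟩
    2 + 2 * pred r  ∎)
    where
    open ≡-Reasoning
    double : ∀ {r} → 0 < r → r * 2 ≡ 2 + 2 * pred r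
    double {suc r} _ = cong (2 +_) (*-comm r 2)

  deficit≥1 : ∀ {v} → isNonLeaf H v ≡ true → (∀ {x y} → x ≢ y → isNonLeaf H x ∧ adj H x v ≡ true → isNonLeaf H y ∧ adj H y v ≡ true → Data.Empty.⊥) →
    1 ≤ deficit v
  deficit≥1 {v} iv none with spineDegree H v ≤? 1
  ... | yes le = subst (λ b → 1 ≤ ⟦ b ⟧ * (2 ∸ spineDegree H v)) (sym iv) (≤-trans (m<n⇒0<n∸m (s≤s le)) (≤-reflexive (sym (+-identityʳ _))))
  ... | no nle with two-members _ (subst (2 ≤_) (spineDegree-count H v) (≰⇒> nle))
  ...   | x , y , x≢y , hx , hy = ⊥-elim (none x≢y hx hy)

  sym-adj : ∀ {u v} → adj H u v ≡ true → adj H v u ≡ true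
  sym-adj {u} {v} a = trans (Graph.sym H v u) a

  -- The two ends of the path use up the total deficit of 2, so a nonleaf off the path lacks no
  -- neighbour.
  off-path : ∀ {w} → isNonLeaf H w ≡ true → ¬ OnPath w →
    ∃₂ λ x y → x ≢ y × isNonLeaf H x ∧ adj H x w ≡ true × isNonLeaf H y ∧ adj H y w ≡ true
  off-path {w} iw off with 2 ≤? spineDegree H w
  ... | yes le = two-members _ (subst (2 ≤_) (spineDegree-count H w) le)
  ... | no nle = ⊥-elim (1+n≰n (begin
    3  ≤⟨ +-mono-≤ first (+-mono-≤ last (+-mono-≤ here′ (z≤n {0}))) ⟩
    sumᴸ (map deficit (p 0 ∷ p (suc k) ∷ w ∷ []))  ≤⟨ sum-unique-≤ deficit unique ⟩
    sum deficit  ≡⟨ deficit-total ⟩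
    2  ∎))
    where
    open ≤-Reasoning
    first : 1 ≤ deficit (p 0)
    first = deficit≥1 i₀ λ {x} {y} ne hx hy → ne (trans
      (end x (proj₁ (∧-true hx)) (proj₂ (∧-true {isNonLeaf H x} hx)))
      (sym (end y (proj₁ (∧-true hy)) (proj₂ (∧-true {isNonLeaf H y} hy)))))
    before : ∀ {x} → isNonLeaf H x ∧ adj H x (p (suc k)) ≡ true → x ≡ p k
    before {x} hx with closed (suc k) ≤-refl (proj₁ (∧-true hx)) (sym-adj (proj₂ (∧-true {isNonLeaf H x} hx)))
    ... | .(suc (suc k)) , le , _ , inj₁ refl = ⊥-elim (1+n≰n le)
    ... | .k , _ , e , inj₂ refl = sym e
    last : 1 ≤ deficit (p (suc k))
    last = deficit≥1 (p-nonLeaf good (suc k) ≤-refl) λ ne hx hy → ne (trans (before hx) (sym (before hy)))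
    here′ : 1 ≤ deficit w
    here′ = subst (λ b → 1 ≤ ⟦ b ⟧ * (2 ∸ spineDegree H w)) (sym iw) (≤-trans (m<n⇒0<n∸m (≰⇒> nle)) (≤-reflexive (sym (+-identityʳ _))))
    unique : Unique (p 0 ∷ p (suc k) ∷ w ∷ [])
    unique = (distinct (s≤s z≤n) ≤-refl ∷ (λ e → off (0 , s≤s z≤n , e)) ∷ []) ∷ ((λ e → off (suc k , ≤-refl , e)) ∷ []) ∷ [] ∷ []

  module Outside (w x : Fin n) (a : adj H w x ≡ true) (iw : isNonLeaf H w ≡ true) (ix : isNonLeaf H x ≡ true) (off : ¬ OnPath w) where

    module Q = From w x a iw ix

    stays-off : ∀ {u v} → isNonLeaf H u ≡ true → ¬ OnPath u → adj H u v ≡ true → ¬ OnPath v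
    stays-off iu offu auv (j , j< , refl) with closed j (s≤s⁻¹ j<) iu (sym-adj auv)
    ... | j′ , le , e , _ = offu (j′ , s≤s le , e)

    -- Off the path `off-path` always offers a neighbour to go on to, and the path is closed under
    -- nonleaf neighbours, so it is never entered.
    forever : ∀ m → Q.Good m × (∀ i → i ≤ suc m → ¬ OnPath (Q.p i))
    forever zero = (λ _ ()) , λ { zero _ → off ; (suc zero) _ → stays-off iw off a ; (suc (suc i)) (s≤s ()) }
    forever (suc m) with forever m
    ... | goodₘ , offₘ = good′ , off′
      where
      i′ = Q.p-nonLeaf goodₘ (suc m) ≤-refl
      cont : Continues (Q.p m) (Q.p (suc m))
      cont with off-path i′ (offₘ (suc m) ≤-refl)
      ... | y , z , y≢z , hy , hz with y ≟ Q.p m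
      ...   | no ne = continue (sym-adj (proj₂ (∧-true {isNonLeaf H y} hy))) ne (proj₁ (∧-true hy))
      ...   | yes refl = continue (sym-adj (proj₂ (∧-true {isNonLeaf H z} hz))) (y≢z ∘ sym) (proj₁ (∧-true hz))
      good′ : Q.Good (suc m)
      good′ i lt with m≤n⇒m<n∨m≡n (s≤s⁻¹ lt)
      ... | inj₁ l = goodₘ i l
      ... | inj₂ refl = cont
      off′ : ∀ i → i ≤ suc (suc m) → ¬ OnPath (Q.p i)
      off′ i le with m≤n⇒m<n∨m≡n le
      ... | inj₁ l = offₘ i (s≤s⁻¹ l)
      ... | inj₂ refl = stays-off i′ (offₘ (suc m) ≤-refl) (Q.p-adj good′ (suc m) ≤-refl)

    Q-adj : ∀ i → adj H (Q.p i) (Q.p (suc i)) ≡ true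
    Q-adj i = Q.p-adj (proj₁ (forever i)) i ≤-refl

    Q-nonLeaf : ∀ i → isNonLeaf H (Q.p i) ≡ true
    Q-nonLeaf i = Q.p-nonLeaf (proj₁ (forever i)) i (n≤1+n i)

    -- A first repetition closes a cycle of length at most N, against `noCycle`; gaps of 1 and 2
    -- would be a loop and a turn back.
    Q-distinct : ∀ b → b ≤ N → ∀ a → a < b → Q.p a ≢ Q.p b
    Q-distinct = <-rec (λ b → b ≤ N → ∀ a → a < b → Q.p a ≢ Q.p b) body
      where
      body : ∀ b → (∀ {b′} → b′ < b → b′ ≤ N → ∀ a → a < b′ → Q.p a ≢ Q.p b′) → b ≤ N → ∀ a → a < b → Q.p a ≢ Q.p b
      body b ih b≤N a a<b e with m≤n⇒∃[o]m+o≡n a<b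
      ... | zero , refl = adj-irrefl H (Q-adj a) (trans e (cong (Q.p ∘ suc) (+-identityʳ a)))
      ... | suc zero , refl = Q.p-turn (proj₁ (forever (suc a))) a ≤-refl
              (trans (cong (Q.p ∘ suc) (trans (cong suc (sym (+-identityʳ a))) (sym (+-suc a 0)))) (sym e))
      ... | suc (suc c) , refl = noCycle m (≤-trans (s≤s (m≤n+m (suc (suc c)) a)) b≤N) (s≤s (s≤s (s≤s z≤n))) g
              (λ {i} {j} i<j j<m → ih (subst (a + j <_) (+-suc a (suc (suc c))) (+-monoʳ-< a j<m))
                (≤-trans (<⇒≤ (subst (a + j <_) (+-suc a (suc (suc c))) (+-monoʳ-< a j<m))) b≤N) (a + i) (+-monoʳ-< a i<j))
              (λ i _ → subst (λ l → adj H (g i) (Q.p l) ≡ true) (sym (+-suc a i)) (Q-adj (a + i)))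
              g0≡gm
        where
        g : ℕ → Fin n
        g i = Q.p (a + i)
        m : ℕ
        m = suc (suc (suc c))
        g0≡gm : g 0 ≡ g m
        g0≡gm = trans (cong Q.p (+-identityʳ a)) (trans e (cong Q.p (sym (+-suc a (suc (suc c))))))

    -- The path has at least L + 2 vertices and the walk off it N + 1 distinct ones, more nonleaf
    -- vertices than `room` allows.
    absurd : Data.Empty.⊥
    absurd = 1+n≰n (begin
      suc r  ≤⟨ s≤s room ⟩
      suc (L + 2 + N)  ≡⟨ trans (sym (+-suc (L + 2) N)) (cong (_+ suc N) (+-comm L 2)) ⟩
      suc (suc L) + suc N  ≤⟨ +-monoˡ-≤ (suc N) (s≤s (s≤s L≤k)) ⟩
      suc (suc k) + suc N  ≡⟨ cong₂ _+_ (length-applyUpTo p (suc (suc k))) (length-applyUpTo Q.p (suc N)) ⟨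
      length (applyUpTo p (suc (suc k))) + length (applyUpTo Q.p (suc N)) ≡⟨ length-++ (applyUpTo p (suc (suc k))) ⟨
      length (applyUpTo p (suc (suc k)) ++ applyUpTo Q.p (suc N)) ≤⟨ unique-≤r unique nonLeaf ⟩
      r ∎)
      where
      open ≤-Reasoning
      unique : Unique (applyUpTo p (suc (suc k)) ++ applyUpTo Q.p (suc N))
      unique = Uniqueₚ.++⁺
        (Uniqueₚ.applyUpTo⁺₁ p (suc (suc k)) λ i<j j< → distinct i<j (s≤s⁻¹ j<))
        (Uniqueₚ.applyUpTo⁺₁ Q.p (suc N) λ {i} {j} i<j j< → Q-distinct j (s≤s⁻¹ j<) i i<j)
        λ { (v∈ , v∈′) → case (∈-applyUpTo⁻ p v∈ , ∈-applyUpTo⁻ Q.p v∈′) of λ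
          { ((i , i< , refl) , (j , j< , e)) → proj₂ (forever j) j (n≤1+n j) (i , i< , e) } }
      nonLeaf : ∀ {v} → v ∈ applyUpTo p (suc (suc k)) ++ applyUpTo Q.p (suc N) → isNonLeaf H v ≡ true
      nonLeaf v∈ with ∈-++⁻ (applyUpTo p (suc (suc k))) v∈
      ... | inj₁ v∈₁ = applyUpTo-nonLeaf p (suc (suc k)) (λ i lt → p-nonLeaf good i (s≤s⁻¹ lt)) v∈₁
      ... | inj₂ v∈₂ = applyUpTo-nonLeaf Q.p (suc N) (λ i _ → Q-nonLeaf i) v∈₂

  all-on-path : ∀ w → isNonLeaf H w ≡ true → OnPath w
  all-on-path w iw with onPath? w
  ... | yes on = on
  ... | no off with off-path iw off
  ...   | x , _ , _ , hx , _ = ⊥-elim (Outside.absurd w x (sym-adj (proj₂ (∧-true {isNonLeaf H x} hx))) iw (proj₁ (∧-true hx)) off)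

  path-injective : ∀ {i j} → i < suc (suc k) → j < suc (suc k) → p i ≡ p j → i ≡ j
  path-injective {i} {j} i< j< e with <-cmp i j
  ... | tri< lt _ _ = ⊥-elim (distinct lt (s≤s⁻¹ j<) e)
  ... | tri≈ _ eq _ = eq
  ... | tri> _ _ gt = ⊥-elim (distinct gt (s≤s⁻¹ i<) (sym e))

  path-spine : Spine H (suc (suc k))
  path-spine = record
    { at = p
    ; at-injective = path-injective
    ; at-nonLeaf = λ {i} lt → p-nonLeaf good i (s≤s⁻¹ lt)
    ; at-onto = all-on-path
    ; at-adj = λ {i} lt → p-adj good i (s≤s⁻¹ (s≤s⁻¹ lt))
    ; at-adj⁻ = λ {i} {j} i< j< a → case closed i (s≤s⁻¹ i<) (p-nonLeaf good j (s≤s⁻¹ j<)) a of λ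
        { (j′ , le , e , h) → subst (λ j → j ≡ suc i ⊎ i ≡ suc j) (path-injective (s≤s le) j< e) h }
    ; deg≢0 = deg≢0
    ; leaf-adj = leaf-adj
    }

  spine : Spine H r
  spine = subst (Spine H) (trans (sym (nonLeafCount-spine path-spine)) count) path-spine

-- Sequences determined up to reversal

-- The hypothesis says (a - a*)(c - c*) = 0; the larger of a and a* is written as the smaller one
-- plus d.
rectangle : ∀ a a* c c* → a * c + a* * c* ≡ a * c* + a* * c → a ≡ a* ⊎ c ≡ c*
rectangle a a* c c* e with ≤-total a a*
... | inj₁ le with m≤n⇒∃[o]m+o≡n le
...   | d , refl = go d (+-cancelˡ-≡ (a * c + a * c*) _ _ (trans (sym (left a d c c*)) (trans e (right a d c c*))))
  where
  left : ∀ a d c c* → a * c + (a + d) * c* ≡ (a * c + a * c*) + d * c*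
  left = solve-∀
  right : ∀ a d c c* → a * c* + (a + d) * c ≡ (a * c + a * c*) + d * c
  right = solve-∀
  go : ∀ d → d * c* ≡ d * c → a ≡ a + d ⊎ c ≡ c*
  go zero _ = inj₁ (sym (+-identityʳ a))
  go (suc d) q = inj₂ (sym (*-cancelˡ-≡ c* c (suc d) q))
rectangle a a* c c* e | inj₂ le with m≤n⇒∃[o]m+o≡n le
... | d , refl = go d (+-cancelˡ-≡ (a* * c + a* * c*) _ _ (trans (sym (left a* d c c*)) (trans e (right a* d c c*))))
  where
  left : ∀ a d c c* → (a + d) * c + a * c* ≡ (a * c + a * c*) + d * c
  left = solve-∀
  right : ∀ a d c c* → (a + d) * c* + a * c ≡ (a * c + a * c*) + d * c*
  right = solve-∀
  go : ∀ d → d * c ≡ d * c* → a* + d ≡ a* ⊎ c ≡ c*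
  go zero _ = inj₁ (+-identityʳ a*)
  go (suc d) q = inj₂ (*-cancelˡ-≡ c c* (suc d) q)

-- Sum and sum of squares give the product, and then (x′ - x)(x′ - y) = 0 is an instance of
-- `rectangle`.
sum-and-squares : ∀ x y x′ y′ → x + y ≡ x′ + y′ → x * x + y * y ≡ x′ * x′ + y′ * y′ →
  (x′ ≡ x × y′ ≡ y) ⊎ (x′ ≡ y × y′ ≡ x)
sum-and-squares x y x′ y′ s q = case rectangle x′ x x′ y product of λ
  { (inj₁ e) → inj₁ (e , +-cancelˡ-≡ x′ y′ y (trans (sym s) (cong (_+ y) (sym e))))
  ; (inj₂ e) → inj₂ (e , +-cancelˡ-≡ x′ y′ x (trans (sym s) (trans (+-comm x y) (cong (_+ x) (sym e))))) }
  where
  open ≡-Reasoning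
  square : ∀ x y → (x + y) * (x + y) ≡ (x * x + y * y) + 2 * (x * y)
  square = solve-∀
  same-product : x * y ≡ x′ * y′
  same-product = *-cancelˡ-≡ (x * y) (x′ * y′) 2 (+-cancelˡ-≡ (x * x + y * y) _ _ (begin
    (x * x + y * y) + 2 * (x * y)       ≡⟨ square x y ⟨
    (x + y) * (x + y)  ≡⟨ cong₂ _*_ s s ⟩
    (x′ + y′) * (x′ + y′)  ≡⟨ square x′ y′ ⟩
    (x′ * x′ + y′ * y′) + 2 * (x′ * y′) ≡⟨ cong (_+ 2 * (x′ * y′)) q ⟨
    (x * x + y * y) + 2 * (x′ * y′)     ∎))
  product : x′ * x′ + x * y ≡ x′ * y + x * x′
  product = begin
    x′ * x′ + x * y   ≡⟨ cong (x′ * x′ +_) same-product ⟩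
    x′ * x′ + x′ * y′ ≡⟨ *-distribˡ-+ x′ x′ y′ ⟨
    x′ * (x′ + y′)    ≡⟨ cong (x′ *_) s ⟨
    x′ * (x + y)      ≡⟨ *-distribˡ-+ x′ x y ⟩
    x′ * x + x′ * y   ≡⟨ +-comm (x′ * x) _ ⟩
    x′ * y + x′ * x   ≡⟨ cong (x′ * y +_) (*-comm x′ x) ⟩
    x′ * y + x * x′   ∎

-- The sequence c is b read from the other end; k + l ≡ pred r states this without truncated
-- subtraction.
record Mirror (r : ℕ) (b c : ℕ → ℕ) : Set where
  field
    mirror : ∀ {k l} → k + l ≡ pred r → k < r → b k ≡ c l
    vanish : ∀ k → r ≤ k → b k ≡ 0
    vanish* : ∀ k → r ≤ k → c k ≡ 0

flip : ∀ {r b c} → Mirror r b c → Mirror r c b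
flip {r} M = record
  { mirror = λ {k} {l} e lt → sym (mirror (trans (+-comm l k) e) (≤-<-trans (m≤m+n l k) (subst (_< r) (sym (trans (+-comm l k) e)) (pred< lt))))
  ; vanish = vanish*
  ; vanish* = vanish }
  where
  open Mirror M
  pred< : ∀ {k r} → k < r → pred r < r
  pred< {r = suc r} _ = ≤-refl

-- The one (r odd) or two (r even) middle positions among 0, …, r ∸ 1.
Middle : ℕ → ℕ → Set
Middle r k = 2 * k ≤ r × r ≤ 2 * k + 2

module Balance (r : ℕ) (f f′ : ℕ → ℕ) (Σ≡ : Σ< r f ≡ Σ< r f′)
  (off : ∀ k → k < r → ¬ Middle r k → f k ≡ f′ k)
  (const : ∀ {k l} → Middle r k → Middle r l → k < r → l < r → f k ≡ f l × f′ k ≡ f′ l) where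

  middle? : ∀ k → Dec (Middle r k)
  middle? k with 2 * k ≤? r | r ≤? 2 * k + 2
  ... | yes p | yes q = yes (p , q)
  ... | no np | _ = no (np ∘ proj₁)
  ... | yes _ | no nq = no (nq ∘ proj₂)

  -- The two functions can differ only in the middle, where each is constant. A difference there
  -- would have the same sign at all middle positions, against the equal totals.
  balance : ∀ k → k < r → f k ≡ f′ k
  balance k k<r with middle? k
  ... | no nm = off k k<r nm
  ... | yes m with <-cmp (f k) (f′ k)
  ...   | tri≈ _ e _ = e
  ...   | tri< lt _ _ = ⊥-elim (<-irrefl Σ≡ (Σ<-mono-< r le k k<r lt))
    where
    le : ∀ i → i < r → f i ≤ f′ i
    le i i<r with middle? i
    ... | no nm = ≤-reflexive (off i i<r nm)
    ... | yes m′ = subst₂ _≤_ (proj₁ (const m m′ k<r i<r)) (proj₂ (const m m′ k<r i<r)) (<⇒≤ lt)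
  ...   | tri> _ _ gt = ⊥-elim (<-irrefl (sym Σ≡) (Σ<-mono-< r le k k<r gt))
    where
    le : ∀ i → i < r → f′ i ≤ f i
    le i i<r with middle? i
    ... | no nm = ≤-reflexive (sym (off i i<r nm))
    ... | yes m′ = subst₂ _≤_ (proj₂ (const m m′ k<r i<r)) (proj₁ (const m m′ k<r i<r)) (<⇒≤ gt)

consecutive : ∀ {k l r} → k < l → 2 * l ≤ r → r ≤ 2 * k + 2 → k + l ≡ pred r
consecutive {k} {l} {r} lt lr rk with ≤-antisym (*-cancelˡ-≤ {l} {suc k} 2 (≤-trans (≤-trans lr rk) (≤-reflexive (double k)))) lt
  where
  double : ∀ k → 2 * k + 2 ≡ 2 * suc k
  double = solve-∀
... | refl = cong pred (trans (odd k) (≤-antisym lr (≤-trans rk (≤-reflexive (double k)))))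
  where
  double : ∀ k → 2 * k + 2 ≡ 2 * suc k
  double = solve-∀
  odd : ∀ k → suc (k + suc k) ≡ 2 * suc k
  odd = solve-∀

middle-pair : ∀ {r k l} → Middle r k → Middle r l → k ≡ l ⊎ k + l ≡ pred r
middle-pair {r} {k} {l} (p , q) (p′ , q′) with <-cmp k l
... | tri≈ _ e _ = inj₁ e
... | tri< lt _ _ = inj₂ (consecutive lt p′ q)
... | tri> _ _ gt = inj₂ (trans (+-comm k l) (consecutive gt p q′))

module Pairing (b c b′ c′ : ℕ → ℕ) where

  Same Swap : ℕ → Set
  Same k = b′ k ≡ b k × c′ k ≡ c k
  Swap k = b′ k ≡ c k × c′ k ≡ b k

  Product≡ : ℕ → ℕ → Set
  Product≡ i j = b i * b j + c i * c j ≡ b′ i * b′ j + c′ i * c′ j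

  -- If the pair at K is swapped and asymmetric, `rectangle` forces all earlier pairs to be
  -- symmetric, so that they count as swapped too. A symmetric pair at K counts as not swapped.
  extend : ∀ K → (∀ i → i < K → Same i) → Same K ⊎ Swap K → (∀ i → i < K → Product≡ i K) →
    (∀ i → i < suc K → Same i) ⊎ (∀ i → i < suc K → Swap i)
  extend K same (inj₁ s) prod = inj₁ λ i lt → case m≤n⇒m<n∨m≡n (s≤s⁻¹ lt) of λ { (inj₁ l) → same i l ; (inj₂ refl) → s }
  extend K same (inj₂ (p , q)) prod with b K ℕ.≟ c K
  ... | yes e = inj₁ λ i lt → case m≤n⇒m<n∨m≡n (s≤s⁻¹ lt) of λ { (inj₁ l) → same i l ; (inj₂ refl) → trans p (sym e) , trans q e }
  ... | no ne = inj₂ λ i lt → case m≤n⇒m<n∨m≡n (s≤s⁻¹ lt) of λ { (inj₁ l) → swapped i l ; (inj₂ refl) → p , q }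
    where
    swapped : ∀ i → i < K → Swap i
    swapped i l with same i l
    ... | s , t with rectangle (b i) (c i) (b K) (c K) (trans (prod i l) (cong₂ _+_ (cong₂ _*_ s p) (cong₂ _*_ t q)))
    ...   | inj₁ e = trans s e , trans t (sym e)
    ...   | inj₂ e = ⊥-elim (ne e)

open Pairing public using (Same; Swap; Product≡)

coherent : ∀ b c b′ c′ K → (∀ i → i < K → Same b c b′ c′ i ⊎ Swap b c b′ c′ i) →
  (∀ i j → i < j → j < K → Product≡ b c b′ c′ i j) →
  (∀ i → i < K → Same b c b′ c′ i) ⊎ (∀ i → i < K → Swap b c b′ c′ i)
coherent b c b′ c′ zero _ _ = inj₁ λ i ()
coherent b c b′ c′ (suc K) pair prod with coherent b c b′ c′ K (λ i lt → pair i (m≤n⇒m≤1+n lt)) (λ i j i<j j<K → prod i j i<j (m≤n⇒m≤1+n j<K))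
... | inj₁ same = Pairing.extend b c b′ c′ K same (pair K ≤-refl) λ i lt → prod i K lt ≤-refl
-- Exchanging b′ and c′ turns `Swap` into `Same`, so the same extension step applies.
... | inj₂ swap with Pairing.extend b c c′ b′ K (λ i lt → proj₂ (swap i lt) , proj₁ (swap i lt))
        ([ (λ { (p , q) → inj₂ (q , p) }) , (λ { (p , q) → inj₁ (q , p) }) ]′ (pair K ≤-refl))
        (λ i lt → trans (prod i K lt ≤-refl) (+-comm (b′ i * b′ K) _))
...   | inj₁ h = inj₂ λ i lt → proj₂ (h i lt) , proj₁ (h i lt)
...   | inj₂ h = inj₁ λ i lt → proj₂ (h i lt) , proj₁ (h i lt)

correlation : (ℕ → ℕ) → (ℕ → ℕ) → ℕ → ℕ → ℕ
correlation b c d k = b k * b (k + suc d) + c k * c (k + suc d)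

position* : ∀ {r k} → k < r → ∃ λ l → k + l ≡ pred r
position* {suc r} {k} lt = m≤n⇒∃[o]m+o≡n (s≤s⁻¹ lt)

position*-< : ∀ {r k l} → k + l ≡ pred r → k < r → l < r
position*-< {suc r} {k} {l} e lt = s≤s (subst (l ≤_) e (m≤n+m l k))

-- The positions with 2 j + 3 ≤ r and their mirror images are all but the middle ones, which are
-- left to `Balance`.
level : ∀ r (f f′ : ℕ → ℕ) → Σ< r f ≡ Σ< r f′ →
  (∀ {k l} → k + l ≡ pred r → k < r → f k ≡ f l) → (∀ {k l} → k + l ≡ pred r → k < r → f′ k ≡ f′ l) →
  (∀ j → 2 * j + 3 ≤ r → f j ≡ f′ j) → ∀ k → k < r → f k ≡ f′ k
level r f f′ Σ≡ sym-f sym-f′ direct = Balance.balance r f f′ Σ≡ off const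
  where
  near : ∀ k l r → k + l ≡ pred r → k < r → r < 2 * k → 2 * l + 3 ≤ r
  near k l (suc r) refl _ lt = ≤-trans (≤-reflexive (shape l)) (s≤s (+-monoˡ-≤ l (+-cancelˡ-≤ k (2 + l) k
      (≤-trans (≤-reflexive (shift k l)) (≤-trans lt (≤-reflexive (cong (k +_) (+-identityʳ k))))))))
    where
    shape : ∀ l → 2 * l + 3 ≡ 1 + (2 + l + l)
    shape = solve-∀
    shift : ∀ k l → k + (2 + l) ≡ 2 + (k + l)
    shift = solve-∀
  off : ∀ k → k < r → ¬ Middle r k → f k ≡ f′ k
  off k k<r nm with 2 * k + 3 ≤? r
  ... | yes le = direct k le
  ... | no nle with 2 * k ≤? r
  ...   | yes p = ⊥-elim (nm (p , s≤s⁻¹ (subst (r <_) (+-suc (2 * k) 2) (≰⇒> nle))))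
  ...   | no np with position* k<r
  ...     | l , e = trans (sym-f e k<r) (trans (direct l (near k l r e k<r (≰⇒> np))) (sym (sym-f′ e k<r)))
  const : ∀ {k l} → Middle r k → Middle r l → k < r → l < r → f k ≡ f l × f′ k ≡ f′ l
  const {k} {l} m m′ k<r l<r with middle-pair {r} {k} {l} m m′
  ... | inj₁ refl = refl , refl
  ... | inj₂ e = sym-f e k<r , sym-f′ e k<r

-- In both parities κ is the last position that does not lie behind its mirror image.
half : ∀ r → 1 ≤ r → ∃ λ κ → r ≡ suc (2 * κ) ⊎ r ≡ suc (suc (2 * κ))
half (suc zero) _ = 0 , inj₁ refl
half (suc (suc zero)) _ = 0 , inj₂ refl
half (suc (suc (suc r))) _ with half (suc r) (s≤s z≤n)
... | κ , inj₁ e = suc κ , inj₁ (trans (cong (2 +_) e) (cong suc (sym (*-suc 2 κ))))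
... | κ , inj₂ e = suc κ , inj₂ (trans (cong (2 +_) e) (cong (2 +_) (sym (*-suc 2 κ))))

first-asymmetric : ∀ (b c : ℕ → ℕ) K → (∀ i → i < K → b i ≡ c i) ⊎ ∃ λ i → i < K × b i ≢ c i × (∀ j → j < i → b j ≡ c j)
first-asymmetric b c zero = inj₁ λ i ()
first-asymmetric b c (suc K) with first-asymmetric b c K
... | inj₂ (i , lt , rest) = inj₂ (i , m≤n⇒m≤1+n lt , rest)
... | inj₁ all with b K ℕ.≟ c K
...   | no ne = inj₂ (K , ≤-refl , ne , all)
...   | yes e = inj₁ λ i lt → case m≤n⇒m<n∨m≡n (s≤s⁻¹ lt) of λ { (inj₁ l) → all i l ; (inj₂ refl) → e }

-- Here r = 2 κ + 2, the sequences b and b′ differ by swapping the two middle entries, and i is the first position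
-- with b i ≢ c i.  In the correlation at distance κ + 1 ∸ i only the two terms joining i or its mirror image to the
-- middle change, and they change by the same amount.
module MiddleSwap (i e : ℕ) (b c b′ c′ : ℕ → ℕ)
  (M : Mirror (suc (suc (2 * (i + suc e)))) b c) (M′ : Mirror (suc (suc (2 * (i + suc e)))) b′ c′)
  (same : ∀ k → k < i + suc e → Same b c b′ c′ k) (swap : Swap b c b′ c′ (i + suc e))
  (symmetric : ∀ j → j < i → b j ≡ c j) where

  private
    κ r d D D′ : ℕ
    κ = i + suc e
    r = suc (suc (2 * κ))
    d = suc e
    -- The value of either changing term before the swap, and `D′` after it. Their equality means (b
    -- i - c i)(b κ - c κ) = 0.
    D = b i * c κ + c i * b κ
    D′ = b i * b κ + c i * c κ
    t t′ : ℕ → ℕ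
    t = correlation b c d
    t′ = correlation b′ c′ d

    module M = Mirror M
    module M′ = Mirror M′
    module F = Mirror (flip M)
    module F′ = Mirror (flip M′)

    centre : suc κ + κ ≡ pred r
    centre = cong (λ x → suc (κ + x)) (sym (+-identityʳ κ))

    κ′<r : suc κ < r
    κ′<r = s≤s (s≤s (m≤m+n κ (κ + 0)))

    b-centre : b (suc κ) ≡ c κ
    b-centre = M.mirror centre κ′<r

    c-centre : c (suc κ) ≡ b κ
    c-centre = F.mirror centre κ′<r

    swap′ : Swap b c b′ c′ (suc κ)
    swap′ = trans (M′.mirror centre κ′<r) (trans (proj₂ swap) (sym c-centre)) ,
            trans (F′.mirror centre κ′<r) (trans (proj₁ swap) (sym b-centre))

    beyond : ∀ k → suc κ < k → k < r → Same b c b′ c′ k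
    beyond k lt k<r with position* k<r
    ... | l , eq = trans (M′.mirror eq k<r) (trans (proj₂ (same l l<κ)) (sym (M.mirror eq k<r))) ,
                   trans (F′.mirror eq k<r) (trans (proj₁ (same l l<κ)) (sym (F.mirror eq k<r)))
      where
      l<κ : l < κ
      l<κ = +-cancelˡ-< (suc κ) l κ (subst (suc κ + l <_) (trans eq (sym centre)) (+-monoˡ-< l lt))

    both-same : ∀ {k l} → Same b c b′ c′ k → Same b c b′ c′ l → b k * b l + c k * c l ≡ b′ k * b′ l + c′ k * c′ l
    both-same (p , q) (p′ , q′) = sym (cong₂ _+_ (cong₂ _*_ p p′) (cong₂ _*_ q q′))

    symmetric-left : ∀ {k l} → Same b c b′ c′ k → b k ≡ c k → Swap b c b′ c′ l → b k * b l + c k * c l ≡ b′ k * b′ l + c′ k * c′ l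
    symmetric-left {k} {l} (p , q) s (p′ , q′) rewrite p | q | p′ | q′ | s = +-comm (c k * b l) (c k * c l)

    commute : ∀ x y u v → u * x + v * y ≡ x * u + y * v
    commute x y u v = cong₂ _+_ (*-comm u x) (*-comm v y)

    t-i : t i ≡ D × t′ i ≡ D′
    t-i rewrite +-suc i d | b-centre | c-centre | proj₁ swap′ | proj₂ swap′ | b-centre | c-centre
      | proj₁ (same i (m<m+n i (s≤s z≤n))) | proj₂ (same i (m<m+n i (s≤s z≤n))) = refl , refl

    point : ∀ k → k < r → t k ≡ t′ k ⊎ (t k ≡ D × t′ k ≡ D′)
    point k k<r with k + suc d <? r
    ... | no nlt = inj₁ (trans (zero-at b c M.vanish M.vanish*) (sym (zero-at b′ c′ M′.vanish M′.vanish*)))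
      where
      zero-at : ∀ b c → (∀ k → r ≤ k → b k ≡ 0) → (∀ k → r ≤ k → c k ≡ 0) → correlation b c d k ≡ 0
      zero-at b c vb vc rewrite vb (k + suc d) (≮⇒≥ nlt) | vc (k + suc d) (≮⇒≥ nlt) | *-zeroʳ (b k) | *-zeroʳ (c k) = refl
    ... | yes l<r with <-cmp k κ
    ...   | tri< k<κ _ _ = low (<-cmp (k + suc d) κ)
      where
      low : Tri (k + suc d < κ) (k + suc d ≡ κ) (κ < k + suc d) → t k ≡ t′ k ⊎ (t k ≡ D × t′ k ≡ D′)
      low (tri< l<κ _ _) = inj₁ (both-same (same k k<κ) (same (k + suc d) l<κ))
      -- Only position i - 1 is joined to κ itself from the left; there b and c agree, so the swap
      -- has no effect.
      low (tri≈ _ l≡κ _) = inj₁ (symmetric-left (same k k<κ) (symmetric k k<i) (subst (Swap b c b′ c′) (sym l≡κ) swap))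
        where
        k<i : k < i
        k<i = +-cancelʳ-≤ d (suc k) i (≤-reflexive (trans (sym (+-suc k d)) l≡κ))
      low (tri> _ _ κ<l) with k + suc d ℕ.≟ suc κ
      ... | yes l≡ = inj₂ (at-i k≡i)
        where
        k≡i : k ≡ i
        k≡i = +-cancelʳ-≡ d k i (suc-injective (trans (sym (+-suc k d)) l≡))
        at-i : k ≡ i → t k ≡ D × t′ k ≡ D′
        at-i refl = t-i
      ... | no ne = inj₁ (both-same (same k k<κ) (beyond (k + suc d) (≤∧≢⇒< κ<l (ne ∘ sym)) l<r))
    ...   | tri≈ _ refl _ = inj₂ (trans (cong₂ (λ x y → b κ * x + c κ * y) bl cl) (trans (+-comm (b κ * c i) _) (commute (b i) (c i) (c κ) (b κ)) ) ,
              (trans (cong₂ _+_ (cong₂ _*_ (proj₁ swap) (trans (proj₁ sl) bl)) (cong₂ _*_ (proj₂ swap) (trans (proj₂ sl) cl)))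
                (trans (+-comm (c κ * c i) _) (commute (b i) (c i) (b κ) (c κ)))))
      where
      mirror-i : κ + suc d + i ≡ pred r
      mirror-i = arithmetic i e
        where
        arithmetic : ∀ i e → i + (1 + e) + (2 + e) + i ≡ 1 + 2 * (i + (1 + e))
        arithmetic = solve-∀
      bl : b (κ + suc d) ≡ c i
      bl = M.mirror mirror-i l<r
      cl : c (κ + suc d) ≡ b i
      cl = F.mirror mirror-i l<r
      sl : Same b c b′ c′ (κ + suc d)
      sl = beyond (κ + suc d) (subst (suc κ <_) (sym (+-suc κ d)) (s≤s (m<m+n κ (s≤s z≤n)))) l<r
    ...   | tri> _ _ κ<k with k ℕ.≟ suc κ
    ...     | no ne = inj₁ (both-same (beyond k κ′<k k<r) (beyond (k + suc d) (<-trans κ′<k (m<m+n k (s≤s z≤n))) l<r))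
      where
      κ′<k : suc κ < k
      κ′<k = ≤∧≢⇒< κ<k (ne ∘ sym)
    -- From κ + 1 the distance leads to the mirror image of i - 1, again a symmetric position, or
    -- past the end when i is 0.
    ...     | yes refl = inj₁ (far (i ℕ.≟ 0))
      where
      sl : Same b c b′ c′ (suc κ + suc d)
      sl = beyond (suc κ + suc d) (m<m+n (suc κ) (s≤s z≤n)) l<r
      swapped : b (suc κ + suc d) ≡ c (suc κ + suc d) → t (suc κ) ≡ t′ (suc κ)
      swapped s rewrite proj₁ swap′ | proj₂ swap′ | proj₁ sl | proj₂ sl | s = +-comm (b (suc κ) * c (suc κ + suc d)) _
      far : Dec (i ≡ 0) → t (suc κ) ≡ t′ (suc κ)
      far (yes i≡0) = ⊥-elim (<-irrefl (trans (outside i≡0) refl) l<r)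
        where
        arithmetic : ∀ e → (2 + e) + (2 + e) ≡ 2 + 2 * (1 + e)
        arithmetic = solve-∀
        outside : i ≡ 0 → suc κ + suc d ≡ r
        outside refl = arithmetic e
      far (no i≢0) with m≤n⇒∃[o]m+o≡n (n≢0⇒n>0 i≢0)
      ... | j , j≡ = swapped (trans (M.mirror mirror-j l<r) (trans (sym (symmetric j j<i)) (sym (F.mirror mirror-j l<r))))
        where
        j<i : j < i
        j<i = ≤-reflexive j≡
        arithmetic : ∀ j e → (1 + ((1 + j) + (1 + e))) + (2 + e) + j ≡ 1 + 2 * ((1 + j) + (1 + e))
        arithmetic = solve-∀
        mirror-j : suc κ + suc d + j ≡ pred r
        mirror-j = subst (λ i → suc (i + suc e) + suc (suc e) + j ≡ suc (2 * (i + suc e))) j≡ (arithmetic j e)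

    i<r : i < r
    i<r = ≤-<-trans (m≤m+n i (suc e)) (<-trans ≤-refl κ′<r)

  conclusion : Σ< r t ≡ Σ< r t′ → b i ≡ c i ⊎ b κ ≡ c κ
  conclusion Σ≡ with <-cmp D D′
  ... | tri≈ _ eq _ = [ inj₁ , inj₂ ∘ sym ]′ (rectangle (b i) (c i) (c κ) (b κ) eq)
  ... | tri< lt _ _ = ⊥-elim (<-irrefl Σ≡ (Σ<-mono-< r (λ k k<r → le (point k k<r)) i i<r (subst₂ _<_ (sym (proj₁ t-i)) (sym (proj₂ t-i)) lt)))
    where
    le : ∀ {k} → t k ≡ t′ k ⊎ (t k ≡ D × t′ k ≡ D′) → t k ≤ t′ k
    le (inj₁ e) = ≤-reflexive e
    le (inj₂ (p , q)) = subst₂ _≤_ (sym p) (sym q) (<⇒≤ lt)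
  ... | tri> _ _ gt = ⊥-elim (<-irrefl (sym Σ≡) (Σ<-mono-< r (λ k k<r → le (point k k<r)) i i<r (subst₂ _<_ (sym (proj₂ t-i)) (sym (proj₁ t-i)) gt)))
    where
    le : ∀ {k} → t k ≡ t′ k ⊎ (t k ≡ D × t′ k ≡ D′) → t′ k ≤ t k
    le (inj₁ e) = ≤-reflexive (sym e)
    le (inj₂ (p , q)) = subst₂ _≤_ (sym q) (sym p) (<⇒≤ gt)

module _ {r κ : ℕ} (size : r ≡ suc (2 * κ) ⊎ r ≡ suc (suc (2 * κ))) {b c b′ c′ : ℕ → ℕ}
  (M : Mirror r b c) (M′ : Mirror r b′ c′) where

  private
    upper : ∀ {k l} → k + l ≡ pred r → κ < k → l ≤ κ
    upper {k} {l} e lt = +-cancelˡ-≤ (suc κ) l κ (≤-trans (+-monoˡ-≤ l lt) (≤-trans (≤-reflexive e) (pred-r size)))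
      where
      pred-r : r ≡ suc (2 * κ) ⊎ r ≡ suc (suc (2 * κ)) → pred r ≤ suc κ + κ
      pred-r (inj₁ refl) = m≤n⇒m≤1+n (≤-reflexive (cong (κ +_) (+-identityʳ κ)))
      pred-r (inj₂ refl) = s≤s (≤-reflexive (cong (κ +_) (+-identityʳ κ)))

    κ<r : κ < r
    κ<r = bound size
      where
      bound : r ≡ suc (2 * κ) ⊎ r ≡ suc (suc (2 * κ)) → κ < r
      bound (inj₁ refl) = s≤s (m≤m+n κ (κ + 0))
      bound (inj₂ refl) = s≤s (m≤n⇒m≤1+n (m≤m+n κ (κ + 0)))

  spread-same : (∀ i → i < suc κ → Same b c b′ c′ i) → ∀ k → k < r → b′ k ≡ b k
  spread-same same k k<r with k ≤? κ
  ... | yes le = proj₁ (same k (s≤s le))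
  ... | no nle with position* k<r
  ...   | l , e = trans (Mirror.mirror M′ e k<r) (trans (proj₂ (same l (s≤s (upper e (≰⇒> nle))))) (sym (Mirror.mirror M e k<r)))

  spread-swap : (∀ i → i < suc κ → Swap b c b′ c′ i) → ∀ k → k < r → b′ k ≡ c k
  spread-swap swap k k<r with k ≤? κ
  ... | yes le = proj₁ (swap k (s≤s le))
  ... | no nle with position* k<r
  ...   | l , e = trans (Mirror.mirror M′ e k<r) (trans (proj₂ (swap l (s≤s (upper e (≰⇒> nle))))) (sym (Mirror.mirror (flip M) e k<r)))

  -- Only the middle pair is open. If it is symmetric, or if all earlier pairs are, one orientation
  -- fits everywhere. Otherwise, for odd r the middle position is its own mirror image, and for even
  -- r `MiddleSwap` applies.
  finish : (∀ i → i < κ → Same b c b′ c′ i) → Same b c b′ c′ κ ⊎ Swap b c b′ c′ κ →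
    (∀ d → 2 * suc d ≤ r → Σ< r (correlation b c d) ≡ Σ< r (correlation b′ c′ d)) →
    (∀ k → k < r → b′ k ≡ b k) ⊎ (∀ k → k < r → b′ k ≡ c k)
  finish same (inj₁ s) _ = inj₁ (spread-same λ i lt → case m≤n⇒m<n∨m≡n (s≤s⁻¹ lt) of λ { (inj₁ l) → same i l ; (inj₂ refl) → s })
  finish same (inj₂ (p , q)) corr with b κ ℕ.≟ c κ
  ... | yes e = inj₁ (spread-same λ i lt → case m≤n⇒m<n∨m≡n (s≤s⁻¹ lt) of λ
          { (inj₁ l) → same i l ; (inj₂ refl) → trans p (sym e) , trans q e })
  ... | no ne with first-asymmetric b c κ
  ...   | inj₁ symmetric = inj₂ (spread-swap λ i lt → case m≤n⇒m<n∨m≡n (s≤s⁻¹ lt) of λ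
            { (inj₁ l) → trans (proj₁ (same i l)) (symmetric i l) , trans (proj₂ (same i l)) (sym (symmetric i l))
            ; (inj₂ refl) → p , q })
  ...   | inj₂ (i , i<κ , asym , symmetric) = ⊥-elim ([ asym , ne ]′ (contradict size))
    where
    contradict : r ≡ suc (2 * κ) ⊎ r ≡ suc (suc (2 * κ)) → b i ≡ c i ⊎ b κ ≡ c κ
    contradict (inj₁ refl) = inj₂ (Mirror.mirror M (cong (κ +_) (sym (+-identityʳ κ))) κ<r)
    contradict (inj₂ refl) with m≤n⇒∃[o]m+o≡n i<κ
    ... | e , eq = at-distance e (trans (+-suc i e) eq)
      where
      at-distance : ∀ e → i + suc e ≡ κ → b i ≡ c i ⊎ b κ ≡ c κ
      at-distance e refl = MiddleSwap.conclusion i e b c b′ c′ M M′ same (p , q) symmetric (corr (suc e)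
        (≤-trans (≤-reflexive (*-suc 2 (suc e))) (s≤s (s≤s (*-monoʳ-≤ 2 (m≤n+m (suc e) i))))))

mirror-sum : ∀ {r b c} → Mirror r b c → ∀ (h : ℕ → ℕ) → Σ< r (h ∘ b) ≡ Σ< r (h ∘ c)
mirror-sum {r} {b} {c} M h = trans (Σ<-cong r λ i lt → cong h (Mirror.mirror M (total-index lt) lt)) (sym (Σ<-reverse r (h ∘ c)))
  where
  total-index : ∀ {i r} → i < r → i + (r ∸ suc i) ≡ pred r
  total-index {i} {suc r} (s≤s lt) = m+[n∸m]≡n lt

sum-pair : ∀ {r b c b′ c′} → Mirror r b c → Mirror r b′ c′ → ∀ h → Σ< r (h ∘ b) ≡ Σ< r (h ∘ b′) →
  (∀ j → 2 * j + 3 ≤ r → h (b j) + h (c j) ≡ h (b′ j) + h (c′ j)) →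
  ∀ k → k < r → h (b k) + h (c k) ≡ h (b′ k) + h (c′ k)
sum-pair {r} {b} {c} {b′} {c′} M M′ h T direct = level r (λ k → h (b k) + h (c k)) (λ k → h (b′ k) + h (c′ k))
  (trans (Σ<-+ r (h ∘ b) (h ∘ c)) (trans
    (cong₂ _+_ T (trans (sym (mirror-sum M h)) (trans T (mirror-sum M′ h))))
    (sym (Σ<-+ r (h ∘ b′) (h ∘ c′)))))
  (symmetric M) (symmetric M′) direct
  where
  symmetric : ∀ {b c} → Mirror r b c → ∀ {k l} → k + l ≡ pred r → k < r → h (b k) + h (c k) ≡ h (b l) + h (c l)
  symmetric M e lt = trans (cong₂ _+_ (cong h (Mirror.mirror M e lt)) (cong h (Mirror.mirror (flip M) e lt))) (+-comm (h _) (h _))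

determined : ∀ {r} → 1 ≤ r → ∀ {b c b′ c′} → Mirror r b c → Mirror r b′ c′ →
  Σ< r b ≡ Σ< r b′ → Σ< r (λ k → b k * b k) ≡ Σ< r (λ k → b′ k * b′ k) →
  (∀ j → 2 * j + 3 ≤ r → b j + c j ≡ b′ j + c′ j) →
  (∀ i j → i ≤ j → 2 * j + 3 ≤ r → Product≡ b c b′ c′ i j) →
  (∀ d → 2 * suc d ≤ r → Σ< r (correlation b c d) ≡ Σ< r (correlation b′ c′ d)) →
  (∀ k → k < r → b′ k ≡ b k) ⊎ (∀ k → k < r → b′ k ≡ c k)
determined {r} 1≤r {b} {c} {b′} {c′} M M′ T₁ T₂ sums products corr =
  conclude (coherent b c b′ c′ κ (λ i lt → pair i (<-trans lt κ<r)) (λ i j i<j j<κ → products i j (<⇒≤ i<j) (small size j<κ)))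
  where
  κ : ℕ
  κ = proj₁ (half r 1≤r)
  size : r ≡ suc (2 * κ) ⊎ r ≡ suc (suc (2 * κ))
  size = proj₂ (half r 1≤r)
  κ<r : κ < r
  κ<r = bound size
    where
    bound : ∀ {κ r} → r ≡ suc (2 * κ) ⊎ r ≡ suc (suc (2 * κ)) → κ < r
    bound {κ} (inj₁ refl) = s≤s (m≤m+n κ (κ + 0))
    bound {κ} (inj₂ refl) = s≤s (m≤n⇒m≤1+n (m≤m+n κ (κ + 0)))
  small : ∀ {κ r j} → r ≡ suc (2 * κ) ⊎ r ≡ suc (suc (2 * κ)) → j < κ → 2 * j + 3 ≤ r
  small {κ} {j = j} size lt = bound size
    where
    double : ∀ j → 2 * j + 3 ≡ 1 + 2 * (1 + j)
    double = solve-∀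
    base : 2 * j + 3 ≤ suc (2 * κ)
    base = ≤-trans (≤-reflexive (double j)) (s≤s (*-monoʳ-≤ 2 lt))
    bound : ∀ {r} → r ≡ suc (2 * κ) ⊎ r ≡ suc (suc (2 * κ)) → 2 * j + 3 ≤ r
    bound (inj₁ refl) = base
    bound (inj₂ refl) = m≤n⇒m≤1+n base
  pair : ∀ k → k < r → Same b c b′ c′ k ⊎ Swap b c b′ c′ k
  pair k k<r = sum-and-squares (b k) (c k) (b′ k) (c′ k)
    (sum-pair M M′ id T₁ sums k k<r)
    (sum-pair M M′ (λ x → x * x) T₂ (λ j → products j j ≤-refl) k k<r)
  exchange : (∀ k → k < r → c′ k ≡ b k) ⊎ (∀ k → k < r → c′ k ≡ c k) → (∀ k → k < r → b′ k ≡ b k) ⊎ (∀ k → k < r → b′ k ≡ c k)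
  exchange (inj₁ h) = inj₂ λ k k<r → case position* k<r of λ
    { (l , e) → trans (Mirror.mirror M′ e k<r) (trans (h l (position*-< e k<r)) (sym (Mirror.mirror (flip M) e k<r))) }
  exchange (inj₂ h) = inj₁ λ k k<r → case position* k<r of λ
    { (l , e) → trans (Mirror.mirror M′ e k<r) (trans (h l (position*-< e k<r)) (sym (Mirror.mirror M e k<r))) }
  conclude : (∀ i → i < κ → Same b c b′ c′ i) ⊎ (∀ i → i < κ → Swap b c b′ c′ i) →
    (∀ k → k < r → b′ k ≡ b k) ⊎ (∀ k → k < r → b′ k ≡ c k)
  conclude (inj₁ same) = finish size M M′ same (pair κ κ<r) corr
  -- The swapped case is the other one with b′ and c′ exchanged.
  conclude (inj₂ swap) = exchange (finish size M (flip M′) (λ i lt → proj₂ (swap i lt) , proj₁ (swap i lt))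
    ([ (λ { (p , q) → inj₂ (q , p) }) , (λ { (p , q) → inj₁ (q , p) }) ]′ (pair κ κ<r))
    (λ d le → trans (corr d le) (Σ<-cong r λ k _ → +-comm (b′ k * b′ (k + suc d)) _)))

-- Graphs with equal degrees along their spines

⟦⟧-injective : ∀ {b c} → ⟦ b ⟧ ≡ ⟦ c ⟧ → b ≡ c
⟦⟧-injective {true} {true} _ = refl
⟦⟧-injective {false} {false} _ = refl

lookup-unique : ∀ {A : Set} {xs : List A} → Unique xs → ∀ {i j} → lookup xs i ≡ lookup xs j → i ≡ j
lookup-unique (_ ∷ u) {zero} {zero} e = refl
lookup-unique (x∉ ∷ u) {zero} {suc j} e = ⊥-elim (All.lookup x∉ (∈-lookup j) e)
lookup-unique (x∉ ∷ u) {suc i} {zero} e = ⊥-elim (All.lookup x∉ (∈-lookup i) (sym e))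
lookup-unique (_ ∷ u) {suc i} {suc j} e = cong suc (lookup-unique u e)

injective⇒surjective : ∀ {n} (f : Fin n → Fin n) → (∀ {x y} → f x ≡ f y → x ≡ y) → ∀ y → ∃ λ x → f x ≡ y
injective⇒surjective {n} f inj y with any? (λ x → f x ≟ y)
... | yes hit = hit
... | no miss = ⊥-elim (1+n≰n (begin
  suc n  ≡⟨ cong suc (trans (length-map f (allFin n)) (length-tabulate {n = n} id)) ⟨
  length (y ∷ map f (allFin n))       ≤⟨ length-≤-sum (λ _ → true) unique (λ _ → refl) ⟩
  sum {n} (λ _ → 1)  ≡⟨ sum-const-1 n ⟩
  n  ∎))
  where
  open ≤-Reasoning
  unique : Unique (y ∷ map f (allFin n))
  unique = All.tabulate (λ z∈ e → case ∈-map⁻ f z∈ of λ { (x , _ , e′) → miss (x , sym (trans e e′)) }) ∷ Uniqueₚ.map⁺ inj (Uniqueₚ.allFin⁺ n)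

module Leaves {n r} {G : Graph (Fin n)} (S : Spine G r) where

  open Spine S

  isLeafAt : ℕ → Fin n → Bool
  isLeafAt i x = adj G (at i) x ∧ not (isNonLeaf G x)

  leaves : ℕ → List (Fin n)
  leaves i = members (isLeafAt i)

  leaves-adj : ∀ {i x} → x ∈ leaves i → adj G (at i) x ≡ true
  leaves-adj {i} x∈ = proj₁ (∧-true (∈-members⁻ (isLeafAt i) x∈))

  leaves-leaf : ∀ {i x} → x ∈ leaves i → isNonLeaf G x ≡ false
  leaves-leaf {i} {x} x∈ with isNonLeaf G x | proj₂ (∧-true {adj G (at i) x} (∈-members⁻ (isLeafAt i) x∈))
  ... | false | _ = refl

  leaf-unique : ∀ {i j x} → i < r → j < r → isNonLeaf G x ≡ false → adj G (at i) x ≡ true → adj G (at j) x ≡ true → i ≡ j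
  leaf-unique {i} {j} {x} i<r j<r ix ai aj with at i ≟ at j
  ... | yes e = at-injective i<r j<r e
  ... | no ne = case trans (sym ix) (two-neighbours G (trans (Graph.sym G x (at i)) ai) (trans (Graph.sym G x (at j)) aj) ne) of λ ()

  -- The sum over j counts spine neighbours by position alone, so equal degrees at position i of two
  -- spines leave equally many leaves there.
  length-leaves : ∀ {i} → i < r → length (leaves i) + Σ< r (λ j → ⟦ j ≡ᵇ suc i ⟧ + ⟦ i ≡ᵇ suc j ⟧) ≡ deg G (at i)
  length-leaves {i} i<r = begin
    length (leaves i) + Σ< r (λ j → ⟦ j ≡ᵇ suc i ⟧ + ⟦ i ≡ᵇ suc j ⟧)
      ≡⟨ cong₂ _+_ (length-filterᵇ (isLeafAt i)) (Σ<-cong r λ j j<r → sym (adj-at-count S i<r j<r)) ⟩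
    sum (λ x → ⟦ isLeafAt i x ⟧) + Σ< r (λ j → ⟦ adj G (at i) (at j) ⟧)
      ≡⟨ cong (sum (λ x → ⟦ isLeafAt i x ⟧) +_) (sum-nonLeaf (λ x → ⟦ adj G (at i) x ⟧)) ⟨
    sum (λ x → ⟦ isLeafAt i x ⟧) + sum (λ x → ⟦ isNonLeaf G x ⟧ * ⟦ adj G (at i) x ⟧)
      ≡⟨ sum-+ (λ x → ⟦ isLeafAt i x ⟧) _ ⟨
    sum (λ x → ⟦ isLeafAt i x ⟧ + ⟦ isNonLeaf G x ⟧ * ⟦ adj G (at i) x ⟧)
      ≡⟨ sum-cong-≗ point ⟩
    sum (λ x → ⟦ adj G (at i) x ⟧)
      ≡⟨ deg-sum G (at i) ⟨
    deg G (at i) ∎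
    where
    open ≡-Reasoning
    point : ∀ x → ⟦ isLeafAt i x ⟧ + ⟦ isNonLeaf G x ⟧ * ⟦ adj G (at i) x ⟧ ≡ ⟦ adj G (at i) x ⟧
    point x with adj G (at i) x | isNonLeaf G x
    ... | true | true = refl
    ... | true | false = refl
    ... | false | true = refl
    ... | false | false = refl

  adj-leaf : ∀ {i j x} → i < r → j < r → x ∈ leaves j → adj G (at i) x ≡ (i ≡ᵇ j)
  adj-leaf {i} {j} {x} i<r j<r x∈ with i ℕ.≟ j
  ... | yes refl = trans (leaves-adj x∈) (sym (≡ᵇ-refl i))
  ... | no ne with adj G (at i) x in a
  ...   | false = sym (≡ᵇ-≢ ne)
  ...   | true = ⊥-elim (ne (leaf-unique i<r j<r (leaves-leaf x∈) a (leaves-adj x∈)))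

  leaves-nonadj : ∀ {x y} → isNonLeaf G x ≡ false → isNonLeaf G y ≡ false → adj G x y ≡ false
  leaves-nonadj {x} {y} ix iy with adj G x y in a
  ... | false = refl
  ... | true = case trans (sym iy) (leaf-adj a ix) of λ ()

  OnSpine Hanging Place : Fin n → Set
  OnSpine v = ∃ λ i → i < r × at i ≡ v
  Hanging v = ∃ λ i → i < r × ∃ λ (j : Fin (length (leaves i))) → lookup (leaves i) j ≡ v
  Place v = OnSpine v ⊎ Hanging v

  place : ∀ v → Place v
  place v with isNonLeaf G v in iv
  ... | true = inj₁ (at-onto v iv)
  ... | false with sum-≢0 (deg≢0 v ∘ trans (deg-sum G v))
  ...   | x , ne with adj G v x in a
  ...     | false = ⊥-elim (ne refl)
  ...     | true with at-onto x (leaf-adj a iv)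
  ...       | i , i<r , refl = inj₂ (i , i<r , index v∈ , sym (lookup-index v∈))
    where
    v∈ : v ∈ leaves i
    v∈ = ∈-members⁺ (isLeafAt i) (∧-intro (trans (Graph.sym G (at i) v) a) (cong not iv))

module _ {n r} {G H : Graph (Fin n)} (S : Spine G r) (T : Spine H r)
  (same : ∀ i → i < r → deg G (Spine.at S i) ≡ deg H (Spine.at T i)) where

  private
    module S = Spine S
    module T = Spine T
    module SL = Leaves S
    module TL = Leaves T

    same-length : ∀ {i} → i < r → length (SL.leaves i) ≡ length (TL.leaves i)
    same-length {i} i<r = +-cancelʳ-≡ _ _ _ (trans (SL.length-leaves i<r) (trans (same i i<r) (sym (TL.length-leaves i<r))))

    leafImage : ∀ i → i < r → Fin (length (SL.leaves i)) → Fin n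
    leafImage i i<r j = lookup (TL.leaves i) (cast (same-length i<r) j)

    leafImage-∈ : ∀ i (i<r : i < r) j → leafImage i i<r j ∈ TL.leaves i
    leafImage-∈ i i<r j = ∈-lookup (cast (same-length i<r) j)

    to : ∀ {v} → SL.Place v → Fin n
    to (inj₁ (i , _)) = T.at i
    to (inj₂ (i , i<r , j , _)) = leafImage i i<r j

    nonLeaf≢leaf : ∀ {x y} → isNonLeaf H x ≡ true → isNonLeaf H y ≡ false → x ≢ y
    nonLeaf≢leaf ix iy refl = case trans (sym ix) iy of λ ()

    to-injective : ∀ {u v} (p : SL.Place u) (q : SL.Place v) → to p ≡ to q → u ≡ v
    to-injective (inj₁ (i , i<r , refl)) (inj₁ (j , j<r , refl)) e = cong S.at (T.at-injective i<r j<r e)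
    to-injective (inj₁ (i , i<r , _)) (inj₂ (j , j<r , l , _)) e = ⊥-elim (nonLeaf≢leaf (T.at-nonLeaf i<r) (TL.leaves-leaf (leafImage-∈ j j<r l)) e)
    to-injective (inj₂ (j , j<r , l , _)) (inj₁ (i , i<r , _)) e = ⊥-elim (nonLeaf≢leaf (T.at-nonLeaf i<r) (TL.leaves-leaf (leafImage-∈ j j<r l)) (sym e))
    to-injective (inj₂ (i , i<r , k , refl)) (inj₂ (j , j<r , l , refl)) e
      with TL.leaf-unique i<r j<r (TL.leaves-leaf (leafImage-∈ i i<r k)) (TL.leaves-adj (leafImage-∈ i i<r k))
             (subst (λ x → adj H (T.at j) x ≡ true) (sym e) (TL.leaves-adj (leafImage-∈ j j<r l)))
    ... | refl = cong (lookup (SL.leaves i)) (toℕ-injective (trans (sym (toℕ-cast (same-length i<r) k))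
                   (trans (cong toℕ (lookup-unique (members-unique (TL.isLeafAt i)) e)) (toℕ-cast (same-length j<r) l))))

    to-adj : ∀ {u v} (p : SL.Place u) (q : SL.Place v) → adj G u v ≡ adj H (to p) (to q)
    to-adj (inj₁ (i , i<r , refl)) (inj₁ (j , j<r , refl)) = ⟦⟧-injective (trans (adj-at-count S i<r j<r) (sym (adj-at-count T i<r j<r)))
    to-adj (inj₁ (i , i<r , refl)) (inj₂ (j , j<r , l , refl)) = trans (SL.adj-leaf i<r j<r (∈-lookup l)) (sym (TL.adj-leaf i<r j<r (leafImage-∈ j j<r l)))
    to-adj (inj₂ (j , j<r , l , refl)) (inj₁ (i , i<r , refl)) = trans (Graph.sym G _ _)
      (trans (trans (SL.adj-leaf i<r j<r (∈-lookup l)) (sym (TL.adj-leaf i<r j<r (leafImage-∈ j j<r l)))) (Graph.sym H _ _))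
    to-adj (inj₂ (i , i<r , k , refl)) (inj₂ (j , j<r , l , refl)) = trans
      (SL.leaves-nonadj (SL.leaves-leaf (∈-lookup k)) (SL.leaves-leaf (∈-lookup l)))
      (sym (TL.leaves-nonadj (TL.leaves-leaf (leafImage-∈ i i<r k)) (TL.leaves-leaf (leafImage-∈ j j<r l))))

  -- Spine vertices are matched by position, and the leaves at each position by their order of
  -- enumeration.
  spines-isomorphic : G ≅ H
  spines-isomorphic = record
    { bij = mk⤖ {to = f} (f-injective , λ y → case injective⇒surjective f f-injective y of λ { (x , e) → x , λ { refl → e } })
    ; preserve = λ u v → to-adj (SL.place u) (SL.place v)
    }
    where
    f : Fin n → Fin n
    f v = to (SL.place v)
    f-injective : ∀ {x y} → f x ≡ f y → x ≡ y
    f-injective {x} {y} = to-injective (SL.place x) (SL.place y)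

-- Local structure passes to the other graph

acyclic⇒NoCycle : ∀ {n} (G : Graph (Fin n)) → (∀ v vs → ¬ IsCycle G v vs) → ∀ m → NoCycle G m
acyclic⇒NoCycle G acyclic (suc m) (s≤s 2≤m) g distinct linked e = acyclic (g 0) (applyUpTo (g ∘ suc) m)
  ( subst (2 ≤_) (sym (length-applyUpTo (g ∘ suc) m)) 2≤m
  , Uniqueₚ.applyUpTo⁺₁ g (suc m) distinct
  , subst (Linked (Adj G)) (trans (sym (applyUpTo-∷ʳ g (suc m))) (cong (λ y → applyUpTo g (suc m) ++ [ y ]) (sym e)))
      (Linkedₚ.applyUpTo⁺₁ g (suc (suc m)) λ {i} lt → linked i (s≤s⁻¹ lt)))

similar-≡ : ∀ {n m k} (G : Graph (Fin n)) (H : Graph (Fin m)) (t : Vec (Fin n) k) (t′ : Vec (Fin m) k) →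
  Similar G H t t′ → ∀ i j → Vec.lookup t′ i ≡ Vec.lookup t′ j → Vec.lookup t i ≡ Vec.lookup t j
similar-≡ G H t t′ s i j e = ==-≡ (trans (proj₂ (s i j)) (==-true e))

similar-≢ : ∀ {n m k} (G : Graph (Fin n)) (H : Graph (Fin m)) (t : Vec (Fin n) k) (t′ : Vec (Fin m) k) →
  Similar G H t t′ → ∀ i j → Vec.lookup t i ≢ Vec.lookup t j → Vec.lookup t′ i ≢ Vec.lookup t′ j
similar-≢ G H t t′ s i j ne e = ne (similar-≡ G H t t′ s i j e)

similar-adj : ∀ {n m k} (G : Graph (Fin n)) (H : Graph (Fin m)) (t : Vec (Fin n) k) (t′ : Vec (Fin m) k) →
  Similar G H t t′ → ∀ i j → adj G (Vec.lookup t i) (Vec.lookup t j) ≡ true → adj H (Vec.lookup t′ i) (Vec.lookup t′ j) ≡ true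
similar-adj G H t t′ s i j a = trans (sym (proj₁ (s i j))) a

other-neighbour : ∀ {n} (G : Graph (Fin n)) {v x} → isNonLeaf G x ≡ true → adj G x v ≡ true → ∃ λ y → adj G x y ≡ true × y ≢ v
other-neighbour G {v} {x} ix a with sum-≢0 {f = λ y → ⟦ onward G v x y ⟧}
  (λ e → case subst (2 ≤_) (trans (deg≡1+onward G a) (cong suc e)) (nonLeaf-deg G ix) of λ { (s≤s ()) })
... | y , ne = y , proj₁ (∧-true on) , λ e → case trans (sym (proj₂ (∧-true {adj G x y} on))) (cong not (==-true e)) of λ ()
  where
  on : onward G v x y ≡ true
  on with onward G v x y
  ... | true = refl
  ... | false = ⊥-elim (ne refl)

-- If x and y differ, then v is a nonleaf too, and only two positions are next to its position k.
spine-thin : ∀ {n r} {G : Graph (Fin n)} → Spine G r → Thin G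
spine-thin {G = G} S {v} {x} {y} {z} ax ay az ix iy iz with x ≟ y
... | yes e = inj₁ e
... | no ne with at-onto v (two-neighbours G ax ay ne) | at-onto x ix | at-onto y iy | at-onto z iz
  where open Spine S
...   | k , k< , refl | i , i< , refl | j , j< , refl | l , l< , refl =
        pigeon (at-adj⁻ k< i< ax) (at-adj⁻ k< j< ay) (at-adj⁻ k< l< az)
  where
  open Spine S
  pigeon : i ≡ suc k ⊎ k ≡ suc i → j ≡ suc k ⊎ k ≡ suc j → l ≡ suc k ⊎ k ≡ suc l → at i ≡ at j ⊎ at i ≡ at l ⊎ at j ≡ at l
  pigeon (inj₁ p) (inj₁ q) _ = inj₁ (cong at (trans p (sym q)))
  pigeon (inj₂ p) (inj₂ q) _ = inj₁ (cong at (suc-injective (trans (sym p) q)))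
  pigeon (inj₁ p) (inj₂ q) (inj₁ s) = inj₂ (inj₁ (cong at (trans p (sym s))))
  pigeon (inj₁ p) (inj₂ q) (inj₂ s) = inj₂ (inj₂ (cong at (suc-injective (trans (sym q) s))))
  pigeon (inj₂ p) (inj₁ q) (inj₁ s) = inj₂ (inj₂ (cong at (trans q (sym s))))
  pigeon (inj₂ p) (inj₁ q) (inj₂ s) = inj₂ (inj₁ (cong at (suc-injective (trans (sym p) s))))

module _ {n} {G H : Graph (Fin n)} (D : SameDeck H G) where

  -- The moment argument needs a common bound for both graphs. A vertex of degree at least k shows k
  -- neighbours on a card of k + 1 vertices, and they transport to k neighbours in `G`.
  degree-bound : ∀ k → 2 * suc k ≤ n + 2 → (∀ w → deg G w < k) → ∀ v → deg H v < k
  degree-bound k small bound v with deg H v <? k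
  ... | yes lt = lt
  ... | no nlt = ⊥-elim (<⇒≱ (bound (Vec.lookup t′ zero)) (begin
    k  ≡⟨ length-tabulate g′ ⟨
    length (Data.List.tabulate g′)  ≤⟨ length-≤-sum (adj G (Vec.lookup t′ zero)) unique adjacent ⟩
    sum (λ x → ⟦ adj G (Vec.lookup t′ zero) x ⟧)  ≡⟨ deg-sum G (Vec.lookup t′ zero) ⟨
    deg G (Vec.lookup t′ zero)  ∎))
    where
    open ≤-Reasoning
    enough : k ≤ length (members (adj H v))
    enough = ≮⇒≥ nlt
    g : Fin k → Fin n
    g j = lookup (members (adj H v)) (inject≤ j enough)
    t : Vec (Fin n) (suc k)
    t = v ∷ Vec.tabulate g
    t′ : Vec (Fin n) (suc k)
    t′ = transport D small t
    sim : Similar H G t t′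
    sim = transport-similar D small t
    g′ : Fin k → Fin n
    g′ j = Vec.lookup t′ (suc j)
    unique : Unique (Data.List.tabulate g′)
    unique = Uniqueₚ.tabulate⁺ λ {i} {j} e → inject≤-injective enough enough i j (lookup-unique (members-unique (adj H v))
      (trans (sym (Vecₚ.lookup∘tabulate g i)) (trans (similar-≡ H G t t′ sim (suc i) (suc j) e) (Vecₚ.lookup∘tabulate g j))))
    adjacent : ∀ {x} → x ∈ Data.List.tabulate g′ → adj G (Vec.lookup t′ zero) x ≡ true
    adjacent x∈ with ∈-tabulate⁻ x∈
    ... | j , refl = similar-adj H G t t′ sim zero (suc j) (subst (λ y → adj H v y ≡ true) (sym (Vecₚ.lookup∘tabulate g j))
            (∈-members⁻ (adj H v) (∈-lookup (inject≤ j enough))))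

  -- Degrees are not visible on a card; the further neighbours x′, y′, z′ certify that the
  -- transported x, y, z are nonleaf.
  thin-transfer : 2 * 7 ≤ n + 2 → Thin G → Thin H
  thin-transfer small thin {v} {x} {y} {z} ax ay az ix iy iz
    with other-neighbour H ix (trans (Graph.sym H x v) ax) | other-neighbour H iy (trans (Graph.sym H y v) ay) | other-neighbour H iz (trans (Graph.sym H z v) az)
  ... | x′ , bx , x′≢ | y′ , by , y′≢ | z′ , bz , z′≢ =
    conclude (thin (A #0 #1 ax) (A #0 #2 ay) (A #0 #3 az)
      (two-neighbours G (A #1 #0 (trans (Graph.sym H x v) ax)) (A #1 #4 bx) (E #0 #4 (x′≢ ∘ sym)))
      (two-neighbours G (A #2 #0 (trans (Graph.sym H y v) ay)) (A #2 #5 by) (E #0 #5 (y′≢ ∘ sym)))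
      (two-neighbours G (A #3 #0 (trans (Graph.sym H z v) az)) (A #3 #6 bz) (E #0 #6 (z′≢ ∘ sym))))
    where
    t t′ : Vec (Fin n) 7
    t = v ∷ x ∷ y ∷ z ∷ x′ ∷ y′ ∷ z′ ∷ []
    t′ = transport D small t
    sim : Similar H G t t′
    sim = transport-similar D small t
    #0 #1 #2 #3 #4 #5 #6 : Fin 7
    #0 = zero
    #1 = suc zero
    #2 = suc (suc zero)
    #3 = suc (suc (suc zero))
    #4 = suc (suc (suc (suc zero)))
    #5 = suc (suc (suc (suc (suc zero))))
    #6 = suc (suc (suc (suc (suc (suc zero)))))
    A : ∀ i j → adj H (Vec.lookup t i) (Vec.lookup t j) ≡ true → adj G (Vec.lookup t′ i) (Vec.lookup t′ j) ≡ true
    A = similar-adj H G t t′ sim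
    E : ∀ i j → Vec.lookup t i ≢ Vec.lookup t j → Vec.lookup t′ i ≢ Vec.lookup t′ j
    E = similar-≢ H G t t′ sim
    conclude : Vec.lookup t′ #1 ≡ Vec.lookup t′ #2 ⊎ Vec.lookup t′ #1 ≡ Vec.lookup t′ #3 ⊎ Vec.lookup t′ #2 ≡ Vec.lookup t′ #3 →
      x ≡ y ⊎ x ≡ z ⊎ y ≡ z
    conclude (inj₁ e) = inj₁ (similar-≡ H G t t′ sim #1 #2 e)
    conclude (inj₂ (inj₁ e)) = inj₂ (inj₁ (similar-≡ H G t t′ sim #1 #3 e))
    conclude (inj₂ (inj₂ e)) = inj₂ (inj₂ (similar-≡ H G t t′ sim #2 #3 e))

  NoCycle-transfer : ∀ m → 2 * m ≤ n + 2 → NoCycle G m → NoCycle H m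
  NoCycle-transfer m small none 3≤m g distinct linked e = none 3≤m g′ distinct′ linked′ (trans (g′-< 0<m) (sym g′-m))
    where
    0<m : 0 < m
    0<m = ≤-trans (s≤s z≤n) 3≤m
    t t′ : Vec (Fin n) m
    t = Vec.tabulate (g ∘ toℕ)
    t′ = transport D small t
    sim : Similar H G t t′
    sim = transport-similar D small t
    pick : ∀ {i} → Dec (i < m) → Fin n
    pick (yes lt) = Vec.lookup t′ (fromℕ< lt)
    -- Index m receives the starting vertex, which closes the cycle.
    pick (no _) = Vec.lookup t′ (fromℕ< 0<m)
    g′ : ℕ → Fin n
    g′ i = pick (i <? m)
    g′-< : ∀ {i} (lt : i < m) → g′ i ≡ Vec.lookup t′ (fromℕ< lt)
    g′-< {i} lt with i <? m
    ... | yes lt′ = cong (λ l → Vec.lookup t′ (fromℕ< l)) (<-irrelevant lt′ lt)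
    ... | no nlt = ⊥-elim (nlt lt)
    g′-m : g′ m ≡ Vec.lookup t′ (fromℕ< 0<m)
    g′-m with m <? m
    ... | yes lt = ⊥-elim (<-irrefl refl lt)
    ... | no _ = refl
    t-at : ∀ {i} (lt : i < m) → Vec.lookup t (fromℕ< lt) ≡ g i
    t-at lt = trans (Vecₚ.lookup∘tabulate (g ∘ toℕ) (fromℕ< lt)) (cong g (toℕ-fromℕ< lt))
    distinct′ : ∀ {i j} → i < j → j < m → g′ i ≢ g′ j
    distinct′ {i} {j} i<j j<m q = distinct i<j j<m (trans (sym (t-at i<m)) (trans
      (similar-≡ H G t t′ sim (fromℕ< i<m) (fromℕ< j<m) (trans (sym (g′-< i<m)) (trans q (g′-< j<m))))
      (t-at j<m)))
      where
      i<m : i < m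
      i<m = <-trans i<j j<m
    adj′ : ∀ {i j} (i<m : i < m) (j<m : j < m) → adj H (g i) (g j) ≡ true → adj G (Vec.lookup t′ (fromℕ< i<m)) (Vec.lookup t′ (fromℕ< j<m)) ≡ true
    adj′ i<m j<m a = similar-adj H G t t′ sim (fromℕ< i<m) (fromℕ< j<m) (subst₂ (λ x y → adj H x y ≡ true) (sym (t-at i<m)) (sym (t-at j<m)) a)
    linked′ : ∀ i → i < m → adj G (g′ i) (g′ (suc i)) ≡ true
    linked′ i i<m with m≤n⇒m<n∨m≡n i<m
    ... | inj₁ lt = subst₂ (λ x y → adj G x y ≡ true) (sym (g′-< i<m)) (sym (g′-< lt)) (adj′ i<m lt (linked i i<m))
    ... | inj₂ refl = subst₂ (λ x y → adj G x y ≡ true) (sym (g′-< i<m)) (sym g′-m)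
            (adj′ i<m 0<m (subst (λ y → adj H (g i) y ≡ true) (sym e) (linked i i<m)))

-- A spine in the second graph

along-steps : ∀ ℓ b i → along (steps ℓ) b i ≡ b (ℓ + suc i)
along-steps zero b i = refl
along-steps (suc ℓ) b i = trans (along-steps ℓ b (suc i)) (cong b (+-suc ℓ (suc i)))

sum≡0 : ∀ {n} {f : Fin n → ℕ} → sum f ≡ 0 → ∀ i → f i ≡ 0
sum≡0 {f = f} e i = n≤0⇒n≡0 (≤-trans (term≤sum f i) (≤-reflexive e))

half-bounds : ∀ n → 1 ≤ n → ∃ λ h → 2 * h ≤ n × n ≤ 2 * h + 1
half-bounds n 1≤n with half n 1≤n
... | κ , inj₁ refl = κ , n≤1+n _ , ≤-reflexive (+-comm 1 (2 * κ))
... | κ , inj₂ refl = suc κ , ≤-reflexive (*-suc 2 κ) , ≤-trans (≤-reflexive (sym (*-suc 2 κ))) (m≤m+n (2 * suc κ) 1)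

module _ {n r} {G : Graph (Fin n)} (S : Spine G r) where

  open Spine S

  isolated-spine : isolated G ≡ 0
  isolated-spine = sum-zero λ v → cong ⟦_⟧ (≡ᵇ-≢ (deg≢0 v))

  leafPairs-spine : leafPairs G ≡ 0
  leafPairs-spine = sum-zero λ u → sum-zero λ v → point u v
    where
    point : ∀ u v → ⟦ adj G u v ⟧ * (⟦ not (isNonLeaf G u) ⟧ * ⟦ not (isNonLeaf G v) ⟧) ≡ 0
    point u v with adj G u v in a | isNonLeaf G u in iu
    ... | false | _ = refl
    ... | true | true = refl
    ... | true | false rewrite leaf-adj a iu = refl

-- M + 2 is the maximal degree d₁; r + 3 M + 3 ≤ n comes from its three vertices and a fourth one of degree at least 3.
module Setting {n r M} {G H : Graph (Fin n)} (D : SameDeck G H) (S : Spine G r)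
  (acyclic : ∀ v vs → ¬ IsCycle G v vs) (bound : ∀ v → deg G v ≤ M + 2)
  (r+3M+3≤n : r + 3 * M + 3 ≤ n) (n≤2r+5 : n ≤ 2 * r + 5) (48≤n : 48 ≤ n) (2≤M : 2 ≤ M) where

  private
    K h L N : ℕ
    K = M + 1

    -- Twice r + 3 M + 3 ≤ n plus n ≤ 2 r + 5 eliminates r.
    6M+1≤n : 6 * M + 1 ≤ n
    6M+1≤n = ≤-linear 0 0 (+-mono-≤ (*-monoʳ-≤ 2 r+3M+3≤n) n≤2r+5) (identity r M n)
      where
      identity : ∀ r M n → 1 * (6 * M + 1) + (2 * n + (2 * r + 5)) + 0 ≡ 1 * n + (2 * (r + 3 * M + 3) + n)
      identity = solve-∀

    degree-budget : 2 * (1 + (M + 3)) ≤ n + 2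
    degree-budget = ≤-linear 2 79 (+-mono-≤ 6M+1≤n (*-monoʳ-≤ 2 48≤n)) (identity M n)
      where
      identity : ∀ M n → 3 * (2 * (1 + (M + 3))) + (n + 2 * n) + 79 ≡ 3 * (n + 2) + (6 * M + 1 + 2 * 48)
      identity = solve-∀

    count-budget : 2 * (3 + K) ≤ n + 2
    count-budget = ≤-trans (≤-reflexive (identity M)) degree-budget
      where
      identity : ∀ M → 2 * (3 + (M + 1)) ≡ 2 * (1 + (M + 3))
      identity = solve-∀

    pairs-budget : 2 * (3 + (K + K)) ≤ n + 2
    pairs-budget = ≤-linear 2 26 (+-mono-≤ (*-monoʳ-≤ 2 6M+1≤n) 48≤n) (identity M n)
      where
      identity : ∀ M n → 3 * (2 * (3 + (M + 1 + (M + 1)))) + (2 * n + n) + 26 ≡ 3 * (n + 2) + (2 * (6 * M + 1) + 48)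
      identity = solve-∀

    halved : ∃ λ h → 2 * h ≤ n × n ≤ 2 * h + 1
    halved = half-bounds n (≤-trans (s≤s z≤n) 48≤n)

    h = proj₁ halved

    2h≤n : 2 * h ≤ n
    2h≤n = proj₁ (proj₂ halved)

    n≤2h+1 : n ≤ 2 * h + 1
    n≤2h+1 = proj₂ (proj₂ halved)

    M+4≤h : M + 4 ≤ h
    M+4≤h = ≤-linear 5 70 (+-mono-≤ (≤-trans 6M+1≤n n≤2h+1) (*-monoʳ-≤ 2 (≤-trans 48≤n n≤2h+1))) (identity M h)
      where
      identity : ∀ M h → 6 * (M + 4) + (2 * h + 1 + 2 * (2 * h + 1)) + 70 ≡ 6 * h + (6 * M + 1 + 2 * 48)
      identity = solve-∀

    -- The longest walk the budget allows: 3 + K + (1 + L) = 1 + h, where h is n / 2 rounded down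
    -- and 1 + h is the largest size of a card.
    L = proj₁ (m≤n⇒∃[o]m+o≡n M+4≤h)

    M+4+L≡h : M + 4 + L ≡ h
    M+4+L≡h = proj₂ (m≤n⇒∃[o]m+o≡n M+4≤h)

    N = 1 + h

    cycle-budget : 2 * N ≤ n + 2
    cycle-budget = ≤-trans (≤-reflexive (*-suc 2 h)) (≤-trans (+-monoʳ-≤ 2 2h≤n) (≤-reflexive (+-comm 2 n)))

    path-budget : 2 * (3 + (K + (1 + L))) ≤ n + 2
    path-budget = ≤-trans (≤-reflexive (trans (identity M L) (cong (λ h → 2 * (1 + h)) M+4+L≡h))) cycle-budget
      where
      identity : ∀ M L → 2 * (3 + (M + 1 + (1 + L))) ≡ 2 * (1 + (M + 4 + L))
      identity = solve-∀

    L+2≤r : 2 + L ≤ r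
    L+2≤r = ≤-linear 1 3 (+-mono-≤ (≤-trans (subst (λ h → 2 * h ≤ n) (sym M+4+L≡h) 2h≤n) n≤2r+5) (*-monoʳ-≤ 2 2≤M)) (identity r M L)
      where
      identity : ∀ r M L → 2 * (2 + L) + (2 * r + 5 + 2 * M) + 3 ≡ 2 * r + (2 * (M + 4 + L) + 2 * 2)
      identity = solve-∀

    -- L + 2 + N = 2 h - M - 1 ≥ n - M - 2, whereas r ≤ n - 3 M - 3.
    room : r ≤ L + 2 + N
    room = subst (λ h → r ≤ L + 2 + (1 + h)) M+4+L≡h
      (≤-linear 0 (2 * M + 1) (≤-trans r+3M+3≤n (subst (λ h → n ≤ 2 * h + 1) (sym M+4+L≡h) n≤2h+1)) (identity r M L))
      where
      identity : ∀ r M L → 1 * r + (2 * (M + 4 + L) + 1) + (2 * M + 1) ≡ 1 * (L + 2 + (1 + (M + 4 + L))) + (r + 3 * M + 3)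
      identity = solve-∀

    M+3 : M + 3 ≡ suc (M + 2)
    M+3 = +-suc M 2

    boundᴴ : ∀ v → deg H v < M + 3
    boundᴴ = degree-bound (SameDeck-sym D) (M + 3) degree-budget λ w → subst (deg G w <_) (sym M+3) (s≤s (bound w))

    pred-bound : ∀ {d} → d < M + 3 → pred d ≤ K
    pred-bound {d} lt = subst (pred d ≤_) (cong pred (+-suc M 1)) (pred-mono-≤ (s≤s⁻¹ (subst (d <_) M+3 lt)))

  ≤K : ∀ v → excess G v ≤ K
  ≤K v = pred-bound (subst (deg G v <_) (sym M+3) (s≤s (bound v)))

  ≤Kᴴ : ∀ v → excess H v ≤ K
  ≤Kᴴ v = pred-bound (boundᴴ v)

  edges-same : edges G ≡ edges H
  edges-same = edges-≡ D (≤-trans (s≤s (s≤s z≤n)) 48≤n)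

  private
    degreeSum-same : nonLeafDegreeSum G ≡ nonLeafDegreeSum H
    degreeSum-same = nonLeafDegreeSum-≡ D ≤K ≤Kᴴ count-budget

    count-same : sum (λ v → ⟦ isNonLeaf G v ⟧) ≡ sum (λ v → ⟦ isNonLeaf H v ⟧)
    count-same = nonLeafCount-≡ D ≤K ≤Kᴴ count-budget

    pairs-same : nonLeafPairs G ≡ nonLeafPairs H
    pairs-same = nonLeafPairs-≡ D ≤K ≤Kᴴ pairs-budget

    leafPairsᴴ : leafPairs H ≡ 0
    leafPairsᴴ = trans (+-cancelˡ-≡ (nonLeafDegreeSum H + nonLeafDegreeSum H) _ _ (begin
      nonLeafDegreeSum H + nonLeafDegreeSum H + leafPairs H ≡⟨ edges-by-leaves H ⟨
      edges H + nonLeafPairs H  ≡⟨ cong₂ _+_ edges-same pairs-same ⟨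
      edges G + nonLeafPairs G  ≡⟨ edges-by-leaves G ⟩
      nonLeafDegreeSum G + nonLeafDegreeSum G + leafPairs G ≡⟨ cong (λ d → d + d + leafPairs G) degreeSum-same ⟩
      nonLeafDegreeSum H + nonLeafDegreeSum H + leafPairs G ∎)) (leafPairs-spine S)
      where open ≡-Reasoning

    isolatedᴴ : isolated H ≡ 0
    isolatedᴴ = trans (+-cancelˡ-≡ (sum (λ v → ⟦ isNonLeaf H v ⟧)) _ _ (+-cancelʳ-≡ (edges H) _ _ (begin
      sum (λ v → ⟦ isNonLeaf H v ⟧) + isolated H + edges H  ≡⟨ vertices-by-degree H ⟨
      n + nonLeafDegreeSum H  ≡⟨ cong (n +_) degreeSum-same ⟨
      n + nonLeafDegreeSum G  ≡⟨ vertices-by-degree G ⟩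
      sum (λ v → ⟦ isNonLeaf G v ⟧) + isolated G + edges G  ≡⟨ cong₂ (λ a b → a + isolated G + b) count-same edges-same ⟩
      sum (λ v → ⟦ isNonLeaf H v ⟧) + isolated G + edges H  ∎))) (isolated-spine S)
      where open ≡-Reasoning

    deg≢0ᴴ : ∀ v → deg H v ≢ 0
    deg≢0ᴴ v e = case trans (sym (sum≡0 isolatedᴴ v)) (cong (λ d → ⟦ d ≡ᵇ 0 ⟧) e) of λ ()

    leaf-adjᴴ : ∀ {u v} → adj H u v ≡ true → isNonLeaf H u ≡ false → isNonLeaf H v ≡ true
    leaf-adjᴴ {u} {v} a iu with isNonLeaf H v in iv
    ... | true = refl
    ... | false = case trans (sym (sum≡0 (sum≡0 leafPairsᴴ u) v)) pair of λ ()
      where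
      pair : ⟦ adj H u v ⟧ * (⟦ not (isNonLeaf H u) ⟧ * ⟦ not (isNonLeaf H v) ⟧) ≡ 1
      pair rewrite a | iu | iv = refl

    -- By `nonLeafTotal-step` the difference contains the weight at position L + 1, which is
    -- positive because that position is on the spine.
    decreasing : nonLeafTotal G (step ∷ steps L) < nonLeafTotal G (steps L)
    decreasing = subst (nonLeafTotal G (step ∷ steps L) <_) (sym (nonLeafTotal-step S (steps L)))
      (m<n+m _ (≤-trans positive-weight (m≤m+n _ _)))
      where
      open Spine S
      positive-weight : 1 ≤ along (steps L) weights 0
      positive-weight = subst (1 ≤_) (sym (trans (along-steps L weights 0) (trans (cong weights (+-comm L 1)) (weights-at L+2≤r))))
        (pred-mono-≤ (nonLeaf-deg G (at-nonLeaf L+2≤r)))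

    decreasingᴴ : nonLeafTotal H (step ∷ steps L) < nonLeafTotal H (steps L)
    decreasingᴴ = subst₂ _<_
      (nonLeafTotal-≡ D ≤K ≤Kᴴ (step ∷ steps L) (subst (λ l → 2 * (3 + (K + suc l)) ≤ n + 2) (sym (length-steps L)) path-budget))
      (nonLeafTotal-≡ D ≤K ≤Kᴴ (steps L) (≤-trans (*-monoʳ-≤ 2 (+-monoʳ-≤ 3 (+-monoʳ-≤ K
        (≤-trans (≤-reflexive (length-steps L)) (n≤1+n L))))) path-budget))
      decreasing

    thinᴴ : Thin H
    thinᴴ = thin-transfer (SameDeck-sym D) (≤-trans (m≤m+n 14 34) (≤-trans 48≤n (m≤m+n n 2))) (spine-thin S)

    noCycleᴴ : ∀ m → m ≤ N → NoCycle H m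
    noCycleᴴ m m≤N = NoCycle-transfer (SameDeck-sym D) m (≤-trans (*-monoʳ-≤ 2 m≤N) cycle-budget) (acyclic⇒NoCycle G acyclic m)

    countᴴ : sum (λ v → ⟦ isNonLeaf H v ⟧) ≡ r
    countᴴ = trans (sym count-same) (nonLeafCount-spine S)

    pairsᴴ : nonLeafPairs H ≡ 2 * pred r
    pairsᴴ = trans (sym pairs-same) (nonLeafPairs-spine S)

    fromDeadEnd : (∃₂ λ v x → isNonLeaf H v ≡ true × adj H v x ≡ true × walks H (steps L) v x ≢ 0 ×
      (∀ u → isNonLeaf H u ≡ true → adj H u v ≡ true → u ≡ x)) → Spine H r
    fromDeadEnd (v₀ , v₁ , i₀ , a₀ , long , end) =
      PathFromEnd.spine H thinᴴ r countᴴ pairsᴴ N noCycleᴴ v₀ v₁ a₀ i₀ end L long room deg≢0ᴴ leaf-adjᴴ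

  spineᴴ : Spine H r
  spineᴴ = fromDeadEnd (dead-end H (steps L) decreasingᴴ)

-- Comparing the weights of two spines

deg-excess : ∀ {n} (G : Graph (Fin n)) {v} → deg G v ≢ 0 → deg G v ≡ suc (excess G v)
deg-excess G {v} ne with deg G v
... | zero = ⊥-elim (ne refl)
... | suc d = refl

along-steps-++ : ∀ ℓ p b k → along (steps ℓ ++ p) b k ≡ along p b (ℓ + k)
along-steps-++ zero p b k = refl
along-steps-++ (suc ℓ) p b k = trans (along-steps-++ ℓ p b (suc k)) (cong (along p b) (+-suc ℓ k))

-- The weight at the tail already vanishes on leaves, so no moments are spent. This is why
-- correlations are affordable at distances up to r / 2.
total-back : ∀ {n} (G : Graph (Fin n)) p → total G (back ∷ p) ≡ nonLeafTotal G (back ∷ p)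
total-back G p = sum-cong-≗ point
  where
  point : ∀ u → sumFrom G (back ∷ p) u ≡ ⟦ isNonLeaf G u ⟧ * sumFrom G (back ∷ p) u
  point u with isNonLeaf G u in iu
  ... | true = sym (+-identityʳ _)
  ... | false = sum-zero λ v → trans (cong (λ e → ⟦ adj G u v ⟧ * (e * walks G p u v)) (leaf-excess G iu)) (*-zeroʳ ⟦ adj G u v ⟧)

module _ {n r} {G : Graph (Fin n)} (S : Spine G r) where

  open Spine S
  private
    module R = Spine (reverse S)

  spine-mirror : Mirror r weights R.weights
  spine-mirror = record
    { mirror = λ {k} {l} e k<r → trans (weights-at k<r) (trans (cong (excess G ∘ at) (sym (mirrored e k<r))) (sym (R.weights-at (position*-< e k<r))))
    ; vanish = weights-beyond
    ; vanish* = R.weights-beyond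
    }
    where
    mirrored : ∀ {r k l} → k + l ≡ pred r → k < r → r ∸ suc l ≡ k
    mirrored {suc r} {k} {l} refl _ = m+n∸n≡m k l

  edges-excess : edges G ≡ n + sum (λ v → excess G v ^ 1)
  edges-excess = begin
    edges G  ≡⟨ edges-deg G ⟩
    sum (deg G)  ≡⟨ sum-cong-≗ (λ v → trans (deg-excess G (deg≢0 v)) (cong suc (sym (*-identityʳ (excess G v))))) ⟩
    sum (λ v → 1 + excess G v ^ 1)  ≡⟨ sum-+ (λ _ → 1) _ ⟩
    sum {n} (λ _ → 1) + sum (λ v → excess G v ^ 1) ≡⟨ cong (_+ sum (λ v → excess G v ^ 1)) (sum-const-1 n) ⟩
    n + sum (λ v → excess G v ^ 1)  ∎
    where open ≡-Reasoning

  total-excess : total G [] ≡ sum (λ v → excess G v ^ 1) + sum (λ v → excess G v ^ 2)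
  total-excess = begin
    total G []  ≡⟨ total-fwds G 0 ⟩
    sum (λ v → excess G v ^ 1 * deg G v)  ≡⟨ sum-cong-≗ (λ v → trans (cong (excess G v ^ 1 *_) (deg-excess G (deg≢0 v))) (expand (excess G v))) ⟩
    sum (λ v → excess G v ^ 1 + excess G v ^ 2)       ≡⟨ sum-+ (λ v → excess G v ^ 1) _ ⟩
    sum (λ v → excess G v ^ 1) + sum (λ v → excess G v ^ 2) ∎
    where
    open ≡-Reasoning
    expand : ∀ e → e * 1 * (1 + e) ≡ e * 1 + e * (e * 1)
    expand = solve-∀

  -- The final factor of a program weighs a position after its tail, so position 0 alone is obtained
  -- as what the full sum has beyond the sum from position 1 on; `g 0 ≡ 0` disposes of the term at
  -- r.
  sum-from-zeroth : ∀ p g → (∀ b i → along p b i ≡ g (b (suc i))) → g 0 ≡ 0 →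
    Σ< r (g ∘ weights) + Σ< r (g ∘ R.weights) ≡ (g (weights 0) + g (R.weights 0)) + nonLeafTotal G p
  sum-from-zeroth p g h g0 = begin
    Σ< r (g ∘ weights) + Σ< r (g ∘ R.weights)        ≡⟨ cong₂ _+_ (peel weights weights-beyond) (peel R.weights R.weights-beyond) ⟩
    (g (weights 0) + Σ< r (along p weights)) + (g (R.weights 0) + Σ< r (along p R.weights))
                ≡⟨ regroup (g (weights 0)) _ (g (R.weights 0)) _ ⟩
    (g (weights 0) + g (R.weights 0)) + (Σ< r (along p weights) + Σ< r (along p R.weights))
                ≡⟨ cong (g (weights 0) + g (R.weights 0) +_) (nonLeafTotal-spine S p) ⟨
    (g (weights 0) + g (R.weights 0)) + nonLeafTotal G p ∎
    where
    open ≡-Reasoning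
    regroup : ∀ a b c d → (a + b) + (c + d) ≡ (a + c) + (b + d)
    regroup = solve-∀
    peel : ∀ b → (∀ i → r ≤ i → b i ≡ 0) → Σ< r (g ∘ b) ≡ g (b 0) + Σ< r (along p b)
    peel b van = begin
      Σ< r (g ∘ b)  ≡⟨ +-identityʳ _ ⟨
      Σ< r (g ∘ b) + 0  ≡⟨ cong (Σ< r (g ∘ b) +_) (trans (cong g (van r ≤-refl)) g0) ⟨
      Σ< (suc r) (g ∘ b)  ≡⟨ Σ<-head r (g ∘ b) ⟩
      g (b 0) + Σ< r (λ i → g (b (suc i)))  ≡⟨ cong (g (b 0) +_) (Σ<-cong r λ i _ → h b i) ⟨
      g (b 0) + Σ< r (along p b)  ∎

  correlation-spine : ∀ d → total G (back ∷ steps d) ≡ Σ< r (correlation weights R.weights d)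
  correlation-spine d = begin
    total G (back ∷ steps d)  ≡⟨ total-back G (steps d) ⟩
    nonLeafTotal G (back ∷ steps d)  ≡⟨ nonLeafTotal-spine S (back ∷ steps d) ⟩
    Σ< r (along (back ∷ steps d) weights) + Σ< r (along (back ∷ steps d) R.weights)
                ≡⟨ Σ<-+ r (along (back ∷ steps d) weights) _ ⟨
    Σ< r (λ k → along (back ∷ steps d) weights k + along (back ∷ steps d) R.weights k)
                ≡⟨ Σ<-cong r (λ k _ → cong₂ _+_ (distance weights k) (distance R.weights k)) ⟩
    Σ< r (correlation weights R.weights d)  ∎
    where
    open ≡-Reasoning
    distance : ∀ b k → along (back ∷ steps d) b k ≡ b k * b (k + suc d)
    distance b k = cong (b k *_) (trans (along-steps d b k) (cong b
      (trans (+-suc d k) (trans (cong suc (+-comm d k)) (sym (+-suc k d))))))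

module Compare {n r M} {G H : Graph (Fin n)} (D : SameDeck G H) (S : Spine G r) (T : Spine H r)
  (≤K : ∀ v → excess G v ≤ M + 1) (≤Kᴴ : ∀ v → excess H v ≤ M + 1)
  (r+3M+3≤n : r + 3 * M + 3 ≤ n) (2≤M : 2 ≤ M) (1≤r : 1 ≤ r) where

  private
    K : ℕ
    K = M + 1

    b c b′ c′ : ℕ → ℕ
    b = Spine.weights S
    c = Spine.weights (reverse S)
    b′ = Spine.weights T
    c′ = Spine.weights (reverse T)

    -- Here 1 + j is the length of `step ∷ p` for a program p of length j. The hypotheses add up to
    -- this bound with no slack.
    walk-budget : ∀ j → 2 * j + 3 ≤ r → 2 * (3 + (K + (1 + j))) ≤ n + 2
    walk-budget j le = ≤-linear 0 0 (+-mono-≤ (+-mono-≤ le r+3M+3≤n) 2≤M) (identity j r M n)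
      where
      identity : ∀ j r M n → 1 * (2 * (3 + (M + 1 + (1 + j)))) + (r + n + M) + 0 ≡ 1 * (n + 2) + (2 * j + 3 + (r + 3 * M + 3) + 2)
      identity = solve-∀

    correlation-budget : ∀ d → 2 * (1 + d) ≤ r → 2 * (3 + (1 + d)) ≤ n + 2
    correlation-budget d le = ≤-linear 0 (2 * M + 1) (+-mono-≤ (+-mono-≤ le r+3M+3≤n) 2≤M) (identity d r M n)
      where
      identity : ∀ d r M n → 1 * (2 * (3 + (1 + d))) + (r + n + M) + (2 * M + 1) ≡ 1 * (n + 2) + (2 * (1 + d) + (r + 3 * M + 3) + 2)
      identity = solve-∀

    1≤n : 1 ≤ n
    1≤n = ≤-trans 1≤r (≤-trans (≤-trans (m≤m+n r (3 * M)) (m≤m+n _ 3)) r+3M+3≤n)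

    4≤n : 4 ≤ n
    4≤n = ≤-trans (+-mono-≤ (≤-trans 1≤r (m≤m+n r (3 * M))) (≤-refl {3})) r+3M+3≤n

    sums¹ : sum (λ v → excess G v ^ 1) ≡ sum (λ v → excess H v ^ 1)
    sums¹ = +-cancelˡ-≡ n _ _ (trans (sym (edges-excess S)) (trans (edges-≡ D (≤-trans (s≤s (s≤s z≤n)) 4≤n)) (edges-excess T)))

    sums² : sum (λ v → excess G v ^ 2) ≡ sum (λ v → excess H v ^ 2)
    sums² = +-cancelˡ-≡ (sum (λ v → excess G v ^ 1)) _ _ (trans (sym (total-excess S))
      (trans (total-≡ D [] (+-monoˡ-≤ 2 4≤n)) (trans (total-excess T) (cong (_+ sum (λ v → excess H v ^ 2)) (sym sums¹)))))

    T₁ : Σ< r b ≡ Σ< r b′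
    T₁ = begin
      Σ< r b  ≡⟨ Σ<-cong r (λ i _ → *-identityʳ (b i)) ⟨
      Σ< r (λ i → b i ^ 1)  ≡⟨ sum-excess-spine S 0 ⟨
      sum (λ v → excess G v ^ 1)      ≡⟨ sums¹ ⟩
      sum (λ v → excess H v ^ 1)      ≡⟨ sum-excess-spine T 0 ⟩
      Σ< r (λ i → b′ i ^ 1)  ≡⟨ Σ<-cong r (λ i _ → *-identityʳ (b′ i)) ⟩
      Σ< r b′  ∎
      where open ≡-Reasoning

    T₂ : Σ< r (λ k → b k * b k) ≡ Σ< r (λ k → b′ k * b′ k)
    T₂ = begin
      Σ< r (λ k → b k * b k)  ≡⟨ Σ<-cong r (λ i _ → cong (b i *_) (*-identityʳ (b i))) ⟨
      Σ< r (λ i → b i ^ 2)  ≡⟨ sum-excess-spine S 1 ⟨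
      sum (λ v → excess G v ^ 2)      ≡⟨ sums² ⟩
      sum (λ v → excess H v ^ 2)      ≡⟨ sum-excess-spine T 1 ⟩
      Σ< r (λ i → b′ i ^ 2)  ≡⟨ Σ<-cong r (λ i _ → cong (b′ i *_) (*-identityʳ (b′ i))) ⟩
      Σ< r (λ k → b′ k * b′ k)        ∎
      where open ≡-Reasoning

    nonLeafTotal-same : ∀ p j → length p ≤ 1 + j → 2 * j + 3 ≤ r → nonLeafTotal G p ≡ nonLeafTotal H p
    nonLeafTotal-same p j len le = nonLeafTotal-≡ D ≤K ≤Kᴴ p
      (≤-trans (*-monoʳ-≤ 2 (+-monoʳ-≤ 3 (+-monoʳ-≤ K len))) (walk-budget j le))

    ends-same : ∀ p j → length p ≤ j → 2 * j + 3 ≤ r → along p b 0 + along p c 0 ≡ along p b′ 0 + along p c′ 0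
    ends-same p j len le = +-cancelʳ-≡ (nonLeafTotal G (step ∷ p)) _ _ (begin
      along p b 0 + along p c 0 + nonLeafTotal G (step ∷ p)     ≡⟨ nonLeafTotal-step S p ⟨
      nonLeafTotal G p  ≡⟨ nonLeafTotal-same p j (m≤n⇒m≤1+n len) le ⟩
      nonLeafTotal H p  ≡⟨ nonLeafTotal-step T p ⟩
      along p b′ 0 + along p c′ 0 + nonLeafTotal H (step ∷ p)   ≡⟨ cong (along p b′ 0 + along p c′ 0 +_) (nonLeafTotal-same (step ∷ p) j (s≤s len) le) ⟨
      along p b′ 0 + along p c′ 0 + nonLeafTotal G (step ∷ p)   ∎)
      where open ≡-Reasoning

    zeroth-same : ∀ p g → (∀ b i → along p b i ≡ g (b (suc i))) → g 0 ≡ 0 → length p ≤ 1 → 3 ≤ r →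
      Σ< r (g ∘ b) ≡ Σ< r (g ∘ b′) → g (b 0) + g (c 0) ≡ g (b′ 0) + g (c′ 0)
    zeroth-same p g h g0 len 3≤r Σ≡ = +-cancelʳ-≡ (nonLeafTotal G p) _ _ (begin
      g (b 0) + g (c 0) + nonLeafTotal G p      ≡⟨ sum-from-zeroth S p g h g0 ⟨
      Σ< r (g ∘ b) + Σ< r (g ∘ c)  ≡⟨ cong (Σ< r (g ∘ b) +_) (mirror-sum (spine-mirror S) g) ⟨
      Σ< r (g ∘ b) + Σ< r (g ∘ b)  ≡⟨ cong₂ _+_ Σ≡ Σ≡ ⟩
      Σ< r (g ∘ b′) + Σ< r (g ∘ b′)  ≡⟨ cong (Σ< r (g ∘ b′) +_) (mirror-sum (spine-mirror T) g) ⟩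
      Σ< r (g ∘ b′) + Σ< r (g ∘ c′)  ≡⟨ sum-from-zeroth T p g h g0 ⟩
      g (b′ 0) + g (c′ 0) + nonLeafTotal H p    ≡⟨ cong (g (b′ 0) + g (c′ 0) +_) (nonLeafTotal-same p 0 len 3≤r) ⟨
      g (b′ 0) + g (c′ 0) + nonLeafTotal G p    ∎)
      where open ≡-Reasoning

    sums : ∀ j → 2 * j + 3 ≤ r → b j + c j ≡ b′ j + c′ j
    sums zero le = zeroth-same [] id (λ _ _ → refl) refl z≤n le T₁
    sums (suc j) le = trans (sym (cong₂ _+_ (at-suc b) (at-suc c))) (trans
      (ends-same (steps j) (suc j) (≤-trans (≤-reflexive (length-steps j)) (n≤1+n j)) le)
      (cong₂ _+_ (at-suc b′) (at-suc c′)))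
      where
      at-suc : ∀ b → along (steps j) b 0 ≡ b (suc j)
      at-suc b = trans (along-steps j b 0) (cong b (+-comm j 1))

    -- Position 0 is the tail of the first arc and is weighed by `back`; a later i is weighed by
    -- `fwd` in passing, and j by the final factor. No such program gives the square at 0, which
    -- goes through the total of squares.
    products : ∀ i j → i ≤ j → 2 * j + 3 ≤ r → Product≡ b c b′ c′ i j
    products zero zero _ le = zeroth-same (fwd ∷ []) (λ x → x * x) (λ _ _ → refl) refl ≤-refl le T₂
    products zero (suc j) _ le = trans (sym (cong₂ _+_ (at-suc b) (at-suc c))) (trans
      (ends-same (back ∷ steps j) (suc j) (s≤s (≤-reflexive (length-steps j))) le)
      (cong₂ _+_ (at-suc b′) (at-suc c′)))
      where
      at-suc : ∀ b → along (back ∷ steps j) b 0 ≡ b 0 * b (suc j)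
      at-suc b = cong (b 0 *_) (trans (along-steps j b 0) (cong b (+-comm j 1)))
    products (suc i) j i<j le with m≤n⇒∃[o]m+o≡n i<j
    ... | e , refl = trans (sym (cong₂ _+_ (at-both b) (at-both c))) (trans
      (ends-same (steps i ++ fwd ∷ steps e) (suc i + e) len le)
      (cong₂ _+_ (at-both b′) (at-both c′)))
      where
      len : length (steps i ++ fwd ∷ steps e) ≤ suc i + e
      len = ≤-reflexive (trans (length-++ (steps i)) (trans (cong₂ (λ x y → x + suc y) (length-steps i) (length-steps e)) (+-suc i e)))
      at-both : ∀ b → along (steps i ++ fwd ∷ steps e) b 0 ≡ b (suc i) * b (suc i + e)
      at-both b = trans (along-steps-++ i (fwd ∷ steps e) b 0) (trans
        (cong (along (fwd ∷ steps e) b) (+-identityʳ i))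
        (cong (b (suc i) *_) (trans (along-steps e b i) (cong b (+-comm e (suc i))))))

    correlations : ∀ d → 2 * suc d ≤ r → Σ< r (correlation b c d) ≡ Σ< r (correlation b′ c′ d)
    correlations d le = trans (sym (correlation-spine S d)) (trans
      (total-≡ D (back ∷ steps d) (subst (λ l → 2 * (3 + suc l) ≤ n + 2) (sym (length-steps d)) (correlation-budget d le)))
      (correlation-spine T d))

    same-degrees : (S : Spine G r) → (∀ k → k < r → b′ k ≡ Spine.weights S k) → ∀ i → i < r → deg G (Spine.at S i) ≡ deg H (Spine.at T i)
    same-degrees S h i i<r = trans (deg-excess G (Spine.deg≢0 S _)) (trans
      (cong suc (trans (sym (Spine.weights-at S i<r)) (trans (sym (h i i<r)) (Spine.weights-at T i<r))))
      (sym (deg-excess H (Spine.deg≢0 T _))))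

  isomorphic : G ≅ H
  isomorphic = [ spines-isomorphic S T ∘ same-degrees S , spines-isomorphic (reverse S) T ∘ same-degrees (reverse S) ]′
    (determined 1≤r (spine-mirror S) (spine-mirror T) T₁ T₂ sums products correlations)

-- From the degree sequence to the size estimate

module _ {n} (G : Graph (Fin n)) where

  nonLeafDegrees⁻ : ∀ {d} → d ∈ nonLeafDegrees G → ∃ λ v → isNonLeaf G v ≡ true × d ≡ deg G v
  nonLeafDegrees⁻ d∈ with ∈-map⁻ (deg G) d∈
  ... | v , v∈ , e = v , ∈-members⁻ (isNonLeaf G) v∈ , e

  nonLeafDegrees⁺ : ∀ {v} → isNonLeaf G v ≡ true → deg G v ∈ nonLeafDegrees G
  nonLeafDegrees⁺ iv = ∈-map⁺ (deg G) (∈-members⁺ (isNonLeaf G) iv)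

  nonLeafDegrees≥2 : ∀ {d} → d ∈ nonLeafDegrees G → 2 ≤ d
  nonLeafDegrees≥2 d∈ with nonLeafDegrees⁻ d∈
  ... | v , iv , refl = nonLeaf-deg G iv

  sum-nonLeafDegrees : nonLeafDegreeSum G ≡ sumᴸ (nonLeafDegrees G)
  sum-nonLeafDegrees = trans (sym (sum-map-allFin λ v → ⟦ isNonLeaf G v ⟧ * deg G v)) (go (allFin n))
    where
    go : ∀ xs → sumᴸ (map (λ v → ⟦ isNonLeaf G v ⟧ * deg G v) xs) ≡ sumᴸ (map (deg G) (filterᵇ (isNonLeaf G) xs))
    go [] = refl
    go (x ∷ xs) with isNonLeaf G x
    ... | true = cong₂ _+_ (+-identityʳ (deg G x)) (go xs)
    ... | false = go xs

  -- The n - r leaves take up what the nonleaf degrees leave over after the spine edges, namely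
  -- their sum minus 2 (r - 1).
  size-by-degrees : ∀ {r} → Spine G r → n + 2 * pred r ≡ r + sumᴸ (nonLeafDegrees G)
  size-by-degrees {r} S = trans (+-cancelʳ-≡ P _ _ (begin
    n + 2 * pred r + P  ≡⟨ swap n (2 * pred r) P ⟩
    n + P + 2 * pred r  ≡⟨ cong₂ _+_ (vertices-by-degree G) (sym (nonLeafPairs-spine S)) ⟩
    sum (λ v → ⟦ isNonLeaf G v ⟧) + isolated G + edges G + nonLeafPairs G
                ≡⟨ cong₂ (λ a b → a + b + edges G + nonLeafPairs G) (nonLeafCount-spine S) (isolated-spine S) ⟩
    r + 0 + edges G + nonLeafPairs G  ≡⟨ +-assoc (r + 0) (edges G) _ ⟩
    r + 0 + (edges G + nonLeafPairs G)  ≡⟨ cong₂ _+_ (+-identityʳ r) (trans (edges-by-leaves G) (cong (P + P +_) (leafPairs-spine S))) ⟩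
    r + (P + P + 0)  ≡⟨ trans (cong (r +_) (+-identityʳ (P + P))) (sym (+-assoc r P P)) ⟩
    r + P + P  ∎)) (cong (r +_) sum-nonLeafDegrees)
    where
    open ≡-Reasoning
    P = nonLeafDegreeSum G
    swap : ∀ a b c → a + b + c ≡ a + c + b
    swap = solve-∀

sum-≥2 : ∀ xs → (∀ {x} → x ∈ xs → 2 ≤ x) → 2 * length xs ≤ sumᴸ xs
sum-≥2 [] h = z≤n
sum-≥2 (x ∷ xs) h = ≤-trans (≤-reflexive (*-suc 2 (length xs))) (+-mono-≤ (h (here refl)) (sum-≥2 xs (h ∘ there)))

caterpillar-reconstructible : (n : ℕ) (G : Graph (Fin n)) → 48 ≤ n → IsCaterpillar G →
  (d₁ d₂ d₃ d₄ : ℕ) (rest : List ℕ) →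
  (d₁ ∷ d₂ ∷ d₃ ∷ d₄ ∷ rest) ↭ nonLeafDegrees G →
  Linked (λ a b → b ≤ a) (d₁ ∷ d₂ ∷ d₃ ∷ d₄ ∷ rest) →
  n ≤ 2 * length (nonLeafDegrees G) + 5 →
  d₁ ≡ d₃ → d₄ < d₃ → 2 < d₄ →
  (H : Graph (Fin n)) → SameDeck G H → G ≅ H
caterpillar-reconstructible n G 48≤n cat d₁ d₂ .d₁ d₄ rest perm sorted@(_ ∷ d₃≤d₂ ∷ _) n≤2r+5 refl d₄<d₁ 2<d₄ H D =
  Compare.isomorphic {M = M} D S spineᴴ ≤K ≤Kᴴ r+3M+3≤n 2≤M (subst (1 ≤_) r≡ (s≤s z≤n))
  where
  r M : ℕ
  r = length (nonLeafDegrees G)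
  M = d₁ ∸ 2

  r≡ : 4 + length rest ≡ r
  r≡ = ↭-length perm

  4≤d₁ : 4 ≤ d₁
  4≤d₁ = ≤-trans (s≤s 2<d₄) d₄<d₁

  M+2≡d₁ : M + 2 ≡ d₁
  M+2≡d₁ = m∸n+n≡m (≤-trans (s≤s (s≤s z≤n)) 4≤d₁)

  2≤M : 2 ≤ M
  2≤M = ∸-monoˡ-≤ 2 4≤d₁

  top = nonLeafDegrees⁻ G (∈-resp-↭ perm (here refl))

  S : Spine G r
  S = caterpillar-spine G (≤-trans (s≤s (s≤s z≤n)) 48≤n) (proj₁ (proj₂ top)) cat

  ≤d₁ : ∀ {d} → d ∈ nonLeafDegrees G → d ≤ d₁
  ≤d₁ d∈ = All.lookup (Linkedₚ.Linked⇒All (λ p q → ≤-trans q p) (≤-refl {d₁}) sorted) (∈-resp-↭ (↭-sym perm) d∈)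

  bound : ∀ v → deg G v ≤ M + 2
  bound v with isNonLeaf G v in iv
  ... | true = subst (deg G v ≤_) (sym M+2≡d₁) (≤d₁ (nonLeafDegrees⁺ G iv))
  ... | false = ≤-trans (≤pred⇒≤1+ (leaf-excess G iv)) (≤-trans (s≤s z≤n) (m≤n+m 2 M))
    where
    ≤pred⇒≤1+ : ∀ {d} → pred d ≡ 0 → d ≤ 1
    ≤pred⇒≤1+ {zero} _ = z≤n
    ≤pred⇒≤1+ {suc d} refl = ≤-refl

  degrees : sumᴸ (nonLeafDegrees G) ≡ d₁ + (d₂ + (d₁ + (d₄ + sumᴸ rest)))
  degrees = sym (sum-↭ perm)

  -- Since d₂ ≥ d₃ = d₁, three degrees are at least M + 2; the fourth is at least 3 and all others
  -- are at least 2.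
  many : M + 2 + (M + 2 + (M + 2 + (3 + 2 * length rest))) ≤ sumᴸ (nonLeafDegrees G)
  many = subst₂ _≤_ (cong (λ d → d + (d + (d + (3 + 2 * length rest)))) (sym M+2≡d₁)) (sym degrees)
    (+-monoʳ-≤ d₁ (+-mono-≤ d₃≤d₂ (+-monoʳ-≤ d₁ (+-mono-≤ 2<d₄
      (sum-≥2 rest λ x∈ → nonLeafDegrees≥2 G (∈-resp-↭ perm (there (there (there (there x∈))))))))))

  r+3M+3≤n : r + 3 * M + 3 ≤ n
  r+3M+3≤n = subst (λ r → r + 3 * M + 3 ≤ n) r≡ (≤-linear 0 0 many (begin
    1 * (4 + ℓ + 3 * M + 3) + P + 0  ≡⟨ left ℓ M P ⟩
    (4 + ℓ + P) + (3 * M + 3)  ≡⟨ cong (_+ (3 * M + 3)) (subst (λ r → n + 2 * pred r ≡ r + P) (sym r≡) (size-by-degrees G S)) ⟨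
    (n + 2 * (3 + ℓ)) + (3 * M + 3)  ≡⟨ right n ℓ M ⟩
    1 * n + (M + 2 + (M + 2 + (M + 2 + (3 + 2 * ℓ))))  ∎))
    where
    open ≡-Reasoning
    ℓ = length rest
    P = sumᴸ (nonLeafDegrees G)
    left : ∀ ℓ M P → 1 * (4 + ℓ + 3 * M + 3) + P + 0 ≡ (4 + ℓ + P) + (3 * M + 3)
    left = solve-∀
    right : ∀ n ℓ M → (n + 2 * (3 + ℓ)) + (3 * M + 3) ≡ 1 * n + (M + 2 + (M + 2 + (M + 2 + (3 + 2 * ℓ))))
    right = solve-∀

  open Setting D S (proj₂ (proj₁ cat)) bound r+3M+3≤n n≤2r+5 48≤n 2≤M using (≤K; ≤Kᴴ; spineᴴ)

theorem6p5 : (n : ℕ) (G : Graph (Fin n)) → 48 ≤ n → IsCaterpillar G →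
    (d₁ d₂ d₃ d₄ : ℕ) (rest : List ℕ) →
    (d₁ ∷ d₂ ∷ d₃ ∷ d₄ ∷ rest) ↭ nonLeafDegrees G →
    Linked (λ a b → b ≤ a) (d₁ ∷ d₂ ∷ d₃ ∷ d₄ ∷ rest) →
    n ≤ 2 * length (nonLeafDegrees G) + 5 →
    d₁ ≡ d₃ → d₄ < d₃ → 2 < d₄ →
    (m : ℕ) (H : Graph (Fin m)) → SameDeck G H → G ≅ H
theorem6p5 n G 48≤n cat d₁ d₂ d₃ d₄ rest perm sorted n≤2r+5 d₁≡d₃ d₄<d₃ 2<d₄ m H D
  -- Cards with one vertex show that both graphs have equally many vertices.
  with refl ← ≤-antisym (SameDeck⇒≤ D) (SameDeck⇒≤ (SameDeck-sym D)) =
  caterpillar-reconstructible n G 48≤n cat d₁ d₂ d₃ d₄ rest perm sorted n≤2r+5 d₁≡d₃ d₄<d₃ 2<d₄ H D
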